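{- Let $G$ be a finite simple graph that is a unigraph, i.e., every graph with the same degree sequence as $G$ is isomorphic to $G$. Then the clique-width of $G$ is at most $5$.
   Context: The clique-width $\mathrm{cw}(G)$ of a graph $G$ is the minimum number $k$ of labels from $\{1,\dots,k\}$ needed to construct $G$ (as a vertex-labeled graph, with arbitrary final labels) using the operations: (i) $v(i)$: create a new single vertex $v$ with label $i$; (ii) $\oplus$: disjoint union of two labeled graphs; (iii) $\eta_{i,j}$ ($i\neq j$): add all edges between every vertex with label $i$ and every vertex with label $j$; (iv) $\rho_{i\to j}$: change the label of every vertex with label $i$ to $j$. -}

module Defs where

open import Data.Nat using (ℕ; zero; suc; _+_)
open import Data.Fin using (Fin; splitAt; _≟_)
open import Data.Bool using (Bool; true; false; _∨_; _∧_; if_then_else_)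
open import Data.Sum using (inj₁; inj₂)
open import Data.Product using (Σ; _×_; _,_; proj₁)
open import Data.List using (List; length; filter)
open import Data.Fin.Base using ()
open import Data.List using (allFin)
open import Relation.Binary.PropositionalEquality using (_≡_)
open import Relation.Nullary using (¬_)
open import Relation.Nullary.Decidable using (⌊_⌋)
open import Function.Bundles using (_↔_; Inverse)

record Graph (n : ℕ) : Set where
  field
    adj   : Fin n → Fin n → Bool
    sym   : ∀ u v → adj u v ≡ adj v u
    irrefl : ∀ v → adj v v ≡ false
open Graph public

deg : ∀ {n} → Graph n → Fin n → ℕ
deg G v = length (filter (λ u → adj G v u Data.Bool.≟ true) (allFin _))

_≅_ : ∀ {n m} → Graph n → Graph m → Set
_≅_ {n} {m} G H = Σ (Fin n ↔ Fin m) λ σ →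
  ∀ u v → adj H (Inverse.to σ u) (Inverse.to σ v) ≡ adj G u v

SameDegSeq : ∀ {n m} → Graph n → Graph m → Set
SameDegSeq {n} {m} G H = Σ (Fin n ↔ Fin m) λ σ →
  ∀ v → deg H (Inverse.to σ v) ≡ deg G v

Unigraph : ∀ {n} → Graph n → Set
Unigraph {n} G = ∀ {m} (H : Graph m) → SameDegSeq G H → G ≅ H

data CWExpr (k : ℕ) : ℕ → Set where
  vtx : Fin k → CWExpr k 1
  _⊕_ : ∀ {a b} → CWExpr k a → CWExpr k b → CWExpr k (a + b)
  η   : ∀ {a} (i j : Fin k) → ¬ (i ≡ j) → CWExpr k a → CWExpr k a
  ρ   : ∀ {a} (i j : Fin k) → CWExpr k a → CWExpr k a

label : ∀ {k a} → CWExpr k a → Fin a → Fin k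
label (vtx i) _ = i
label (_⊕_ {a} e f) x with splitAt a x
... | inj₁ y = label e y
... | inj₂ y = label f y
label (η i j _ e) x = label e x
label (ρ i j e) x = if ⌊ label e x ≟ i ⌋ then j else label e x

edge : ∀ {k a} → CWExpr k a → Fin a → Fin a → Bool
edge (vtx i) _ _ = false
edge (_⊕_ {a} e f) x y with splitAt a x | splitAt a y
... | inj₁ x' | inj₁ y' = edge e x' y'
... | inj₂ x' | inj₂ y' = edge f x' y'
... | _ | _ = false
edge (η i j _ e) x y =
  edge e x y ∨ (⌊ label e x ≟ i ⌋ ∧ ⌊ label e y ≟ j ⌋)
             ∨ (⌊ label e x ≟ j ⌋ ∧ ⌊ label e y ≟ i ⌋)
edge (ρ i j e) x y = edge e x y

CwAtMost : ∀ {n} → ℕ → Graph n → Set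
CwAtMost {n} k G = Σ (CWExpr k n) λ e → Σ (Fin n ↔ Fin n) λ σ →
  ∀ u v → edge e (Inverse.to σ u) (Inverse.to σ v) ≡ adj G u v

{-# OPTIONS --safe #-}
-- Switching an alternating 4-cycle preserves all degrees, so in a unigraph it yields an isomorphic graph. Counting
-- edges between degree classes, or vertices with a given number of neighbours in a union of degree classes, before
-- and after one switch gives two local restrictions (Alt⇒deg, private-nbrs). They force the following structure.
-- If some degree class is neither a clique nor independent, then the vertices outside it are, with at most one
-- exception, complete or anticomplete to it, and they form a split graph; otherwise G itself is split. A split
-- unigraph is a nested composition of split graphs in which one side has constant degree, and there either every
-- vertex of that side has exactly one (non-)neighbour, or all but one vertex of the other side have equal degrees.
-- No finer classification is needed: a unigraph is isomorphic to every graph with its degrees, so it suffices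
-- to build some graph with these degrees from 5 labels. For the near-regular parts this is a Euclidean algorithm:
-- peel off complete (bipartite) blocks, and pass to the complement when the density exceeds one half.

module Submission where

open import Defs renaming (sym to adj-sym; irrefl to adj-irrefl)
open import Data.Bool using (Bool; true; false; not; _∧_; _∨_; _xor_; if_then_else_) renaming (_≟_ to _≟ᵇ_)
open import Data.Bool.Properties using (∧-comm; ∨-comm; ∧-zeroʳ; ∧-identityʳ; ∨-identityʳ; not-involutive)
open import Data.Empty using (⊥; ⊥-elim)
open import Data.Fin using (Fin; zero; suc; _≟_; splitAt; _↑ˡ_; _↑ʳ_; cast)
open import Data.Fin.Patterns using (0F; 1F; 2F; 3F; 4F)
open import Data.Fin.Permutation using (Permutation; cast-id)
open import Data.Fin.Properties using (any?; splitAt-↑ˡ; splitAt-↑ʳ; cast-involutive)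
open import Data.List using (List; []; _∷_; _++_; map; length; lookup; replicate; tabulate; filter; allFin; cartesianProduct)
open import Data.List.Membership.Propositional using (_∈_)
open import Data.List.Membership.Propositional.Properties using (∈-cartesianProduct⁺; ∈-allFin)
open import Data.List.Relation.Binary.Permutation.Homogeneous using (onIndices)
open import Data.List.Relation.Binary.Permutation.Setoid.Properties using (onIndices-lookup)
open import Data.List.Relation.Unary.Any using (here; there)
open import Data.List.Relation.Unary.All.Properties using (tabulate⁻)
open import Data.List.Properties using (map-++; map-∘; map-cong; length-tabulate; lookup-tabulate; tabulate-cong; map-tabulate; map-replicate; ++-assoc; ++-identityʳ)
open import Data.List.Relation.Binary.Permutation.Propositional
  using (_↭_; ↭-refl; ↭-sym; ↭-trans; ↭-reflexive; prep; ↭⇒↭ₛ)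
  renaming (refl to ↭refl; swap to ↭swap; trans to ↭trans)
open import Data.List.Relation.Binary.Permutation.Propositional.Properties using (All-resp-↭; map⁺; ++⁺; ++⁺ˡ; ++⁺ʳ; ++-comm; shift; ↭-empty-inv)
open import Data.List.Relation.Unary.All using (All; []; _∷_)
open import Data.Nat using (ℕ; zero; suc; pred; _+_; _*_; _∸_; _≤_; _<_; _≤?_; _<?_; z≤n; s≤s) renaming (_≟_ to _≟ⁿ_)
open import Data.Nat.Induction using (<-rec)
open import Data.Nat.Properties
  hiding (_≟_; _≤?_; _<?_)
open import Algebra.Properties.CommutativeMonoid.Sum +-0-commutativeMonoid
  using (sum; sum-cong-≗; ∑-distrib-+; ∑-comm; sum-permute)
open import Data.Nat.Tactic.RingSolver using (solve-∀)
open import Data.Product using (Σ; ∃; _×_; _,_; proj₁; proj₂)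
open import Data.Sum using (_⊎_; inj₁; inj₂; [_,_]′)
open import Function using (_∘_; id; flip; case_of_)
open import Function.Bundles using (_↔_; Inverse)
open import Function.Construct.Composition using (_↔-∘_)
open import Function.Construct.Symmetry using (↔-sym)
open import Function.Construct.Identity using (↔-id)
open import Relation.Binary.PropositionalEquality using (_≡_; _≢_; _≗_; refl; sym; trans; cong; cong₂; subst; subst₂; setoid; module ≡-Reasoning)
open import Relation.Binary.Definitions using (tri<; tri≈; tri>)
open import Relation.Nullary using (¬_; Dec; yes; no)
open import Relation.Nullary.Decidable using (⌊_⌋; _×-dec_; ¬?)

-- The property `Good` asks only for some 5-expression with the labelled degrees and codegrees of an
-- induced subgraph. Since a join depends on labels alone, the parts of G can be realised
-- independently of each other, and no part has to be a unigraph itself: the hypothesis on G serves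
-- to derive structure, and once more at the end to identify the graph that was built. The
-- structural steps often need an alternating 4-cycle that is not present. It is then produced by a
-- preliminary switch, which is legitimate because a graph with the same degrees as a unigraph is a
-- unigraph. In a near-regular part, the obvious necessary conditions (such as an even degree sum,
-- or equal edge counts from both sides) turn out to be sufficient, and they are preserved when a
-- complete block is peeled off. The fifth label comes from there: one label for the exceptional
-- vertex, two for the rows and columns built so far, and two for the block being attached.
-- Composing split graphs takes four, two for each factor.

bool-cases : ∀ b → b ≡ true ⊎ b ≡ false
bool-cases true  = inj₁ refl
bool-cases false = inj₂ refl

true≢false : ∀ {b} → b ≡ true → b ≡ false → ⊥
true≢false refl ()

not-true : ∀ {b} → ¬ (b ≡ true) → b ≡ false
not-true {true}  h = ⊥-elim (h refl)
not-true {false} _ = refl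

not-false : ∀ {b} → ¬ (b ≡ false) → b ≡ true
not-false {true}  _ = refl
not-false {false} h = ⊥-elim (h refl)

∧-intro : ∀ {a b} → a ≡ true → b ≡ true → a ∧ b ≡ true
∧-intro refl refl = refl

∧-elimˡ : ∀ {a b} → a ∧ b ≡ true → a ≡ true
∧-elimˡ {true} _ = refl

∧-elimʳ : ∀ {a b} → a ∧ b ≡ true → b ≡ true
∧-elimʳ {true} h = h

∨-elim : ∀ {a b} → a ∨ b ≡ true → a ≡ true ⊎ b ≡ true
∨-elim {true}  _ = inj₁ refl
∨-elim {false} h = inj₂ h

∨-falseˡ : ∀ {a b} → a ∨ b ≡ false → a ≡ false
∨-falseˡ {false} _ = refl

∨-falseʳ : ∀ {a b} → a ∨ b ≡ false → b ≡ false
∨-falseʳ {false} h = h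

∨-introˡ : ∀ {a b} → a ≡ true → a ∨ b ≡ true
∨-introˡ refl = refl

∨-introʳ : ∀ {a b} → b ≡ true → a ∨ b ≡ true
∨-introʳ {true}  refl = refl
∨-introʳ {false} refl = refl

not-elim : ∀ {b} → not b ≡ true → b ≡ false
not-elim {false} _ = refl

not-intro : ∀ {b} → b ≡ false → not b ≡ true
not-intro refl = refl

bool-ext : ∀ {a b} → (a ≡ true → b ≡ true) → (b ≡ true → a ≡ true) → a ≡ b
bool-ext {true}  {true}  _ _ = refl
bool-ext {true}  {false} f _ = sym (f refl)
bool-ext {false} {true}  _ g = g refl
bool-ext {false} {false} _ _ = refl

module _ {n : ℕ} where

  infix 7 _==_
  _==_ : Fin n → Fin n → Bool
  x == y = ⌊ x ≟ y ⌋

  ==-refl : ∀ x → x == x ≡ true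
  ==-refl x with x ≟ x
  ... | yes _ = refl
  ... | no  h = ⊥-elim (h refl)

  ==-≢ : ∀ {x y} → x ≢ y → x == y ≡ false
  ==-≢ {x} {y} h with x ≟ y
  ... | yes p = ⊥-elim (h p)
  ... | no  _ = refl

  ==-true : ∀ {x y} → x == y ≡ true → x ≡ y
  ==-true {x} {y} h with x ≟ y
  ... | yes p = p

  ==-false : ∀ {x y} → x == y ≡ false → x ≢ y
  ==-false h refl = true≢false (==-refl _) h

  ==-comm : ∀ x y → x == y ≡ y == x
  ==-comm x y with x ≟ y
  ... | yes refl = sym (==-refl x)
  ... | no  h    = sym (==-≢ (h ∘ sym))

-- Counting in Boolean subsets of a finite set

b2n : Bool → ℕ
b2n true  = 1
b2n false = 0

# : ∀ {n} → (Fin n → Bool) → ℕ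
# {zero}  f = 0
# {suc n} f = b2n (f zero) + # (f ∘ suc)

#-sum : ∀ {n} (f : Fin n → Bool) → # f ≡ sum (b2n ∘ f)
#-sum {zero}  f = refl
#-sum {suc n} f = cong (b2n (f zero) +_) (#-sum (f ∘ suc))

infixl 6 _∩_ _∖_
infixl 5 _∪_
infix 4 _⊆_
_∩_ _∪_ : ∀ {n} → (Fin n → Bool) → (Fin n → Bool) → Fin n → Bool
(f ∩ g) x = f x ∧ g x
(f ∪ g) x = f x ∨ g x

∁ : ∀ {n} → (Fin n → Bool) → Fin n → Bool
∁ f x = not (f x)

_∖_ : ∀ {n} → (Fin n → Bool) → Fin n → Fin n → Bool
(f ∖ p) x = f x ∧ not (x == p)

⟦_⟧ : ∀ {n} → Fin n → Fin n → Bool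
⟦ p ⟧ x = x == p

full : ∀ {n} → Fin n → Bool
full _ = true

#-cong : ∀ {n} {f g : Fin n → Bool} → f ≗ g → # f ≡ # g
#-cong {zero}  h = refl
#-cong {suc n} h = cong₂ _+_ (cong b2n (h zero)) (#-cong (h ∘ suc))

#-split : ∀ {n} (f g : Fin n → Bool) → # f ≡ # (f ∩ g) + # (f ∩ ∁ g)
#-split f g = begin
  # f                                               ≡⟨ #-sum f ⟩
  sum (b2n ∘ f)                                     ≡⟨ sum-cong-≗ (λ x → lem (f x) (g x)) ⟩
  sum (λ x → b2n ((f ∩ g) x) + b2n ((f ∩ ∁ g) x))   ≡⟨ ∑-distrib-+ (b2n ∘ (f ∩ g)) (b2n ∘ (f ∩ ∁ g)) ⟩
  sum (b2n ∘ (f ∩ g)) + sum (b2n ∘ (f ∩ ∁ g))       ≡⟨ cong₂ _+_ (#-sum (f ∩ g)) (#-sum (f ∩ ∁ g)) ⟨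
  # (f ∩ g) + # (f ∩ ∁ g)                           ∎
  where
  open ≡-Reasoning
  lem : ∀ a b → b2n a ≡ b2n (a ∧ b) + b2n (a ∧ not b)
  lem true  true  = refl
  lem true  false = refl
  lem false _     = refl

sum-mono : ∀ {n} {f g : Fin n → ℕ} → (∀ x → f x ≤ g x) → sum f ≤ sum g
sum-mono {zero}  h = z≤n
sum-mono {suc n} h = +-mono-≤ (h zero) (sum-mono (h ∘ suc))

sum-mono-< : ∀ {n} {f g : Fin n → ℕ} → (∀ x → f x ≤ g x) → ∀ p → f p < g p → sum f < sum g
sum-mono-< h zero    lt = +-mono-<-≤ lt (sum-mono (h ∘ suc))
sum-mono-< h (suc p) lt = +-mono-≤-< (h zero) (sum-mono-< (h ∘ suc) p lt)

b2n-mono : ∀ {a b} → (a ≡ true → b ≡ true) → b2n a ≤ b2n b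
b2n-mono {true}  h rewrite h refl = ≤-refl
b2n-mono {false} h = z≤n

_⊆_ : ∀ {n} → (Fin n → Bool) → (Fin n → Bool) → Set
f ⊆ g = ∀ x → f x ≡ true → g x ≡ true

#-mono : ∀ {n} {f g : Fin n → Bool} → f ⊆ g → # f ≤ # g
#-mono {f = f} {g} h = subst₂ _≤_ (sym (#-sum f)) (sym (#-sum g)) (sum-mono (λ x → b2n-mono (h x)))

#-mono-< : ∀ {n} {f g : Fin n → Bool} → f ⊆ g → ∀ p → f p ≡ false → g p ≡ true → # f < # g
#-mono-< {f = f} {g} h p fp gp = subst₂ _<_ (sym (#-sum f)) (sym (#-sum g))
  (sum-mono-< (λ x → b2n-mono (h x)) p (lem fp gp))
  where
  lem : ∀ {a b} → a ≡ false → b ≡ true → b2n a < b2n b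
  lem refl refl = ≤-refl

#-none : ∀ {n} {f : Fin n → Bool} → (∀ x → f x ≡ false) → # f ≡ 0
#-none {zero}  h = refl
#-none {suc n} h rewrite h zero = #-none (h ∘ suc)

#≡0 : ∀ {n} {f : Fin n → Bool} → # f ≡ 0 → ∀ x → f x ≡ false
#≡0 {suc n} {f} h zero with f zero
... | false = refl
#≡0 {suc n} {f} h (suc x) = #≡0 (m+n≡0⇒n≡0 (b2n (f zero)) h) x

#-⟦⟧ : ∀ {n} (f : Fin n → Bool) p → # (f ∩ ⟦ p ⟧) ≡ b2n (f p)
#-⟦⟧ f zero = trans (cong₂ _+_ (cong b2n (∧-identityʳ (f zero))) (#-none (λ x → ∧-zeroʳ (f (suc x))))) (+-identityʳ _)
#-⟦⟧ f (suc p) = cong₂ _+_ (cong b2n (∧-zeroʳ (f zero))) (trans (#-cong (λ x → cong (f (suc x) ∧_) (lem x))) (#-⟦⟧ (f ∘ suc) p))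
  where
  lem : ∀ x → suc x == suc p ≡ x == p
  lem x with x ≟ p
  ... | yes _ = refl
  ... | no  _ = refl

#-point : ∀ {n} (f : Fin n → Bool) p → # f ≡ b2n (f p) + # (f ∖ p)
#-point f p = trans (#-split f ⟦ p ⟧) (cong (_+ # (f ∖ p)) (#-⟦⟧ f p))

#-pos : ∀ {n} (f : Fin n → Bool) {p} → f p ≡ true → 1 ≤ # f
#-pos f {p} h rewrite #-point f p | h = s≤s z≤n

find? : ∀ {n} (f : Fin n → Bool) → (∃ λ x → f x ≡ true) ⊎ (∀ x → f x ≡ false)
find? f with any? (λ x → f x ≟ᵇ true)
... | yes p = inj₁ p
... | no ¬p = inj₂ (λ x → not-true (λ h → ¬p (x , h)))

#-find : ∀ {n} (f : Fin n → Bool) → 1 ≤ # f → ∃ λ x → f x ≡ true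
#-find f h with find? f
... | inj₁ p = p
... | inj₂ ¬p rewrite #-none ¬p = case h of λ ()

∩-find? : ∀ {n} (f g : Fin n → Bool) → (∃ λ x → f x ≡ true × g x ≡ false) ⊎ f ⊆ g
∩-find? f g with find? (f ∩ ∁ g)
... | inj₁ (x , h) = inj₁ (x , ∧-elimˡ h , not-elim (∧-elimʳ {f x} h))
... | inj₂ h = inj₂ λ x fx → not-false (λ gx → true≢false (∧-intro fx (not-intro gx)) (h x))

#-exchange : ∀ {n} {f g : Fin n → Bool} → # f ≤ # g → ∀ {p} → f p ≡ true → g p ≡ false →
             ∃ λ q → g q ≡ true × f q ≡ false
#-exchange {f = f} {g} le {p} fp gp with ∩-find? g f
... | inj₁ w = w
... | inj₂ s = ⊥-elim (<⇒≱ (#-mono-< s p gp fp) le)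

⊆-antisym-# : ∀ {n} {f g : Fin n → Bool} → f ⊆ g → # g ≤ # f → g ⊆ f
⊆-antisym-# {f = f} {g} s le x gx with bool-cases (f x)
... | inj₁ fx = fx
... | inj₂ fx = ⊥-elim (<⇒≱ (#-mono-< s x fx gx) le)

#-perm : ∀ {n m} (σ : Fin n ↔ Fin m) (f : Fin m → Bool) → # (f ∘ Inverse.to σ) ≡ # f
#-perm σ f = trans (#-sum (f ∘ Inverse.to σ)) (trans (sym (sum-permute (b2n ∘ f) σ)) (sym (#-sum f)))

#-full : ∀ n → # (full {n}) ≡ n
#-full zero    = refl
#-full (suc n) = cong suc (#-full n)

argmax : ∀ {n} (S : Fin n → Bool) (w : Fin n → ℕ) {p} → S p ≡ true →
         ∃ λ a → S a ≡ true × (∀ x → S x ≡ true → w x ≤ w a)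
argmax {suc n} S w {p} Sp with find? (S ∘ suc)
argmax {suc n} S w {zero}  Sp | inj₂ h = zero , Sp , λ { zero _ → ≤-refl ; (suc x) k → ⊥-elim (true≢false k (h x)) }
argmax {suc n} S w {suc p} Sp | inj₂ h = ⊥-elim (true≢false Sp (h p))
argmax {suc n} S w {p} Sp | inj₁ (q , Sq) with argmax (S ∘ suc) (w ∘ suc) Sq
... | a , Sa , ma with bool-cases (S zero) | ≤-total (w zero) (w (suc a))
... | inj₂ S0 | _       = suc a , Sa , λ { zero k → ⊥-elim (true≢false k S0) ; (suc x) k → ma x k }
... | inj₁ _  | inj₁ le = suc a , Sa , λ { zero _ → le ; (suc x) k → ma x k }
... | inj₁ S0 | inj₂ le = zero , S0 , λ { zero _ → ≤-refl ; (suc x) k → ≤-trans (ma x k) le }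

filter-tabulate : ∀ {n m} (f : Fin m → Bool) (g : Fin n → Fin m) →
                  length (filter (λ u → f u ≟ᵇ true) (tabulate g)) ≡ # (f ∘ g)
filter-tabulate {zero}  f g = refl
filter-tabulate {suc n} f g with f (g zero)
... | true  = cong suc (filter-tabulate f (g ∘ suc))
... | false = filter-tabulate f (g ∘ suc)

-- Degrees, unigraphs and complements

dg : ∀ {n} → Graph n → Fin n → ℕ
dg G v = # (adj G v)

deg≡dg : ∀ {n} (G : Graph n) v → deg G v ≡ dg G v
deg≡dg G v = filter-tabulate (adj G v) id

SameDeg : ∀ {n} → Graph n → Graph n → Set
SameDeg G H = ∀ v → dg H v ≡ dg G v

module _ {n m : ℕ} {G : Graph n} {H : Graph m} where

  ≅-# : ((σ , _) : G ≅ H) (f : Fin n → Bool) (g : Fin m → Bool) → (∀ u → g (Inverse.to σ u) ≡ f u) →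
        ∀ v → # (adj H (Inverse.to σ v) ∩ g) ≡ # (adj G v ∩ f)
  ≅-# (σ , h) f g fg v = trans (sym (#-perm σ _)) (#-cong (λ u → cong₂ _∧_ (h v u) (fg u)))

  ≅-dg : ((σ , _) : G ≅ H) → ∀ v → dg H (Inverse.to σ v) ≡ dg G v
  ≅-dg (σ , h) v = trans (sym (#-perm σ _)) (#-cong (h v))

-- A record, so that the graph can be inferred from a proof.
record Rigid {n} (G : Graph n) : Set where
  constructor rigid
  field unigraph : Unigraph G
open Rigid

-- Being a unigraph depends on the degree sequence alone. This is what allows switches to be made
-- one after another.
Rigid-resp : ∀ {n} {G H : Graph n} → SameDeg G H → Rigid G → Rigid H
Rigid-resp {n} {G} {H} s (rigid U) .unigraph {m} K (π , k) = τ , iso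
  where
  G≅K : G ≅ K
  G≅K = U K (π , λ v → trans (k v) (trans (deg≡dg H v) (trans (s v) (sym (deg≡dg G v)))))
  G≅H : G ≅ H
  G≅H = U H (↔-id _ , λ v → trans (deg≡dg H v) (trans (s v) (sym (deg≡dg G v))))
  σ₁ = proj₁ G≅K
  σ₂ = proj₁ G≅H
  τ : Fin n ↔ Fin m
  τ = σ₁ ↔-∘ ↔-sym σ₂
  iso : ∀ u v → adj K (Inverse.to τ u) (Inverse.to τ v) ≡ adj H u v
  iso u v = trans (proj₂ G≅K _ _) (trans (sym (proj₂ G≅H _ _))
              (cong₂ (adj H) (Inverse.strictlyInverseˡ σ₂ u) (Inverse.strictlyInverseˡ σ₂ v)))

co : ∀ {n} → Graph n → Graph n
co G .adj u v = not (adj G u v) ∧ not (u == v)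
co G .adj-sym u v = cong₂ _∧_ (cong not (adj-sym G u v)) (cong not (==-comm u v))
co G .adj-irrefl v = trans (cong (λ b → not (adj G v v) ∧ not b) (==-refl v)) (∧-zeroʳ _)

module _ {n} (G : Graph n) where

  adj⇒≢ : ∀ {u v} → adj G u v ≡ true → u ≢ v
  adj⇒≢ h refl = true≢false h (adj-irrefl G _)

  adj-swap : ∀ {u v b} → adj G u v ≡ b → adj G v u ≡ b
  adj-swap {u} {v} h = trans (adj-sym G v u) h

  co-true : ∀ {u v} → u ≢ v → adj G u v ≡ false → adj (co G) u v ≡ true
  co-true h e = ∧-intro (not-intro e) (not-intro (==-≢ h))

  co-false : ∀ {u v} → adj G u v ≡ true → adj (co G) u v ≡ false
  co-false e rewrite e = refl

  co-≢ : ∀ {u v} → u ≢ v → adj (co G) u v ≡ not (adj G u v)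
  co-≢ {u} {v} h rewrite ==-≢ h = ∧-identityʳ _

  -- The last summand is `v` itself, which is neither a neighbour nor a co-neighbour of `v`.
  co-split : ∀ (S : Fin n → Bool) v → # (S ∩ adj G v) + # (S ∩ adj (co G) v) + b2n (S v) ≡ # S
  co-split S v = begin
    # (S ∩ adj G v) + # (S ∩ adj (co G) v) + b2n (S v)
      ≡⟨ cong₂ (λ x y → x + y + b2n (S v)) (#-cong e₁) (#-cong e₂) ⟩
    # ((S ∖ v) ∩ adj G v) + # ((S ∖ v) ∩ ∁ (adj G v)) + b2n (S v)
      ≡⟨ cong (_+ b2n (S v)) (#-split (S ∖ v) (adj G v)) ⟨
    # (S ∖ v) + b2n (S v)
      ≡⟨ +-comm _ (b2n (S v)) ⟩
    b2n (S v) + # (S ∖ v)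
      ≡⟨ #-point S v ⟨
    # S ∎
    where
    open ≡-Reasoning
    e₁ : ∀ u → S u ∧ adj G v u ≡ (S u ∧ not (u == v)) ∧ adj G v u
    e₁ u with u ≟ v
    ... | yes refl rewrite adj-irrefl G u = trans (∧-zeroʳ (S u)) (sym (∧-zeroʳ _))
    ... | no _ = cong (_∧ adj G v u) (sym (∧-identityʳ (S u)))
    e₂ : ∀ u → S u ∧ adj (co G) v u ≡ (S u ∧ not (u == v)) ∧ not (adj G v u)
    e₂ u rewrite ==-comm v u with S u | adj G v u | u == v
    ... | false | _     | _     = refl
    ... | true  | true  | true  = refl
    ... | true  | true  | false = refl
    ... | true  | false | true  = refl
    ... | true  | false | false = refl

  co-co : ∀ u v → adj (co (co G)) u v ≡ adj G u v
  co-co u v with u ≟ v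
  ... | yes refl = trans (∧-zeroʳ _) (sym (adj-irrefl G u))
  ... | no h = trans (∧-identityʳ _) (trans (cong not (∧-identityʳ _)) (not-involutive _))

dg-co : ∀ {n} (G : Graph n) v → dg G v + dg (co G) v + 1 ≡ n
dg-co {n} G v = trans (co-split G full v) (#-full n)

dg-co-cancel : ∀ {n m} (G : Graph n) (H : Graph m) u v → n ≡ m → dg (co G) u ≡ dg (co H) v → dg G u ≡ dg H v
dg-co-cancel G H u v refl e = +-cancelʳ-≡ (dg (co G) u) _ _ (+-cancelʳ-≡ 1 _ _
  (trans (dg-co G u) (sym (trans (cong (λ z → dg H v + z + 1) e) (dg-co H v)))))

dg-co-cong : ∀ {n m} (G : Graph n) (H : Graph m) u v → n ≡ m → dg G u ≡ dg H v → dg (co G) u ≡ dg (co H) v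
dg-co-cong G H u v refl e = +-cancelˡ-≡ (dg G u) _ _ (+-cancelʳ-≡ 1 _ _
  (trans (dg-co G u) (sym (trans (cong (λ z → z + dg (co H) v + 1) e) (dg-co H v)))))

↔-size : ∀ {n m} → Fin n ↔ Fin m → n ≡ m
↔-size {n} {m} σ = trans (sym (#-full n)) (trans (#-perm σ full) (#-full m))

-- Complementation exchanges cliques with independent sets and neighbours with non-neighbours, so
-- many of the later statements are proved in one form and transported. The isomorphism of the
-- complements is injective, hence respects the diagonal as well.
Rigid-co : ∀ {n} {G : Graph n} → Rigid G → Rigid (co G)
Rigid-co {n} {G} (rigid U) .unigraph {m} K (σ , h) = τ , λ u v → begin
    adj K (to τ u) (to τ v)                        ≡⟨ co-co K _ _ ⟨
    adj (co (co K)) (to τ u) (to τ v)              ≡⟨ cong₂ (λ x y → not x ∧ not y) (i u v) (τ-== u v) ⟩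
    adj (co G) u v ∎
  where
  open ≡-Reasoning
  open Inverse using (to)
  d : ∀ v → deg (co K) (to σ v) ≡ deg G v
  d v = trans (deg≡dg (co K) _) (trans
    (trans (dg-co-cong K (co G) (to σ v) v (sym (↔-size σ))
      (trans (sym (deg≡dg K _)) (trans (h v) (deg≡dg (co G) v))))
      (#-cong (co-co G v))) (sym (deg≡dg G v)))
  τ = proj₁ (U (co K) (σ , d))
  i = proj₂ (U (co K) (σ , d))
  τ-== : ∀ u v → to τ u == to τ v ≡ u == v
  τ-== u v with u ≟ v
  ... | yes refl = ==-refl _
  ... | no ne = ==-≢ (λ e → ne (trans (sym (Inverse.strictlyInverseʳ τ u))
                  (trans (cong (Inverse.from τ) e) (Inverse.strictlyInverseʳ τ v))))

-- Switches

-- The edges `a b`, `c d` alternate with the non-edges `c b`, `a d`. Since `adj` is false on the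
-- diagonal too, `b≢c` and `a≢d` have to be demanded; the other inequalities follow.
record Alt {n} (G : Graph n) (a b c d : Fin n) : Set where
  field
    ab : adj G a b ≡ true
    cd : adj G c d ≡ true
    cb : adj G c b ≡ false
    ad : adj G a d ≡ false
    b≢c : b ≢ c
    a≢d : a ≢ d

-- This is one row of a switch: the neighbour `p` is traded for `q`. Subtraction is avoided by
-- moving the lost point to the left.
flip-# : ∀ {n} (f D : Fin n → Bool) {p q} → f p ≡ true → f q ≡ false →
         # ((λ y → f y xor (y == p ∨ y == q)) ∩ D) + b2n (D p) ≡ # (f ∩ D) + b2n (D q)
flip-# f D {p} {q} fp fq = begin
    # g′ + b2n (D p)
      ≡⟨ cong (_+ b2n (D p)) (trans (#-point g′ p) (cong (b2n (g′ p) +_) (#-point (g′ ∖ p) q))) ⟩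
    b2n (g′ p) + (b2n ((g′ ∖ p) q) + # (g′ ∖ p ∖ q)) + b2n (D p)
      ≡⟨ cong₂ (λ x y → b2n x + y + b2n (D p)) g′p (cong₂ _+_ (cong b2n g′q) (#-cong same)) ⟩
    b2n (D q) + r + b2n (D p)
      ≡⟨ shuffle (b2n (D q)) r (b2n (D p)) ⟩
    b2n (D p) + r + b2n (D q)
      ≡⟨ cong₂ (λ x y → b2n x + (b2n y + r) + b2n (D q)) gp gq ⟨
    b2n (g p) + (b2n ((g ∖ p) q) + r) + b2n (D q)
      ≡⟨ cong (_+ b2n (D q)) (trans (#-point g p) (cong (b2n (g p) +_) (#-point (g ∖ p) q))) ⟨
    # g + b2n (D q) ∎
  where
  open ≡-Reasoning
  shuffle : ∀ x y z → x + y + z ≡ z + y + x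
  shuffle = solve-∀
  g′ = (λ y → f y xor (y == p ∨ y == q)) ∩ D
  g  = f ∩ D
  r  = # (g ∖ p ∖ q)
  p≢q : q ≢ p
  p≢q refl = true≢false fp fq
  g′p : g′ p ≡ false
  g′p rewrite fp | ==-refl p = refl
  g′q : (g′ ∖ p) q ≡ D q
  g′q rewrite fq | ==-refl q | ==-≢ p≢q = ∧-identityʳ (D q)
  gp : g p ≡ D p
  gp rewrite fp = refl
  gq : (g ∖ p) q ≡ false
  gq rewrite fq = refl
  same : (g′ ∖ p ∖ q) ≗ (g ∖ p ∖ q)
  same y with y ≟ p | y ≟ q
  ... | yes _ | w     = trans (cong (_∧ not ⌊ w ⌋) (∧-zeroʳ _)) (sym (cong (_∧ not ⌊ w ⌋) (∧-zeroʳ (f y ∧ D y))))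
  ... | no _  | yes _ = trans (∧-zeroʳ _) (sym (∧-zeroʳ _))
  ... | no _  | no _ with f y
  ... | true  = refl
  ... | false = refl

module Switch {n} (G : Graph n) {a b c d : Fin n} (alt : Alt G a b c d) where
  open Alt alt

  ab≢ : a ≢ b
  ab≢ = adj⇒≢ G ab
  cd≢ : c ≢ d
  cd≢ = adj⇒≢ G cd
  ac≢ : a ≢ c
  ac≢ refl = true≢false ab cb
  bd≢ : b ≢ d
  bd≢ refl = true≢false ab ad

  α β : Fin n → Bool
  α x = x == a ∨ x == c
  β x = x == b ∨ x == d

  -- Disjointness of the two sides keeps the switch off the diagonal, so that its result is again
  -- irreflexive.
  αβ : ∀ x → α x ∧ β x ≡ false
  αβ x with x ≟ a | x ≟ c
  ... | yes refl | _        rewrite ==-≢ ab≢ | ==-≢ a≢d = refl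
  ... | no _     | yes refl rewrite ==-≢ cd≢ | ==-≢ (b≢c ∘ sym) = refl
  ... | no _     | no _     = refl

  switch : Graph n
  switch .adj x y = adj G x y xor (α x ∧ β y ∨ β x ∧ α y)
  switch .adj-sym x y = cong₂ _xor_ (adj-sym G x y)
    (trans (∨-comm (α x ∧ β y) _) (cong₂ _∨_ (∧-comm (β x) _) (∧-comm (α x) _)))
  switch .adj-irrefl v rewrite adj-irrefl G v | αβ v | ∧-comm (β v) (α v) | αβ v = refl

  xor-false : ∀ b → b xor false ≡ b
  xor-false true  = refl
  xor-false false = refl

  row-a : ∀ y → adj switch a y ≡ adj G a y xor (y == b ∨ y == d)
  row-a y rewrite ==-refl a | ==-≢ ab≢ | ==-≢ a≢d = cong (adj G a y xor_) (∨-identityʳ _)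

  row-c : ∀ y → adj switch c y ≡ adj G c y xor (y == d ∨ y == b)
  row-c y rewrite ==-refl c | ==-≢ cd≢ | ==-≢ (b≢c ∘ sym) | ==-≢ (ac≢ ∘ sym) =
    cong (adj G c y xor_) (trans (∨-identityʳ _) (∨-comm (y == b) _))

  row-b : ∀ y → adj switch b y ≡ adj G b y xor (y == a ∨ y == c)
  row-b y rewrite ==-refl b | ==-≢ (ab≢ ∘ sym) | ==-≢ b≢c = refl

  row-d : ∀ y → adj switch d y ≡ adj G d y xor (y == c ∨ y == a)
  row-d y rewrite ==-refl d | ==-≢ (a≢d ∘ sym) | ==-≢ (cd≢ ∘ sym) | ==-≢ (bd≢ ∘ sym) =
    cong (adj G d y xor_) (∨-comm (y == a) _)

  row-other : ∀ {x} → x ≢ a → x ≢ b → x ≢ c → x ≢ d → ∀ y → adj switch x y ≡ adj G x y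
  row-other {x} xa xb xc xd y rewrite ==-≢ xa | ==-≢ xb | ==-≢ xc | ==-≢ xd = xor-false _

  #-a : ∀ D → # (adj switch a ∩ D) + b2n (D b) ≡ # (adj G a ∩ D) + b2n (D d)
  #-a D = trans (cong (_+ b2n (D b)) (#-cong (λ y → cong (_∧ D y) (row-a y)))) (flip-# (adj G a) D ab ad)

  #-c : ∀ D → # (adj switch c ∩ D) + b2n (D d) ≡ # (adj G c ∩ D) + b2n (D b)
  #-c D = trans (cong (_+ b2n (D d)) (#-cong (λ y → cong (_∧ D y) (row-c y)))) (flip-# (adj G c) D cd cb)

  #-b : ∀ D → # (adj switch b ∩ D) + b2n (D a) ≡ # (adj G b ∩ D) + b2n (D c)
  #-b D = trans (cong (_+ b2n (D a)) (#-cong (λ y → cong (_∧ D y) (row-b y))))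
            (flip-# (adj G b) D (adj-swap G ab) (adj-swap G cb))

  #-d : ∀ D → # (adj switch d ∩ D) + b2n (D c) ≡ # (adj G d ∩ D) + b2n (D a)
  #-d D = trans (cong (_+ b2n (D c)) (#-cong (λ y → cong (_∧ D y) (row-d y))))
            (flip-# (adj G d) D (adj-swap G cd) (adj-swap G ad))

  #-other : ∀ D {x} → x ≢ a → x ≢ b → x ≢ c → x ≢ d → # (adj switch x ∩ D) ≡ # (adj G x ∩ D)
  #-other D xa xb xc xd = #-cong (λ y → cong (_∧ D y) (row-other xa xb xc xd y))

  data View (x : Fin n) : Set where
    isa : x ≡ a → View x
    isb : x ≡ b → View x
    isc : x ≡ c → View x
    isd : x ≡ d → View x
    other : x ≢ a → x ≢ b → x ≢ c → x ≢ d → View x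

  view : ∀ x → View x
  view x with x ≟ a | x ≟ b | x ≟ c | x ≟ d
  ... | yes p | _ | _ | _ = isa p
  ... | no _ | yes p | _ | _ = isb p
  ... | no _ | no _ | yes p | _ = isc p
  ... | no _ | no _ | no _ | yes p = isd p
  ... | no p | no q | no r | no s = other p q r s

  ∩full : ∀ {f : Fin n → Bool} → # (f ∩ full) ≡ # f
  ∩full {f} = #-cong {f = f ∩ full} {g = f} (λ x → ∧-identityʳ _)

  same-deg : SameDeg G switch
  same-deg x = trans (sym (∩full {adj switch x})) (trans (lem (view x)) (∩full {adj G x}))
    where
    lem : View x → # (adj switch x ∩ full) ≡ # (adj G x ∩ full)
    lem (isa refl) = +-cancelʳ-≡ 1 _ _ (#-a full)
    lem (isb refl) = +-cancelʳ-≡ 1 _ _ (#-b full)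
    lem (isc refl) = +-cancelʳ-≡ 1 _ _ (#-c full)
    lem (isd refl) = +-cancelʳ-≡ 1 _ _ (#-d full)
    lem (other p q r s) = #-other full p q r s

  switch-rigid : Rigid G → Rigid switch
  switch-rigid = Rigid-resp {G = G} {switch} same-deg

  switch-ab : adj switch a b ≡ false
  switch-ab rewrite row-a b | ab | ==-refl b = refl

  switch-cb : adj switch c b ≡ true
  switch-cb rewrite row-c b | cb | ==-refl b | ==-≢ bd≢ = refl

  switch-cd : adj switch c d ≡ false
  switch-cd rewrite row-c d | cd | ==-refl d = refl

  switch-β : ∀ {x y} → x ≢ b → x ≢ d → y ≢ b → y ≢ d → adj switch x y ≡ adj G x y
  switch-β {x} {y} xb xd yb yd rewrite ==-≢ xb | ==-≢ xd | ==-≢ yb | ==-≢ yd | ∧-zeroʳ (α x) = xor-false _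

  switch-α : ∀ {x y} → x ≢ a → x ≢ c → y ≢ a → y ≢ c → adj switch x y ≡ adj G x y
  switch-α {x} {y} xa xc ya yc rewrite ==-≢ xa | ==-≢ xc | ==-≢ ya | ==-≢ yc | ∧-zeroʳ (β x) = xor-false _

module _ {n} (G : Graph n) where

  ofDeg : (ℕ → Bool) → Fin n → Bool
  ofDeg D u = D (dg G u)

  nD : (ℕ → Bool) → Fin n → ℕ
  nD D v = # (adj G v ∩ ofDeg D)

_≡ᵇ_ : ℕ → ℕ → Bool
x ≡ᵇ y = ⌊ x ≟ⁿ y ⌋

≡ᵇ-true : ∀ {x y} → x ≡ᵇ y ≡ true → x ≡ y
≡ᵇ-true {x} {y} h with x ≟ⁿ y
... | yes p = p

≡ᵇ-refl : ∀ x → x ≡ᵇ x ≡ true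
≡ᵇ-refl x with x ≟ⁿ x
... | yes _ = refl
... | no  h = ⊥-elim (h refl)

≡ᵇ-≢ : ∀ {x y} → x ≢ y → x ≡ᵇ y ≡ false
≡ᵇ-≢ {x} {y} h with x ≟ⁿ y
... | yes p = ⊥-elim (h p)
... | no  _ = refl

≡ᵇ-false : ∀ {x y} → x ≡ᵇ y ≡ false → x ≢ y
≡ᵇ-false h refl = true≢false (≡ᵇ-refl _) h

≅-nD : ∀ {n m} {G : Graph n} {H : Graph m} ((σ , _) : G ≅ H) D v → nD H D (Inverse.to σ v) ≡ nD G D v
≅-nD {G = G} {H} i D = ≅-# {G = G} {H} i _ _ (λ u → cong D (≅-dg {G = G} {H} i u))

unique : ∀ {n} {G H : Graph n} → Rigid G → SameDeg G H → G ≅ H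
unique {G = G} {H} (rigid U) s = U H (↔-id _ , λ v → trans (deg≡dg H v) (trans (s v) (sym (deg≡dg G v))))

module _ {n} {G H : Graph n} (U : Rigid G) (s : SameDeg G H) where
  private
    G≅H : G ≅ H
    G≅H = unique {G = G} {H} U s

  -- An isomorphism maps degree classes to degree classes, hence preserves both arguments of `F`.
  -- Each use chooses `F` so that one switch would change the sum.
  invariant : (D : ℕ → Bool) (F : ℕ → ℕ → ℕ) →
              sum (λ v → F (dg H v) (nD H D v)) ≡ sum (λ v → F (dg G v) (nD G D v))
  invariant D F = trans (sum-permute _ (proj₁ G≅H)) (sum-cong-≗
    (λ v → cong₂ F (≅-dg {G = G} {H} G≅H v) (≅-nD {G = G} {H} G≅H D v)))

module _ {n} {G : Graph n} (U : Rigid G) where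

  private
    nD-resp : ∀ (H : Graph n) → SameDeg G H → ∀ D v → nD H D v ≡ # (adj H v ∩ ofDeg G D)
    nD-resp H s D v = #-cong {f = adj H v ∩ ofDeg H D} (λ u → cong (λ z → adj H v u ∧ D z) (s u))

  -- Otherwise the switch would lower the number of edges between the degree classes of a and b.
  Alt⇒deg : ∀ {a b c d} → Alt G a b c d → dg G a ≡ dg G c ⊎ dg G b ≡ dg G d
  Alt⇒deg {a} {b} {c} {d} alt with dg G a ≟ⁿ dg G c | dg G b ≟ⁿ dg G d
  ... | yes p | _     = inj₁ p
  ... | no _  | yes q = inj₂ q
  ... | no ac | no bd = ⊥-elim (<⇒≢ (sum-mono-< le a lt) (invariant {H = switch} U same-deg D F))
    where
    open Switch G alt
    D : ℕ → Bool
    D x = x ≡ᵇ dg G b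
    F : ℕ → ℕ → ℕ
    F x t = if x ≡ᵇ dg G a then t else 0
    E = ofDeg G D
    Db : E b ≡ true
    Db = ≡ᵇ-refl _
    Dd : E d ≡ false
    Dd = ≡ᵇ-≢ (bd ∘ sym)
    ma : # (adj switch a ∩ E) < # (adj G a ∩ E)
    ma = ≤-reflexive (trans (+-comm 1 _) (trans (cong (λ z → # (adj switch a ∩ E) + b2n z) (sym Db))
           (trans (#-a E) (trans (cong (λ z → # (adj G a ∩ E) + b2n z) Dd) (+-identityʳ _)))))
    F≤ : ∀ x t t′ → (x ≡ dg G a → t ≤ t′) → F x t ≤ F x t′
    F≤ x t t′ h with x ≟ⁿ dg G a
    ... | yes p = h p
    ... | no _  = z≤n
    drop : ∀ {x y p q} → x + b2n p ≡ y + b2n q → (q ≡ true → p ≡ true) → x ≤ y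
    drop {x} {y} {p} {q} e h = +-cancelʳ-≤ (b2n p) x y (≤-trans (≤-reflexive e) (+-monoʳ-≤ y (b2n-mono h)))
    le′ : ∀ v → View v → dg G v ≡ dg G a → # (adj switch v ∩ E) ≤ # (adj G v ∩ E)
    le′ v (isa refl) _ = <⇒≤ ma
    le′ v (isb refl) e = drop (#-b E) (λ h → ⊥-elim (ac (trans (sym e) (sym (≡ᵇ-true h)))))
    le′ v (isc refl) e = ⊥-elim (ac (sym e))
    le′ v (isd refl) e = drop (#-d E) (λ h → ⊥-elim (bd (trans (sym (≡ᵇ-true h)) (sym e))))
    le′ v (other p q r s) e = ≤-reflexive (#-other E p q r s)
    le : ∀ v → F (dg switch v) (nD switch D v) ≤ F (dg G v) (nD G D v)
    le v rewrite same-deg v | nD-resp switch same-deg D v = F≤ (dg G v) _ _ (le′ v (view v))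
    lt : F (dg switch a) (nD switch D a) < F (dg G a) (nD G D a)
    lt rewrite same-deg a | nD-resp switch same-deg D a | ≡ᵇ-refl (dg G a) = ma

  -- The switch moves one neighbour with degree in D from b to b′, and must preserve how many vertices of
  -- degree dg G b have nD G D b neighbours with degree in D.
  private-nbrs : ∀ D {a a′ b b′} → Alt G b a b′ a′ → dg G b ≡ dg G b′ →
                 ofDeg G D a ≡ true → ofDeg G D a′ ≡ false → nD G D b ≡ suc (nD G D b′)
  private-nbrs D {a} {a′} {b} {b′} alt e Da Da′ with nD G D b ≟ⁿ suc (nD G D b′)
  ... | yes p = p
  ... | no ne = ⊥-elim (<⇒≢ (sum-mono-< le b lt) (invariant {H = switch} U same-deg D F))
    where
    open Switch G alt
    F : ℕ → ℕ → ℕ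
    F x t = b2n (x ≡ᵇ dg G b ∧ t ≡ᵇ nD G D b)
    E = ofDeg G D
    mb : suc (# (adj switch b ∩ E)) ≡ # (adj G b ∩ E)
    mb = trans (+-comm 1 _) (trans (cong (λ z → # (adj switch b ∩ E) + b2n z) (sym Da))
           (trans (#-a E) (trans (cong (λ z → # (adj G b ∩ E) + b2n z) Da′) (+-identityʳ _))))
    mb′ : # (adj switch b′ ∩ E) ≡ suc (# (adj G b′ ∩ E))
    mb′ = trans (sym (+-identityʳ _)) (trans (cong (λ z → # (adj switch b′ ∩ E) + b2n z) (sym Da′))
           (trans (#-c E) (trans (cong (λ z → # (adj G b′ ∩ E) + b2n z) Da) (+-comm _ 1))))
    F0 : ∀ x {t} → t ≢ nD G D b → F x t ≡ 0
    F0 x h rewrite ≡ᵇ-≢ h = cong b2n (∧-zeroʳ _)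
    le′ : ∀ v → View v → F (dg G v) (# (adj switch v ∩ E)) ≤ F (dg G v) (# (adj G v ∩ E))
    le′ v (isa refl) = ≤-trans (≤-reflexive (F0 (dg G v) λ h → 1+n≢n (trans mb (sym h)))) z≤n
    le′ v (isc refl) = ≤-trans (≤-reflexive (F0 (dg G v) λ h → ne (trans (sym h) mb′))) z≤n
    le′ v (isb refl) = ≤-reflexive (cong (F (dg G v)) (+-cancelʳ-≡ (b2n (E b)) _ _
                         (trans (#-b E) (cong (λ z → # (adj G v ∩ E) + b2n (D z)) (sym e)))))
    le′ v (isd refl) = ≤-reflexive (cong (F (dg G v)) (+-cancelʳ-≡ (b2n (E b′)) _ _
                         (trans (#-d E) (cong (λ z → # (adj G v ∩ E) + b2n (D z)) e))))
    le′ v (other p q r s) = ≤-reflexive (cong (F (dg G v)) (#-other E p q r s))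
    le : ∀ v → F (dg switch v) (nD switch D v) ≤ F (dg G v) (nD G D v)
    le v rewrite same-deg v | nD-resp switch same-deg D v = le′ v (view v)
    lt : F (dg switch b) (nD switch D b) < F (dg G b) (nD G D b)
    lt rewrite same-deg b | nD-resp switch same-deg D b | ≡ᵇ-refl (dg G b) | ≡ᵇ-refl (nD G D b)
             | ≡ᵇ-≢ (λ h → 1+n≢n (trans mb (sym h))) = s≤s z≤n

-- A possible edge between `v` and `w` counts equally in both degrees, so it can be discarded before
-- the neighbourhoods are compared; this also gives `q ≢ v`.
deg-exchange : ∀ {n} (G : Graph n) {v w u} → dg G v ≤ dg G w → adj G v u ≡ true → adj G w u ≡ false → u ≢ w →
               ∃ λ q → adj G w q ≡ true × adj G v q ≡ false × q ≢ v
deg-exchange G {v} {w} {u} le vu wu uw = case #-exchange {f = adj G v ∖ w} {adj G w ∖ v} le′ {u} f1 f2 of λ where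
    (q , h , k) → q , ∧-elimˡ h , lem q (∧-elimˡ h) k , ==-false (not-elim (∧-elimʳ {adj G w q} h))
  where
  le′ : # (adj G v ∖ w) ≤ # (adj G w ∖ v)
  le′ = +-cancelˡ-≤ (b2n (adj G v w)) _ _ (subst₂ _≤_ (#-point (adj G v) w)
          (trans (#-point (adj G w) v) (cong (λ z → b2n z + # (adj G w ∖ v)) (adj-sym G w v))) le)
  f1 : (adj G v ∖ w) u ≡ true
  f1 = ∧-intro vu (not-intro (==-≢ uw))
  f2 : (adj G w ∖ v) u ≡ false
  f2 rewrite wu = refl
  lem : ∀ q → adj G w q ≡ true → (adj G v ∖ w) q ≡ false → adj G v q ≡ false
  lem q wq h rewrite ==-≢ {x = q} {w} (λ e → adj⇒≢ G wq (sym e)) | ∧-identityʳ (adj G v q) = h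

module _ {n} {G : Graph n} (U : Rigid G) where

  no-Alt : ∀ {a v u b} → Alt G a v u b → dg G a ≢ dg G u → dg G v ≢ dg G b → ⊥
  no-Alt alt p q = [ p , q ]′ (Alt⇒deg U alt)

-- If u and v are adjacent, a switch that uses the non-edge u w separates them without touching a v, u b and a b.
crossing₁ : ∀ {n} {G : Graph n} → Rigid G → ∀ {a v u b w} →
            adj G a v ≡ true → adj G u b ≡ true → adj G a b ≡ false → a ≢ b → u ≢ v →
            dg G a ≢ dg G u → dg G v ≢ dg G b →
            adj G u w ≡ false → dg G w ≡ dg G v → w ≢ a → w ≢ u → ⊥
crossing₁ {G = G} U {a} {v} {u} {b} {w} av ub ab a≢b u≢v au vb uw wv w≢a w≢u with bool-cases (adj G u v)
... | inj₂ uv = no-Alt U (record { ab = av ; cd = ub ; cb = uv ; ad = ab ; b≢c = u≢v ∘ sym ; a≢d = a≢b }) au vb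
... | inj₁ uv with deg-exchange G {v} {w} {u} (≤-reflexive (sym wv)) (adj-swap G uv) (adj-swap G uw) (w≢u ∘ sym)
... | q , wq , vq , q≢v = no-Alt switch-rigid′ (record
        { ab = trans (switch-β a≢u a≢q v≢u (q≢v ∘ sym)) av
        ; cd = trans (switch-α u≢v (w≢u ∘ sym) b≢v b≢w) ub
        ; cb = adj-swap switch switch-ab
        ; ad = trans (switch-α a≢v (w≢a ∘ sym) b≢v b≢w) ab
        ; b≢c = u≢v ∘ sym ; a≢d = a≢b })
        (λ e → au (trans (sym (same-deg a)) (trans e (same-deg u))))
        (λ e → vb (trans (sym (same-deg v)) (trans e (same-deg b))))
  where
  alt : Alt G v u w q
  alt = record { ab = adj-swap G uv ; cd = wq ; cb = adj-swap G uw ; ad = vq ; b≢c = w≢u ∘ sym ; a≢d = q≢v ∘ sym }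
  open Switch G alt
  switch-rigid′ = switch-rigid U
  a≢u : a ≢ u
  a≢u refl = au refl
  a≢q : a ≢ q
  a≢q refl = true≢false (adj-swap G av) vq
  v≢u : v ≢ u
  v≢u = u≢v ∘ sym
  b≢v : b ≢ v
  b≢v refl = vb refl
  b≢w : b ≢ w
  b≢w refl = vb (sym wv)
  a≢v : a ≢ v
  a≢v = adj⇒≢ G av

-- The classes of `u` and `v` are not completely joined, as `t w` shows. If `u w` is an edge,
-- exchanging `u w`, `t q` for `t w`, `u q` turns it into a non-edge at `u`, and `crossing₁`
-- applies.
crossing : ∀ {n} {G : Graph n} → Rigid G → ∀ {a v u b t w} →
           adj G a v ≡ true → adj G u b ≡ true → adj G a b ≡ false → a ≢ b → u ≢ v →
           dg G a ≢ dg G u → dg G v ≢ dg G b →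
           adj G t w ≡ false → t ≢ w → dg G t ≡ dg G u → dg G w ≡ dg G v →
           w ≢ a → w ≢ u → t ≢ v → t ≢ b → ⊥
crossing {G = G} U {a} {v} {u} {b} {t} {w} av ub ab a≢b u≢v au vb tw t≢w tu wv w≢a w≢u t≢v t≢b
  with bool-cases (adj G u w)
... | inj₂ uw = crossing₁ U av ub ab a≢b u≢v au vb uw wv w≢a w≢u
... | inj₁ uw with deg-exchange G {u} {t} {w} (≤-reflexive (sym tu)) uw tw (t≢w ∘ sym)
... | q , tq , uq , q≢u = crossing₁ (switch-rigid U)
        (trans (switch-α a≢u a≢t (u≢v ∘ sym) (t≢v ∘ sym)) av)
        (trans (switch-β (w≢u ∘ sym) (q≢u ∘ sym) b≢w b≢q) ub)
        (trans (switch-α a≢u a≢t b≢u (t≢b ∘ sym)) ab)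
        a≢b u≢v
        (λ e → au (trans (sym (same-deg a)) (trans e (same-deg u))))
        (λ e → vb (trans (sym (same-deg v)) (trans e (same-deg b))))
        switch-ab (trans (same-deg w) (trans wv (sym (same-deg v)))) w≢a w≢u
  where
  alt : Alt G u w t q
  alt = record { ab = uw ; cd = tq ; cb = tw ; ad = uq ; b≢c = t≢w ∘ sym ; a≢d = q≢u ∘ sym }
  open Switch G alt
  a≢u : a ≢ u
  a≢u refl = au refl
  a≢t : a ≢ t
  a≢t refl = au tu
  b≢u : b ≢ u
  b≢u = adj⇒≢ G ub ∘ sym
  b≢w : b ≢ w
  b≢w refl = vb (sym wv)
  b≢q : b ≢ q
  b≢q refl = true≢false ub uq

-- Expressions up to their degrees

Item : Set
Item = Fin 5 × ℕ × ℕ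

cnt : (Fin 5 → Bool) → List Item → ℕ
cnt p []            = 0
cnt p ((i , _) ∷ P) = b2n (p i) + cnt p P

bump : (Fin 5 → Fin 5 → Bool) → List Item → Item → Item
bump M Q (i , d , c) = i , d + cnt (M i) Q , c + cnt (∁ (M i)) Q

relabel : Fin 5 → Fin 5 → Fin 5 → Fin 5
relabel i j l = if l == i then j else l

map-bump-[] : ∀ M Q → map (bump M []) Q ≡ Q
map-bump-[] M []      = refl
map-bump-[] M (x ∷ Q) = cong₂ _∷_ (cong₂ (λ d c → proj₁ x , d , c) (+-identityʳ _) (+-identityʳ _)) (map-bump-[] M Q)

relab : Fin 5 → Fin 5 → Item → Item
relab i j (l , d , c) = relabel i j l , d , c

swp : Item → Item
swp (i , d , c) = i , c , d

Side : (Fin 5 → Bool) → Bool → List Item → Set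
Side s b = All (λ x → s (proj₁ x) ≡ b)

-- Con P: some 5-expression has vertices with the (label , degree , codegree) triples P. In a join,
-- s separates the labels of the two parts and M says which labels get joined. Carrying
-- the codegrees makes the closure under complementation immediate.
data Con : List Item → Set where
  nil  : Con []
  pt   : ∀ i → Con ((i , 0 , 0) ∷ [])
  join : ∀ s M {P Q} → Side s true P → Side s false Q → Con P → Con Q →
         Con (map (bump M Q) P ++ map (bump (flip M) P) Q)
  ren  : ∀ i j {P} → Con P → Con (map (relab i j) P)
  perm : ∀ {P Q} → P ↭ Q → Con P → Con Q

Con-resp : ∀ {P Q} → P ≡ Q → Con P → Con Q
Con-resp refl c = c

cnt-map : ∀ p (g : Item → Item) → (∀ x → proj₁ (g x) ≡ proj₁ x) → ∀ P → cnt p (map g P) ≡ cnt p P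
cnt-map p g h []      = refl
cnt-map p g h (x ∷ P) = cong₂ _+_ (cong (b2n ∘ p) (h x)) (cnt-map p g h P)

cnt-cong : ∀ {p q} → p ≗ q → ∀ P → cnt p P ≡ cnt q P
cnt-cong h []      = refl
cnt-cong h (x ∷ P) = cong₂ _+_ (cong b2n (h _)) (cnt-cong h P)

swp-bump : ∀ M Q → map swp ∘ map (bump M Q) ≗ map (bump (λ i j → not (M i j)) (map swp Q)) ∘ map swp
swp-bump M Q P = trans (sym (map-∘ P)) (trans (map-cong lem P) (map-∘ P))
  where
  lem : ∀ x → swp (bump M Q x) ≡ bump (λ i j → not (M i j)) (map swp Q) (swp x)
  lem (i , d , c) = cong₂ (λ a b → i , c + a , d + b)
    (sym (cnt-map (∁ (M i)) swp (λ _ → refl) Q))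
    (sym (trans (cnt-map (∁ (∁ (M i))) swp (λ _ → refl) Q) (cnt-cong (λ j → not-involutive (M i j)) Q)))

Side-swp : ∀ {s b P} → Side s b P → Side s b (map swp P)
Side-swp []      = []
Side-swp (h ∷ a) = h ∷ Side-swp a

comp : ∀ {P} → Con P → Con (map swp P)
comp nil    = nil
comp (pt i) = pt i
comp (join s M {P} {Q} a b c d) = Con-resp
  (sym (trans (map-++ swp (map (bump M Q) P) _) (cong₂ _++_ (swp-bump M Q P) (swp-bump (flip M) P Q))))
  (join s (λ i j → not (M i j)) (Side-swp a) (Side-swp b) (comp c) (comp d))
comp (ren i j {P} c) = Con-resp (trans (sym (map-∘ P)) (map-∘ P)) (ren i j (comp c))
comp (perm σ c) = perm (map⁺ swp σ) (comp c)

forget : Item → Fin 5 × ℕ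
forget (i , d , c) = i , d

profile : ∀ {a} → CWExpr 5 a → List (Fin 5 × ℕ)
profile e = tabulate (λ x → label e x , # (edge e x))

tabulate-+ : ∀ {A : Set} {a b} (h : Fin (a + b) → A) → tabulate h ≡ tabulate (h ∘ (_↑ˡ b)) ++ tabulate (h ∘ (a ↑ʳ_))
tabulate-+ {a = zero}  h = refl
tabulate-+ {a = suc a} h = cong (h zero ∷_) (tabulate-+ {a = a} (h ∘ suc))

#-+ : ∀ {a b} (f : Fin (a + b) → Bool) → # f ≡ # (f ∘ (_↑ˡ b)) + # (f ∘ (a ↑ʳ_))
#-+ {zero}  f = refl
#-+ {suc a} f = trans (cong (b2n (f zero) +_) (#-+ {a} (f ∘ suc))) (sym (+-assoc (b2n (f zero)) _ _))

cnt-profile : ∀ {a} (e : CWExpr 5 a) p Q → map forget Q ↭ profile e → cnt p Q ≡ # (p ∘ label e)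
cnt-profile e p Q σ = trans (sym (cnt-forget Q)) (trans (resp σ) (tab (label e) (λ x → # (edge e x))))
  where
  cnt′ : List (Fin 5 × ℕ) → ℕ
  cnt′ []            = 0
  cnt′ ((i , _) ∷ P) = b2n (p i) + cnt′ P
  cnt-forget : ∀ P → cnt′ (map forget P) ≡ cnt p P
  cnt-forget []      = refl
  cnt-forget (x ∷ P) = cong (b2n (p _) +_) (cnt-forget P)
  resp : ∀ {P R} → P ↭ R → cnt′ P ≡ cnt′ R
  resp ↭refl            = refl
  resp (prep x σ)       = cong (b2n (p (proj₁ x)) +_) (resp σ)
  resp (↭swap x y σ)    = trans (cong (λ z → b2n (p (proj₁ x)) + (b2n (p (proj₁ y)) + z)) (resp σ))
                            (lem (b2n (p (proj₁ x))) (b2n (p (proj₁ y))) _)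
    where
    lem : ∀ x y z → x + (y + z) ≡ y + (x + z)
    lem = solve-∀
  resp (↭trans σ τ)     = trans (resp σ) (resp τ)
  tab : ∀ {a} (l : Fin a → Fin 5) (d : Fin a → ℕ) → cnt′ (tabulate (λ x → l x , d x)) ≡ # (p ∘ l)
  tab {zero}  l d = refl
  tab {suc a} l d = cong (b2n (p (l zero)) +_) (tab (l ∘ suc) (d ∘ suc))

Side-profile : ∀ {a} (e : CWExpr 5 a) s {b} Q → map forget Q ↭ profile e → Side s b Q → ∀ x → s (label e x) ≡ b
Side-profile e s {b} Q σ h x = tabulate⁻ (All-resp-↭ σ (side h)) x
  where
  side : ∀ {Q} → Side s b Q → All (λ y → s (proj₁ y) ≡ b) (map forget Q)
  side []      = []
  side (h ∷ a) = h ∷ side a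

module Join {a b} (s : Fin 5 → Bool) (M : Fin 5 → Fin 5 → Bool) (e : CWExpr 5 a) (f : CWExpr 5 b)
            (he : ∀ x → s (label e x) ≡ true) (hf : ∀ y → s (label f y) ≡ false) where

  -- Only pairs from a left label to a right label are kept. Then no `η` adds edges inside a part,
  -- and its two labels differ as `η` requires.
  M′ : Fin 5 → Fin 5 → Bool
  M′ i j = M i j ∧ (s i ∧ not (s j))

  M′⇒≢ : ∀ {i j} → M′ i j ≡ true → i ≢ j
  M′⇒≢ {i} {j} h refl = true≢false (∧-elimˡ (∧-elimʳ {M i j} h)) (not-elim (∧-elimʳ {s i} (∧-elimʳ {M i j} h)))

  ηif : ∀ {c} i j → CWExpr 5 c → CWExpr 5 c
  ηif i j g with bool-cases (M′ i j)
  ... | inj₁ h = η i j (M′⇒≢ h) g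
  ... | inj₂ _ = g

  ηs : ∀ {c} → List (Fin 5 × Fin 5) → CWExpr 5 c → CWExpr 5 c
  ηs []            g = g
  ηs ((i , j) ∷ L) g = ηif i j (ηs L g)

  label-ηs : ∀ {c} L (g : CWExpr 5 c) x → label (ηs L g) x ≡ label g x
  label-ηs []            g x = refl
  label-ηs ((i , j) ∷ L) g x with bool-cases (M′ i j)
  ... | inj₁ h = label-ηs L g x
  ... | inj₂ _ = label-ηs L g x

  hits : List (Fin 5 × Fin 5) → Fin 5 → Fin 5 → Set
  hits L p q = (p , q) ∈ L × M′ p q ≡ true

  weaken : ∀ {A : Set} {L ij p q} → A ⊎ hits L p q ⊎ hits L q p → A ⊎ hits (ij ∷ L) p q ⊎ hits (ij ∷ L) q p
  weaken (inj₁ k) = inj₁ k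
  weaken (inj₂ (inj₁ (m , k))) = inj₂ (inj₁ (there m , k))
  weaken (inj₂ (inj₂ (m , k))) = inj₂ (inj₂ (there m , k))

  edge-ηs⇒ : ∀ {c} L (g : CWExpr 5 c) x y → edge (ηs L g) x y ≡ true →
             edge g x y ≡ true ⊎ hits L (label g x) (label g y) ⊎ hits L (label g y) (label g x)
  edge-ηs⇒ []            g x y h = inj₁ h
  edge-ηs⇒ ((i , j) ∷ L) g x y h with bool-cases (M′ i j)
  ... | inj₂ _ = weaken (edge-ηs⇒ L g x y h)
  ... | inj₁ ij rewrite label-ηs L g x | label-ηs L g y
    with bool-cases (edge (ηs L g) x y) | bool-cases (label g x == i ∧ label g y == j)
  ... | inj₁ k | _ = weaken (edge-ηs⇒ L g x y k)
  ... | inj₂ _ | inj₁ m with ==-true {x = label g x} (∧-elimˡ m) | ==-true {x = label g y} (∧-elimʳ {label g x == i} m)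
  ... | refl | refl = inj₂ (inj₁ (here refl , ij))
  edge-ηs⇒ ((i , j) ∷ L) g x y h | inj₁ ij | inj₂ k | inj₂ m rewrite k | m
    with ==-true {x = label g x} (∧-elimˡ h) | ==-true {x = label g y} (∧-elimʳ {label g x == j} h)
  ... | refl | refl = inj₂ (inj₂ (here refl , ij))

  ∨-intro : ∀ {p q r} → p ≡ true ⊎ q ≡ true ⊎ r ≡ true → p ∨ q ∨ r ≡ true
  ∨-intro (inj₁ refl) = refl
  ∨-intro {true}  (inj₂ _) = refl
  ∨-intro {false} (inj₂ (inj₁ refl)) = refl
  ∨-intro {false} {true}  (inj₂ (inj₂ refl)) = refl
  ∨-intro {false} {false} (inj₂ (inj₂ refl)) = refl

  edge-ηs⇐ : ∀ {c} L (g : CWExpr 5 c) x y →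
             edge g x y ≡ true ⊎ hits L (label g x) (label g y) ⊎ hits L (label g y) (label g x) →
             edge (ηs L g) x y ≡ true
  edge-ηs⇐ []            g x y (inj₁ h) = h
  edge-ηs⇐ []            g x y (inj₂ (inj₁ (() , _)))
  edge-ηs⇐ []            g x y (inj₂ (inj₂ (() , _)))
  edge-ηs⇐ ((i , j) ∷ L) g x y h with bool-cases (M′ i j)
  edge-ηs⇐ ((i , j) ∷ L) g x y (inj₁ h)                       | inj₁ ij = ∨-introˡ (edge-ηs⇐ L g x y (inj₁ h))
  edge-ηs⇐ ((i , j) ∷ L) g x y (inj₂ (inj₁ (there m , k)))    | inj₁ ij = ∨-introˡ (edge-ηs⇐ L g x y (inj₂ (inj₁ (m , k))))
  edge-ηs⇐ ((i , j) ∷ L) g x y (inj₂ (inj₂ (there m , k)))    | inj₁ ij = ∨-introˡ (edge-ηs⇐ L g x y (inj₂ (inj₂ (m , k))))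
  edge-ηs⇐ ((i , j) ∷ L) g x y (inj₂ (inj₁ (here refl , k)))  | inj₁ ij rewrite label-ηs L g x | label-ηs L g y =
    ∨-intro {edge (ηs L g) x y} (inj₂ (inj₁ (∧-intro (==-refl (label g x)) (==-refl (label g y)))))
  edge-ηs⇐ ((i , j) ∷ L) g x y (inj₂ (inj₂ (here refl , k)))  | inj₁ ij rewrite label-ηs L g x | label-ηs L g y =
    ∨-intro {edge (ηs L g) x y} {label g x == label g y ∧ label g y == label g x}
      (inj₂ (inj₂ (∧-intro (==-refl (label g x)) (==-refl (label g y)))))
  edge-ηs⇐ ((i , j) ∷ L) g x y (inj₁ h)                      | inj₂ ij = edge-ηs⇐ L g x y (inj₁ h)
  edge-ηs⇐ ((i , j) ∷ L) g x y (inj₂ (inj₁ (there m , k)))   | inj₂ ij = edge-ηs⇐ L g x y (inj₂ (inj₁ (m , k)))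
  edge-ηs⇐ ((i , j) ∷ L) g x y (inj₂ (inj₂ (there m , k)))   | inj₂ ij = edge-ηs⇐ L g x y (inj₂ (inj₂ (m , k)))
  edge-ηs⇐ ((i , j) ∷ L) g x y (inj₂ (inj₁ (here refl , k))) | inj₂ ij = ⊥-elim (true≢false k ij)
  edge-ηs⇐ ((i , j) ∷ L) g x y (inj₂ (inj₂ (here refl , k))) | inj₂ ij = ⊥-elim (true≢false k ij)

  pairs : List (Fin 5 × Fin 5)
  pairs = cartesianProduct (allFin 5) (allFin 5)

  ∈-pairs : ∀ p q → (p , q) ∈ pairs
  ∈-pairs p q = ∈-cartesianProduct⁺ (∈-allFin p) (∈-allFin q)

  ef : CWExpr 5 (a + b)
  ef = e ⊕ f

  joined : CWExpr 5 (a + b)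
  joined = ηs pairs ef

  label-l : ∀ x → label ef (x ↑ˡ b) ≡ label e x
  label-l x rewrite splitAt-↑ˡ a x b = refl

  label-r : ∀ y → label ef (a ↑ʳ y) ≡ label f y
  label-r y rewrite splitAt-↑ʳ a b y = refl

  edge-ll : ∀ x y → edge joined (x ↑ˡ b) (y ↑ˡ b) ≡ edge e x y
  edge-ll x y = bool-ext (λ h → case edge-ηs⇒ pairs ef (x ↑ˡ b) (y ↑ˡ b) h of λ where
      (inj₁ k) → trans (sym base) k
      (inj₂ (inj₁ (_ , k))) → ⊥-elim (bad y k)
      (inj₂ (inj₂ (_ , k))) → ⊥-elim (bad x k))
    (λ h → edge-ηs⇐ pairs ef (x ↑ˡ b) (y ↑ˡ b) (inj₁ (trans base h)))
    where
    base : edge ef (x ↑ˡ b) (y ↑ˡ b) ≡ edge e x y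
    base rewrite splitAt-↑ˡ a x b | splitAt-↑ˡ a y b = refl
    bad : ∀ {p} z → M′ p (label ef (z ↑ˡ b)) ≡ true → ⊥
    bad {p} z k rewrite label-l z | he z | ∧-zeroʳ (s p) = true≢false k (∧-zeroʳ _)

  edge-rr : ∀ x y → edge joined (a ↑ʳ x) (a ↑ʳ y) ≡ edge f x y
  edge-rr x y = bool-ext (λ h → case edge-ηs⇒ pairs ef (a ↑ʳ x) (a ↑ʳ y) h of λ where
      (inj₁ k) → trans (sym base) k
      (inj₂ (inj₁ (_ , k))) → ⊥-elim (bad x k)
      (inj₂ (inj₂ (_ , k))) → ⊥-elim (bad y k))
    (λ h → edge-ηs⇐ pairs ef (a ↑ʳ x) (a ↑ʳ y) (inj₁ (trans base h)))
    where
    base : edge ef (a ↑ʳ x) (a ↑ʳ y) ≡ edge f x y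
    base rewrite splitAt-↑ʳ a b x | splitAt-↑ʳ a b y = refl
    bad : ∀ {p} z → M′ (label ef (a ↑ʳ z)) p ≡ true → ⊥
    bad z k rewrite label-r z | hf z = true≢false k (∧-zeroʳ _)

  edge-lr : ∀ x y → edge joined (x ↑ˡ b) (a ↑ʳ y) ≡ M (label e x) (label f y)
  edge-lr x y = bool-ext (λ h → case edge-ηs⇒ pairs ef (x ↑ˡ b) (a ↑ʳ y) h of λ where
      (inj₁ k) → ⊥-elim (true≢false k base)
      (inj₂ (inj₁ (_ , k))) → ∧-elimˡ (trans (sym (cong₂ M′ (label-l x) (label-r y))) k)
      (inj₂ (inj₂ (_ , k))) → ⊥-elim (true≢false k (bad (M _ _))))
    (λ h → edge-ηs⇐ pairs ef (x ↑ˡ b) (a ↑ʳ y) (inj₂ (inj₁ (∈-pairs _ _ ,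
       trans (cong₂ M′ (label-l x) (label-r y)) (∧-intro h (∧-intro (he x) (not-intro (hf y))))))))
    where
    base : edge ef (x ↑ˡ b) (a ↑ʳ y) ≡ false
    base rewrite splitAt-↑ˡ a x b | splitAt-↑ʳ a b y = refl
    bad : ∀ m → m ∧ (s (label ef (a ↑ʳ y)) ∧ not (s (label ef (x ↑ˡ b)))) ≡ false
    bad m rewrite label-r y | hf y = ∧-zeroʳ m

  edge-rl : ∀ x y → edge joined (a ↑ʳ y) (x ↑ˡ b) ≡ M (label e x) (label f y)
  edge-rl x y = bool-ext (λ h → case edge-ηs⇒ pairs ef (a ↑ʳ y) (x ↑ˡ b) h of λ where
      (inj₁ k) → ⊥-elim (true≢false k base)
      (inj₂ (inj₁ (_ , k))) → ⊥-elim (true≢false k (bad (M _ _)))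
      (inj₂ (inj₂ (_ , k))) → ∧-elimˡ (trans (sym (cong₂ M′ (label-l x) (label-r y))) k))
    (λ h → edge-ηs⇐ pairs ef (a ↑ʳ y) (x ↑ˡ b) (inj₂ (inj₂ (∈-pairs _ _ ,
       trans (cong₂ M′ (label-l x) (label-r y)) (∧-intro h (∧-intro (he x) (not-intro (hf y))))))))
    where
    base : edge ef (a ↑ʳ y) (x ↑ˡ b) ≡ false
    base rewrite splitAt-↑ˡ a x b | splitAt-↑ʳ a b y = refl
    bad : ∀ m → m ∧ (s (label ef (a ↑ʳ y)) ∧ not (s (label ef (x ↑ˡ b)))) ≡ false
    bad m rewrite label-r y | hf y = ∧-zeroʳ m

  profile-joined : profile joined ≡
    tabulate (λ x → label e x , # (edge e x) + # (M (label e x) ∘ label f)) ++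
    tabulate (λ y → label f y , # (edge f y) + # (flip M (label f y) ∘ label e))
  profile-joined = trans (tabulate-+ {a = a} _) (cong₂ _++_
    (tabulate-cong (λ x → cong₂ _,_ (trans (label-ηs pairs ef _) (label-l x))
      (trans (#-+ {a} _) (cong₂ _+_ (#-cong (edge-ll x)) (#-cong (edge-lr x))))))
    (tabulate-cong (λ y → cong₂ _,_ (trans (label-ηs pairs ef _) (label-r y))
      (trans (#-+ {a} _) (trans (+-comm (# (edge joined (a ↑ʳ y) ∘ (_↑ˡ b))) _)
        (cong₂ _+_ (#-cong (edge-rr y)) (#-cong (λ x → edge-rl x y))))))))

-- Every expression has at least one vertex, so the empty profile is a case of its own, and a join
-- with an empty part is the other part.
Con-sound : ∀ {P} → Con P → P ≡ [] ⊎ ∃ λ a → Σ (CWExpr 5 a) λ e → map forget P ↭ profile e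
Con-sound nil    = inj₁ refl
Con-sound (pt i) = inj₂ (1 , vtx i , ↭-refl)
Con-sound (perm {P} {Q} σ c) with Con-sound c
... | inj₁ refl = inj₁ (↭-empty-inv (↭-sym σ))
... | inj₂ (a , e , τ) = inj₂ (a , e , ↭-trans (map⁺ forget (↭-sym σ)) τ)
Con-sound (ren i j {P} c) with Con-sound c
... | inj₁ refl = inj₁ refl
... | inj₂ (a , e , τ) = inj₂ (a , ρ i j e , ↭-trans
        (↭-reflexive (trans (sym (map-∘ P)) (map-∘ P)))
        (↭-trans (map⁺ (λ x → relabel i j (proj₁ x) , proj₂ x) τ) (↭-reflexive (map-tabulate _ _))))
Con-sound (join s M {P} {Q} h k c d) with Con-sound c | Con-sound d
... | inj₁ refl | inj₁ refl = inj₁ refl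
... | inj₁ refl | inj₂ (a , e , σ) = inj₂ (a , e , ↭-trans (↭-reflexive
        (cong (map forget) (map-bump-[] (flip M) Q))) σ)
... | inj₂ (a , e , σ) | inj₁ refl = inj₂ (a , e , ↭-trans (↭-reflexive
        (cong (map forget) (trans (++-identityʳ _) (map-bump-[] M P)))) σ)
... | inj₂ (a , e , σ) | inj₂ (b , f , τ) = inj₂ (a + b , joined , ↭-trans
        (↭-reflexive (map-++ forget (map (bump M Q) P) _))
        (↭-trans (++⁺ (part M P Q e f σ τ) (part (flip M) Q P f e τ σ)) (↭-reflexive (sym profile-joined))))
  where
  open Join s M e f (Side-profile e s P σ h) (Side-profile f s Q τ k)
  part : ∀ {a b} M P Q (e : CWExpr 5 a) (f : CWExpr 5 b) → map forget P ↭ profile e → map forget Q ↭ profile f →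
         map forget (map (bump M Q) P) ↭ tabulate (λ x → label e x , # (edge e x) + # (M (label e x) ∘ label f))
  part M P Q e f σ τ = ↭-trans
    (↭-reflexive (trans (sym (map-∘ P)) (trans (map-cong (λ x →
       cong (λ z → proj₁ x , proj₁ (proj₂ x) + z) (cnt-profile f (M (proj₁ x)) Q τ)) P) (map-∘ P))))
    (↭-trans (map⁺ (λ x → proj₁ x , proj₂ x + # (M (proj₁ x) ∘ label f)) σ) (↭-reflexive (map-tabulate _ _)))

-- Degree profiles of induced subgraphs

cons-if : ∀ {X : Set} → Bool → X → List X → List X
cons-if true  x l = x ∷ l
cons-if false x l = l

items : ∀ {n} {X : Set} → (Fin n → Bool) → (Fin n → X) → List X
items {zero}  S f = []
items {suc n} S f = cons-if (S zero) (f zero) (items (S ∘ suc) (f ∘ suc))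

module _ {X : Set} where

  items-cong : ∀ {n} (S : Fin n → Bool) {f g : Fin n → X} → (∀ x → S x ≡ true → f x ≡ g x) → items S f ≡ items S g
  items-cong {zero}  S h = refl
  items-cong {suc n} S h with S zero | h zero
  ... | true  | e = cong₂ _∷_ (e refl) (items-cong (S ∘ suc) (h ∘ suc))
  ... | false | _ = items-cong (S ∘ suc) (h ∘ suc)

  items-set : ∀ {n} {S T : Fin n → Bool} (f : Fin n → X) → S ≗ T → items S f ≡ items T f
  items-set {zero}  f h = refl
  items-set {suc n} f h = cong₂ (λ b l → cons-if b (f zero) l) (h zero) (items-set (f ∘ suc) (h ∘ suc))

  items-map : ∀ {Y : Set} {n} (g : X → Y) (S : Fin n → Bool) (f : Fin n → X) → map g (items S f) ≡ items S (g ∘ f)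
  items-map {n = zero}  g S f = refl
  items-map {n = suc n} g S f with S zero
  ... | true  = cong (g (f zero) ∷_) (items-map g (S ∘ suc) (f ∘ suc))
  ... | false = items-map g (S ∘ suc) (f ∘ suc)

  items-full : ∀ {n} (f : Fin n → X) → items full f ≡ tabulate f
  items-full {zero}  f = refl
  items-full {suc n} f = cong (f zero ∷_) (items-full (f ∘ suc))

  items-empty : ∀ {n} {S : Fin n → Bool} (f : Fin n → X) → (∀ x → S x ≡ false) → items S f ≡ []
  items-empty {zero}  f h = refl
  items-empty {suc n} f h rewrite h zero = items-empty (f ∘ suc) (h ∘ suc)

  items-const : ∀ {n} (S : Fin n → Bool) (x : X) → items S (λ _ → x) ≡ replicate (# S) x
  items-const {zero}  S x = refl
  items-const {suc n} S x with S zero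
  ... | true  = cong (x ∷_) (items-const (S ∘ suc) x)
  ... | false = items-const (S ∘ suc) x

  items-⟦⟧ : ∀ {n} (p : Fin n) (f : Fin n → X) → items ⟦ p ⟧ f ≡ f p ∷ []
  items-⟦⟧ zero    f = cong (f zero ∷_) (items-empty (f ∘ suc) (λ _ → refl))
  items-⟦⟧ (suc p) f = trans (items-set (f ∘ suc) lem) (items-⟦⟧ p (f ∘ suc))
    where
    lem : ∀ x → suc x == suc p ≡ x == p
    lem x with x ≟ p
    ... | yes _ = refl
    ... | no  _ = refl

  items-split : ∀ {n} (S T : Fin n → Bool) (f : Fin n → X) → items S f ↭ items (S ∩ T) f ++ items (S ∩ ∁ T) f
  items-split {zero}  S T f = ↭-refl
  items-split {suc n} S T f with S zero | T zero
  ... | false | _     = items-split (S ∘ suc) (T ∘ suc) (f ∘ suc)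
  ... | true  | true  = prep _ (items-split (S ∘ suc) (T ∘ suc) (f ∘ suc))
  ... | true  | false = ↭-trans (prep _ (items-split (S ∘ suc) (T ∘ suc) (f ∘ suc)))
                          (↭-sym (shift (f zero) (items ((S ∩ T) ∘ suc) (f ∘ suc)) _))

items-cnt : ∀ {n} p (S : Fin n → Bool) (f : Fin n → Item) → cnt p (items S f) ≡ # (S ∩ (p ∘ proj₁ ∘ f))
items-cnt {zero}  p S f = refl
items-cnt {suc n} p S f with S zero
... | true  = cong (b2n (p (proj₁ (f zero))) +_) (items-cnt p (S ∘ suc) (f ∘ suc))
... | false = items-cnt p (S ∘ suc) (f ∘ suc)

items-side : ∀ {n s b} (S : Fin n → Bool) (f : Fin n → Item) → (∀ x → S x ≡ true → s (proj₁ (f x)) ≡ b) → Side s b (items S f)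
items-side {zero}  S f h = []
items-side {suc n} S f h with S zero | h zero
... | true  | e = e refl ∷ items-side (S ∘ suc) (f ∘ suc) (h ∘ suc)
... | false | _ = items-side (S ∘ suc) (f ∘ suc) (h ∘ suc)

prof : ∀ {n} → Graph n → (Fin n → Bool) → (Fin n → Fin 5) → Fin n → Item
prof G S lab v = lab v , # (S ∩ adj G v) , # (S ∩ adj (co G) v)

-- Degrees and codegrees are taken inside `S`. The induced subgraph itself need not be built: any
-- graph with its labelled degrees will do.
record Good {n} (G : Graph n) (S : Fin n → Bool) (lab : Fin n → Fin 5) : Set where
  constructor good
  field con : Con (items S (prof G S lab))
open Good

Disjoint : ∀ {n} → (Fin n → Bool) → (Fin n → Bool) → Set
Disjoint S T = ∀ v → S v ≡ true → T v ≡ false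

Disjoint-sym : ∀ {n} {S T : Fin n → Bool} → Disjoint S T → Disjoint T S
Disjoint-sym h v Tv = not-true (λ Sv → true≢false Tv (h v Sv))

#-∪ : ∀ {n} {S T : Fin n → Bool} (f : Fin n → Bool) → Disjoint S T → # ((S ∪ T) ∩ f) ≡ # (S ∩ f) + # (T ∩ f)
#-∪ {S = S} {T} f h = trans (#-split ((S ∪ T) ∩ f) S) (cong₂ _+_ (#-cong l) (#-cong r))
  where
  l : ∀ x → ((S x ∨ T x) ∧ f x) ∧ S x ≡ S x ∧ f x
  l x with S x
  ... | true  = ∧-identityʳ (f x)
  ... | false = ∧-zeroʳ _
  r : ∀ x → ((S x ∨ T x) ∧ f x) ∧ not (S x) ≡ T x ∧ f x
  r x with S x | h x
  ... | true  | k rewrite k refl = ∧-zeroʳ _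
  ... | false | _ = ∧-identityʳ _

∩-congʳ : ∀ {n} (S : Fin n → Bool) {f g : Fin n → Bool} → (∀ x → S x ≡ true → f x ≡ g x) → S ∩ f ≗ S ∩ g
∩-congʳ S h x with S x | h x
... | true  | e = e refl
... | false | _ = refl

module _ {n} {G : Graph n} where

  Good-lab : ∀ {S lab lab′} → (∀ v → S v ≡ true → lab v ≡ lab′ v) → Good G S lab → Good G S lab′
  Good-lab {S} h (good c) = good (Con-resp (items-cong S (λ v Sv → cong (_, _) (h v Sv))) c)

  Good-set : ∀ {S T lab} → S ≗ T → Good G S lab → Good G T lab
  Good-set {S} {T} h (good c) = good (Con-resp (trans (items-set _ h) (items-cong T
    (λ v _ → cong₂ (λ x y → _ , x , y) (#-cong (λ u → cong (_∧ adj G v u) (h u))) (#-cong (λ u → cong (_∧ adj (co G) v u) (h u)))))) c)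

  Good-ren : ∀ {S lab} i j → Good G S lab → Good G S (relabel i j ∘ lab)
  Good-ren {S} i j (good c) = good (Con-resp (items-map (relab i j) S _) (ren i j c))

  Good-empty : ∀ {S lab} → (∀ v → S v ≡ false) → Good G S lab
  Good-empty h = good (Con-resp (sym (items-empty _ h)) nil)

  Good-single : ∀ p {lab} → Good G ⟦ p ⟧ lab
  Good-single p {lab} = good (Con-resp (sym (trans (items-⟦⟧ p _) (cong (_∷ [])
      (cong₂ (λ x y → lab p , x , y) (#-none (λ u → z (adj G p) (adj-irrefl G p) u)) (#-none (z (adj (co G) p) (adj-irrefl (co G) p)))))))
      (pt (lab p)))
    where
    z : ∀ f → f p ≡ false → ∀ u → (u == p) ∧ f u ≡ false
    z f h u with u ≟ p
    ... | yes refl = h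
    ... | no _ = refl

  -- A vertex gains as many neighbours across as there are vertices with a joined label on the other
  -- side. This number is the same in G and in the realisations of `S` and `T`, which may differ
  -- from the induced subgraphs.
  Good-∪ : ∀ {S T lab} s M → Disjoint S T →
           (∀ v → S v ≡ true → s (lab v) ≡ true) → (∀ v → T v ≡ true → s (lab v) ≡ false) →
           (∀ u v → S u ≡ true → T v ≡ true → adj G u v ≡ M (lab u) (lab v)) →
           Good G S lab → Good G T lab → Good G (S ∪ T) lab
  Good-∪ {S} {T} {lab} s M dis hS hT cross (good c) (good d) = good (perm
      (↭-trans (↭-reflexive (cong₂ _++_ left right)) (↭-trans (↭-reflexive (cong₂ _++_ (items-set g l) (items-set g r)))
         (↭-sym (items-split (S ∪ T) S g))))
      (join s M (items-side S _ hS) (items-side T _ hT) c d))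
    where
    g = prof G (S ∪ T) lab
    l : S ≗ (S ∪ T) ∩ S
    l x with S x | T x
    ... | true  | _ = refl
    ... | false | _ = sym (∧-zeroʳ _)
    r : T ≗ (S ∪ T) ∩ ∁ S
    r x with S x | dis x
    ... | true  | h = h refl
    ... | false | _ = sym (∧-identityʳ _)
    co-S : ∀ u v → S u ≡ true → T v ≡ true → adj (co G) u v ≡ not (M (lab u) (lab v))
    co-S u v Su Tv = trans (co-≢ G (λ { refl → true≢false Tv (dis u Su) })) (cong not (cross u v Su Tv))
    left : map (bump M (items T (prof G T lab))) (items S (prof G S lab)) ≡ items S g
    left = trans (items-map _ S _) (items-cong S (λ v Sv → cong₂ (λ x y → lab v , x , y)
      (trans (cong (# (S ∩ adj G v) +_) (trans (items-cnt _ T _) (#-cong (∩-congʳ T (λ u Tu → sym (cross v u Sv Tu))))))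
             (sym (#-∪ (adj G v) dis)))
      (trans (cong (# (S ∩ adj (co G) v) +_) (trans (items-cnt _ T _) (#-cong (∩-congʳ T (λ u Tu → sym (co-S v u Sv Tu))))))
             (sym (#-∪ (adj (co G) v) dis)))))
    right : map (bump (flip M) (items S (prof G S lab))) (items T (prof G T lab)) ≡ items T g
    right = trans (items-map _ T _) (items-cong T (λ v Tv → cong₂ (λ x y → lab v , x , y)
      (trans (cong (# (T ∩ adj G v) +_) (trans (items-cnt _ S _) (#-cong (∩-congʳ S (λ u Su → sym (trans (adj-sym G v u) (cross u v Su Tv)))))))
             (trans (+-comm (# (T ∩ adj G v)) _) (sym (#-∪ (adj G v) dis))))
      (trans (cong (# (T ∩ adj (co G) v) +_) (trans (items-cnt _ S _) (#-cong (∩-congʳ S (λ u Su → sym (trans (adj-sym (co G) v u) (co-S u v Su Tv)))))))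
             (trans (+-comm (# (T ∩ adj (co G) v)) _) (sym (#-∪ (adj (co G) v) dis))))))

Good-co : ∀ {n} {G : Graph n} {S lab} → Good (co G) S lab → Good G S lab
Good-co {G = G} {S} {lab} (good c) = good (Con-resp
  (trans (items-map swp S _) (items-cong S (λ v _ → cong (λ x → lab v , x , # (S ∩ adj (co G) v))
     (#-cong (λ u → cong (S u ∧_) (co-co G v u)))))) (comp c))

-- Recovering a unigraph from its degree profile

edge-sym : ∀ {a} (e : CWExpr 5 a) x y → edge e x y ≡ edge e y x
edge-sym (vtx i) x y = refl
edge-sym (_⊕_ {a} e f) x y with splitAt a x | splitAt a y
... | inj₁ x′ | inj₁ y′ = edge-sym e x′ y′
... | inj₁ x′ | inj₂ y′ = refl
... | inj₂ x′ | inj₁ y′ = refl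
... | inj₂ x′ | inj₂ y′ = edge-sym f x′ y′
edge-sym (η i j _ e) x y = cong₂ _∨_ (edge-sym e x y)
  (trans (∨-comm (label e x == i ∧ label e y == j) _)
    (cong₂ _∨_ (∧-comm (label e x == j) _) (∧-comm (label e x == i) _)))
edge-sym (ρ i j e) x y = edge-sym e x y

edge-irrefl : ∀ {a} (e : CWExpr 5 a) x → edge e x x ≡ false
edge-irrefl (vtx i) x = refl
edge-irrefl (_⊕_ {a} e f) x with splitAt a x
... | inj₁ x′ = edge-irrefl e x′
... | inj₂ x′ = edge-irrefl f x′
edge-irrefl (η i j i≢j e) x rewrite edge-irrefl e x = not-true λ h →
  case bool-cases (label e x == i ∧ label e x == j) of λ where
    (inj₁ k) → i≢j (trans (sym (==-true {x = label e x} (∧-elimˡ k))) (==-true {x = label e x} (∧-elimʳ {label e x == i} k)))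
    (inj₂ k) → true≢false (trans (sym (cong₂ _∨_ k (trans (∧-comm (label e x == j) _) k))) h) refl
edge-irrefl (ρ i j e) x = edge-irrefl e x

exprGraph : ∀ {a} → CWExpr 5 a → Graph a
exprGraph e .adj = edge e
exprGraph e .adj-sym = edge-sym e
exprGraph e .adj-irrefl = edge-irrefl e

tabulate-↭ : ∀ {A : Set} {n m} {f : Fin n → A} {g : Fin m → A} → tabulate f ↭ tabulate g →
             Σ (Fin n ↔ Fin m) λ σ → ∀ v → g (Inverse.to σ v) ≡ f v
tabulate-↭ {A} {n} {m} {f} {g} p = cast-id lg ↔-∘ (π ↔-∘ cast-id (sym lf)) , λ v →
    let w = Inverse.to π (cast (sym lf) v) in begin
    g (cast lg w)                                   ≡⟨ lookup-tabulate g (cast lg w) ⟨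
    lookup (tabulate g) (cast (sym lg) (cast lg w)) ≡⟨ cong (lookup (tabulate g)) (cast-involutive (sym lg) lg w) ⟩
    lookup (tabulate g) w                           ≡⟨ onIndices-lookup (setoid A) (↭⇒↭ₛ p) (cast (sym lf) v) ⟨
    lookup (tabulate f) (cast (sym lf) v)           ≡⟨ lookup-tabulate f v ⟩
    f v                                             ∎
  where
  open ≡-Reasoning
  lf = length-tabulate f
  lg = length-tabulate g
  π = onIndices (↭⇒↭ₛ p)

degree-list : ∀ {n} (G : Graph n) lab → map proj₂ (map forget (items full (prof G full lab))) ≡ tabulate (dg G)
degree-list G lab = trans (cong (map proj₂) (items-map forget full (prof G full lab)))
  (trans (items-map proj₂ full (forget ∘ prof G full lab)) (items-full (dg G)))

-- The graph of the expression has the degrees of G up to a permutation, so the unigraph property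
-- supplies the isomorphism.
Good⇒cw : ∀ {n} {G : Graph (suc n)} {lab} → Rigid G → Good G full lab → CwAtMost 5 G
Good⇒cw {n} {G} {lab} (rigid U) (good c) with Con-sound c
... | inj₁ ()
... | inj₂ (a , e , p) with tabulate-↭ degrees
  where
  degrees : tabulate (dg G) ↭ tabulate (dg (exprGraph e))
  degrees = ↭-trans (↭-reflexive (sym (degree-list G lab)))
    (↭-trans (map⁺ proj₂ p) (↭-reflexive (map-tabulate _ proj₂)))
... | σ , h with U (exprGraph e) (σ , λ v → trans (deg≡dg (exprGraph e) _) (trans (h v) (sym (deg≡dg G v))))
... | τ , i with ↔-size τ
... | refl = e , τ , i

-- Realisations of near-regular degree sequences

-- (label , degree , codegree , multiplicity)
Group : Set
Group = Fin 5 × ℕ × ℕ × ℕ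

expand : List Group → List Item
expand []                    = []
expand ((i , d , c , m) ∷ g) = replicate m (i , d , c) ++ expand g

gcnt : (Fin 5 → Bool) → List Group → ℕ
gcnt p []                    = 0
gcnt p ((i , d , c , m) ∷ g) = b2n (p i) * m + gcnt p g

gbump : (Fin 5 → Fin 5 → Bool) → List Group → Group → Group
gbump M h (i , d , c , m) = i , d + gcnt (M i) h , c + gcnt (∁ (M i)) h , m

grelab : Fin 5 → Fin 5 → Group → Group
grelab i j (l , d , c , m) = relabel i j l , d , c , m

cnt-++ : ∀ p P Q → cnt p (P ++ Q) ≡ cnt p P + cnt p Q
cnt-++ p []      Q = refl
cnt-++ p (x ∷ P) Q = trans (cong (b2n (p (proj₁ x)) +_) (cnt-++ p P Q)) (sym (+-assoc (b2n (p (proj₁ x))) _ _))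

cnt-replicate : ∀ p m i {y} → cnt p (replicate m (i , y)) ≡ b2n (p i) * m
cnt-replicate p zero    i = sym (*-zeroʳ (b2n (p i)))
cnt-replicate p (suc m) i = trans (cong (b2n (p i) +_) (cnt-replicate p m i)) (sym (*-suc (b2n (p i)) m))

cnt-expand : ∀ p g → cnt p (expand g) ≡ gcnt p g
cnt-expand p []                    = refl
cnt-expand p ((i , d , c , m) ∷ g) = trans (cnt-++ p (replicate m _) _) (cong₂ _+_ (cnt-replicate p m i) (cnt-expand p g))

map-expand : ∀ (f : Item → Item) (f′ : Group → Group) →
             (∀ i d c m → f′ (i , d , c , m) ≡ (proj₁ (f (i , d , c)) , proj₁ (proj₂ (f (i , d , c))) , proj₂ (proj₂ (f (i , d , c))) , m)) →
             ∀ g → map f (expand g) ≡ expand (map f′ g)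
map-expand f f′ h []                    = refl
map-expand f f′ h ((i , d , c , m) ∷ g) rewrite h i d c m =
  trans (map-++ f (replicate m _) _) (cong₂ _++_ (map-replicate f m _) (map-expand f f′ h g))

GSide : (Fin 5 → Bool) → Bool → List Group → Set
GSide s b = All (λ x → s (proj₁ x) ≡ b)

GSide⇒Side : ∀ {s b} g → GSide s b g → Side s b (expand g)
GSide⇒Side []                    []      = []
GSide⇒Side {s} {b} ((i , d , c , m) ∷ g) (h ∷ a) = lem m
  where
  lem : ∀ m → Side s b (replicate m (i , d , c) ++ expand g)
  lem zero    = GSide⇒Side g a
  lem (suc m) = h ∷ lem m

record GCon (g : List Group) : Set where
  constructor gcon
  field con : Con (expand g)

GCon-resp : ∀ {g h} → expand g ↭ expand h → GCon g → GCon h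
GCon-resp σ (gcon c) = gcon (perm σ c)

GCon-≡ : ∀ {g h} → expand g ≡ expand h → GCon g → GCon h
GCon-≡ e (gcon c) = gcon (Con-resp e c)

expand-++ : ∀ g h → expand (g ++ h) ≡ expand g ++ expand h
expand-++ []                    h = refl
expand-++ ((i , d , c , m) ∷ g) h = trans (cong (replicate m _ ++_) (expand-++ g h)) (sym (++-assoc (replicate m _) (expand g) (expand h)))

gjoin : ∀ s M {g h} → GSide s true g → GSide s false h → GCon g → GCon h →
        GCon (map (gbump M h) g ++ map (gbump (flip M) g) h)
gjoin s M {g} {h} a b (gcon c) (gcon d) = gcon (Con-resp
  (trans (cong₂ _++_ (map-expand _ _ (λ i x y m → cong₂ (λ p q → i , x + p , y + q , m) (sym (cnt-expand (M i) h)) (sym (cnt-expand _ h))) g)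
                     (map-expand _ _ (λ i x y m → cong₂ (λ p q → i , x + p , y + q , m) (sym (cnt-expand (flip M i) g)) (sym (cnt-expand _ g))) h))
         (sym (expand-++ (map (gbump M h) g) _)))
  (join s M (GSide⇒Side g a) (GSide⇒Side h b) c d))

gren : ∀ i j {g} → GCon g → GCon (map (grelab i j) g)
gren i j {g} (gcon c) = gcon (Con-resp (map-expand (relab i j) (grelab i j) (λ _ _ _ _ → refl) g) (ren i j c))

gcomp : ∀ {g} → GCon g → GCon (map (λ { (i , d , c , m) → i , c , d , m }) g)
gcomp {g} (gcon c) = gcon (Con-resp (map-expand swp _ (λ _ _ _ _ → refl) g) (comp c))

gpt : ∀ i → GCon ((i , 0 , 0 , 1) ∷ [])
gpt i = gcon (pt i)

-- Degrees matter only in a nonempty group. Some of the identities with `pred m` fail for `m = 0`,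
-- hence the guards.
rep : ∀ m {i d c d′ c′} → (1 ≤ m → d ≡ d′) → (1 ≤ m → c ≡ c′) →
      replicate {A = Item} m (i , d , c) ≡ replicate m (i , d′ , c′)
rep zero    _ _ = refl
rep (suc m) p q with p (s≤s z≤n) | q (s≤s z≤n)
... | refl | refl = refl

rep′ : ∀ {m m′ i d c d′ c′} → d ≡ d′ → c ≡ c′ → m ≡ m′ → replicate {A = Item} m (i , d , c) ≡ replicate m′ (i , d′ , c′)
rep′ refl refl refl = refl

replicate-++ : ∀ {X : Set} m k {x : X} → replicate m x ++ replicate k x ≡ replicate (m + k) x
replicate-++ zero    k = refl
replicate-++ (suc m) k = cong (_ ∷_) (replicate-++ m k)

right₃ right₃₄ : Fin 5 → Bool
right₃ 3F = false
right₃ _  = true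
right₃₄ 3F = false
right₃₄ 4F = false
right₃₄ _  = true

-- A clique (κ = true) or an independent set (κ = false).
uniform : ∀ κ m → GCon ((3F , b2n κ * pred m , b2n (not κ) * pred m , m) ∷ [])
uniform κ zero    = gcon nil
uniform κ (suc m) = GCon-≡ eq
    (gren 4F 3F (gjoin (λ { 4F → false ; _ → true }) (λ _ _ → κ) (refl ∷ []) (refl ∷ []) (uniform κ m) (gpt 4F)))
  where
  lem : ∀ k m → 1 ≤ m → k * pred m + (k * 1 + 0) ≡ k * m
  lem k (suc m) _ = l k m
    where
    l : ∀ k m → k * m + (k * 1 + 0) ≡ k * suc m
    l = solve-∀
  eq : _ ≡ replicate (suc m) (3F , b2n κ * m , b2n (not κ) * m) ++ []
  eq = trans (cong₂ (λ x y → x ++ y ∷ []) (rep m (lem (b2n κ) m) (lem (b2n (not κ)) m))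
               (cong₂ (λ x y → 3F , x , y) (+-identityʳ _) (+-identityʳ _)))
       (trans (replicate-++ m 1) (trans (rep′ refl refl (+-comm m 1)) (sym (++-identityʳ _))))

Even : ℕ → Set
Even n = ∃ λ h → n ≡ h + h

Even-cancel : ∀ a b → Even (a + b) → Even b → Even a
Even-cancel a b (h , e) (k , refl) = h ∸ k , +-cancelʳ-≡ (k + k) a _ (trans e (sym (trans (lem (h ∸ k) k) (cong₂ _+_ hk hk))))
  where
  lem : ∀ x k → x + x + (k + k) ≡ (x + k) + (x + k)
  lem = solve-∀
  k≤h : k ≤ h
  k≤h with k ≤? h
  ... | yes p = p
  ... | no ¬p = ⊥-elim (<⇒≱ (+-mono-< (≰⇒> ¬p) (≰⇒> ¬p)) (≤-trans (m≤n+m (k + k) a) (≤-reflexive e)))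
  hk = m∸n+n≡m k≤h

Even-*-suc : ∀ d → Even (suc d * d)
Even-*-suc zero    = 0 , refl
Even-*-suc (suc d) = let h , e = Even-*-suc d in h + suc d , trans (lem d) (trans (cong (_+ (suc d + suc d)) e) (lem′ h d))
  where
  lem : ∀ d → suc (suc d) * suc d ≡ suc d * d + (suc d + suc d)
  lem = solve-∀
  lem′ : ∀ h d → h + h + (suc d + suc d) ≡ (h + suc d) + (h + suc d)
  lem′ = solve-∀

parity : ∀ n → Even n ⊎ ∃ λ h → n ≡ suc (h + h)
parity zero    = inj₁ (0 , refl)
parity (suc n) with parity n
... | inj₁ (h , e) = inj₂ (h , cong suc e)
... | inj₂ (h , e) = inj₁ (suc h , trans (cong suc e) (cong suc (sym (+-suc h h))))

odd-≢-even : ∀ h k → suc (h + h) ≢ k + k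
odd-≢-even h zero    ()
odd-≢-even h (suc k) e with trans (suc-injective e) (+-suc k k)
odd-≢-even (suc h) (suc k) e | p = odd-≢-even h k (suc-injective (trans (cong suc (sym (+-suc h h))) p))

half-≤ : ∀ {i k} → i + i ≤ suc (k + k) → i ≤ k
half-≤ {i} {k} le with i ≤? k
... | yes p = p
... | no ¬p = ⊥-elim (<⇒≱ (≤-trans (≤-reflexive (cong suc (sym (+-suc k k)))) (+-mono-≤ (≰⇒> ¬p) (≰⇒> ¬p))) le)

-- The hub, of degree s and codegree s′, and n further vertices of degree d and codegree c.
hub : ℕ → ℕ → ℕ → ℕ → ℕ → List Group
hub n d c s s′ = (0F , s , s′ , 1) ∷ (1F , d , c , n) ∷ []

-- Vertices just attached under the label `3F` have reached the common degree and are merged with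
-- the others.
absorb : ∀ {n d c s s′ m d′ c′ d″ c″ t t′ n′} → GCon ((0F , t , t′ , 1) ∷ (1F , d′ , c′ , n) ∷ (3F , d″ , c″ , m) ∷ []) →
         t ≡ s → t′ ≡ s′ → d′ ≡ d → c′ ≡ c → d″ ≡ d → c″ ≡ c → n + m ≡ n′ → GCon (hub n′ d c s s′)
absorb {n} {d} {c} {s} {s′} {m} g refl refl refl refl refl refl refl = GCon-≡
  (cong ((0F , s , s′) ∷_) (trans (sym (++-assoc (replicate n _) _ [])) (cong (_++ []) (replicate-++ n m))))
  (gren 3F 1F g)

-- The new clique on `suc e` vertices is joined to the hub only: `e` neighbours inside the clique
-- and the hub make degree `suc e`.
hub-clique : ∀ e c s s′ → GCon (hub (suc e + c) (suc e) c s s′) →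
             GCon (hub (suc e + (suc e + c)) (suc e) (suc e + c) (suc e + s) s′)
hub-clique e c s s′ g = absorb
  (gjoin right₃ (λ { 0F 3F → true ; _ _ → false }) (refl ∷ refl ∷ []) (refl ∷ []) g (uniform true (suc e)))
  (l₁ e s) (l₂ e s′) (l₂ e (suc e)) (l₃ e c) (l₄ e c) (l₅ e c) (+-comm (suc e + c) (suc e))
  where
  l₁ : ∀ e s → s + (1 * suc e + 0) ≡ suc e + s
  l₁ = solve-∀
  l₂ : ∀ e s → s + (0 * suc e + 0) ≡ s
  l₂ = solve-∀
  l₃ : ∀ e c → c + (1 * suc e + 0) ≡ suc e + c
  l₃ = solve-∀
  l₄ : ∀ e c → 1 * e + (1 * 1 + (0 * (suc e + c) + 0)) ≡ suc e
  l₄ = solve-∀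
  l₅ : ∀ e c → 0 * e + (0 * 1 + (1 * (suc e + c) + 0)) ≡ suc e + c
  l₅ = solve-∀

-- A separate clique on `suc d` vertices is already `d`-regular and adds only to the codegrees of
-- the rest.
hub-coclique : ∀ d c s s′ → GCon (hub (d + c) d c s s′) →
               GCon (hub (d + (suc d + c)) d (suc d + c) s (suc d + s′))
hub-coclique d c s s′ g = absorb
  (gjoin right₃ (λ _ _ → false) (refl ∷ refl ∷ []) (refl ∷ []) g (uniform true (suc d)))
  (l₂ d s) (l₁ d s′) (l₂ d d) (l₁ d c) (l₄ d c) (l₅ d c) (l₆ d c)
  where
  l₁ : ∀ e s → s + (1 * suc e + 0) ≡ suc e + s
  l₁ = solve-∀
  l₂ : ∀ e s → s + (0 * suc e + 0) ≡ s
  l₂ = solve-∀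
  l₄ : ∀ d c → 1 * d + (0 * 1 + (0 * (d + c) + 0)) ≡ d
  l₄ = solve-∀
  l₅ : ∀ d c → 0 * d + (1 * 1 + (1 * (d + c) + 0)) ≡ suc d + c
  l₅ = solve-∀
  l₆ : ∀ d c → d + c + suc d ≡ d + (suc d + c)
  l₆ = solve-∀

gswap : ∀ {x a b y z} → GCon (x ∷ a ∷ b ∷ y ∷ z) → GCon (x ∷ a ∷ y ∷ b ∷ z)
gswap {x} {a} {b} {y} {z} = GCon-resp (++⁺ˡ (rp x) (++⁺ˡ (rp a)
    (↭-trans (↭-reflexive (sym (++-assoc (rp b) (rp y) _)))
      (↭-trans (++⁺ʳ (expand z) (++-comm (rp b) (rp y))) (↭-reflexive (++-assoc (rp y) (rp b) _))))))
  where
  rp : Group → List Item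
  rp (i , d , c , m) = replicate m (i , d , c)

-- Two independent sets of size i + j, joined completely except for a perfect matching on i of the
-- pairs; those i pairs are the neighbours of the hub.
pairs-hub : ∀ i j → GCon ((0F , i + i , j + j , 1) ∷ (1F , i + j , i + j , i + j) ∷ (2F , i + j , i + j , i + j) ∷ [])
pairs-hub = go
  where
  M : Bool → Fin 5 → Fin 5 → Bool
  M b 0F _  = b
  M b 1F 4F = true
  M b 2F 3F = true
  M b _  _  = false
  add : ∀ b {s s′ k t t′ d c} →
        GCon ((0F , s , s′ , 1) ∷ (1F , k , k , k) ∷ (2F , k , k , k) ∷ []) →
        GCon ((3F , d , c , 1) ∷ (4F , d , c , 1) ∷ []) →
        s + (b2n b * 1 + (b2n b * 1 + 0)) ≡ t → s′ + (b2n (not b) * 1 + (b2n (not b) * 1 + 0)) ≡ t′ →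
        d + b2n b ≡ 1 → c + b2n (not b) ≡ 1 →
        GCon ((0F , t , t′ , 1) ∷ (1F , suc k , suc k , suc k) ∷ (2F , suc k , suc k , suc k) ∷ [])
  add b {s} {s′} {k} {d = d} {c} g h refl refl e₁ e₂ = GCon-≡
    (cong₂ _∷_ refl (trans (sym (++-assoc (replicate k _) (_ ∷ []) _)) (cong₂ _++_ (half k (l₁ k) (l₁ k) (l₂ (b2n b) d k e₁) (l₃ (b2n (not b)) c k e₂))
       (trans (sym (++-assoc (replicate k _) (_ ∷ []) [])) (cong (_++ []) (half k (l₁ k) (l₁ k) (l₃ (b2n b) d k e₁) (l₂ (b2n (not b)) c k e₂)))))))
    (gswap
      (gren 4F 2F (gren 3F 1F (gjoin right₃₄ (M b) (refl ∷ refl ∷ refl ∷ []) (refl ∷ refl ∷ []) g h))))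
    where
    half : ∀ k {i x y x′ y′} → x ≡ suc k → y ≡ suc k → x′ ≡ suc k → y′ ≡ suc k →
           replicate {A = Item} k (i , x , y) ++ (i , x′ , y′) ∷ [] ≡ replicate (suc k) (i , suc k , suc k)
    half k refl refl refl refl = trans (replicate-++ k 1) (rep′ refl refl (+-comm k 1))
    l₁ : ∀ k → k + 1 ≡ suc k
    l₁ k = +-comm k 1
    l₂ : ∀ b d k → d + b ≡ 1 → d + (b * 1 + (0 * k + (1 * k + 0))) ≡ suc k
    l₂ b d k e = trans (l b d k) (cong (_+ k) e)
      where
      l : ∀ b d k → d + (b * 1 + (0 * k + (1 * k + 0))) ≡ d + b + k
      l = solve-∀
    l₃ : ∀ b d k → d + b ≡ 1 → d + (b * 1 + (1 * k + (0 * k + 0))) ≡ suc k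
    l₃ b d k e = trans (l b d k) (cong (_+ k) e)
      where
      l : ∀ b d k → d + (b * 1 + (1 * k + (0 * k + 0))) ≡ d + b + k
      l = solve-∀
  nonadjacent : GCon ((3F , 0 , 1 , 1) ∷ (4F , 0 , 1 , 1) ∷ [])
  nonadjacent = gjoin (λ { 4F → false ; _ → true }) (λ _ _ → false) (refl ∷ []) (refl ∷ []) (gpt 3F) (gpt 4F)
  adjacent : GCon ((3F , 1 , 0 , 1) ∷ (4F , 1 , 0 , 1) ∷ [])
  adjacent = gjoin (λ { 4F → false ; _ → true }) (λ _ _ → true) (refl ∷ []) (refl ∷ []) (gpt 3F) (gpt 4F)
  go : ∀ i j → GCon ((0F , i + i , j + j , 1) ∷ (1F , i + j , i + j , i + j) ∷ (2F , i + j , i + j , i + j) ∷ [])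
  go zero    zero    = gcon (pt 0F)
  go zero    (suc j) = add false (go zero j) adjacent refl (l j) refl refl
    where
    l : ∀ j → j + j + 2 ≡ suc j + suc j
    l = solve-∀
  go (suc i) j       = add true (go i j) nonadjacent (l i) (+-identityʳ _) refl refl
    where
    l : ∀ j → j + j + 2 ≡ suc j + suc j
    l = solve-∀

right₄ : Fin 5 → Bool
right₄ 4F = false
right₄ _  = true

b2n-not : ∀ b → b2n (not b) + b2n b ≡ 1
b2n-not true  = refl
b2n-not false = refl

-- The hub z, independent sets A and B of size k and cliques C and D of size q, with A–B as in pairs-hub,
-- A–C and B–D complete, and a vertex v joined to C ∪ D and, if k = q + 1, to z: a blown-up 5-cycle v C A B D.
odd-hub : ∀ i j k q τ → i + j ≡ k → k ≡ b2n τ + q →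
          GCon (hub (q + k + suc (q + k)) (q + k) (suc (q + k)) (i + i + b2n τ) (j + j + (q + q) + b2n (not τ)))
odd-hub i j k q τ refl e = GCon-≡ {h = hub (q + k + suc (q + k)) _ _ _ _}
  (cong₂ _∷_ (cong₂ (λ x y → 0F , x , y) (x₁ (i + i) (b2n τ)) (x₂ (j + j) q (b2n (not τ))))
    (trans (cong₂ _++_ (rep k (λ _ → a₁ k q) (λ _ → a₂ k q))
      (cong₂ _++_ (rep k (λ _ → b₁ k q) (λ _ → b₂ k q))
        (cong₂ _++_ (rep q (c₁ k) (λ _ → c₂ k q (pred q)))
          (cong₂ _++_ (rep q (d₁ k) (λ _ → d₂ k q (pred q)))
            (cong (_∷ []) (cong₂ (λ x y → 1F , x , y) (e₁ k q e) (e₂ k q e)))))))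
     (collect {k} {q})))
  (gren 4F 1F (gren 3F 1F (gjoin right₄ M₄ (refl ∷ refl ∷ refl ∷ refl ∷ refl ∷ []) (refl ∷ [])
    (gren 4F 3F (gren 2F 1F (gjoin right₄ M₂ (refl ∷ refl ∷ refl ∷ refl ∷ []) (refl ∷ [])
      (gjoin right₃ M₁ (refl ∷ refl ∷ refl ∷ []) (refl ∷ []) (pairs-hub i j) (uniform true q))
      (gren 3F 4F (uniform true q)))))
    (gpt 4F))))
  where
  M₁ M₂ M₄ : Fin 5 → Fin 5 → Bool
  M₁ 1F 3F = true
  M₁ _  _  = false
  M₂ 2F 4F = true
  M₂ _  _  = false
  M₄ 0F 4F = τ
  M₄ 3F 4F = true
  M₄ _  _  = false
  x₁ : ∀ i t → i + 0 + 0 + (t * 1 + 0) ≡ i + t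
  x₁ = solve-∀
  x₂ : ∀ j q t → j + (1 * q + 0) + (1 * q + 0) + (t * 1 + 0) ≡ j + (q + q) + t
  x₂ = solve-∀
  a₁ : ∀ k q → k + (1 * q + 0) + (0 * q + 0) + (0 * 1 + 0) ≡ q + k
  a₁ = solve-∀
  a₂ : ∀ k q → k + (0 * q + 0) + (1 * q + 0) + (1 * 1 + 0) ≡ suc (q + k)
  a₂ = solve-∀
  b₁ : ∀ k q → k + (0 * q + 0) + (1 * q + 0) + (0 * 1 + 0) ≡ q + k
  b₁ = solve-∀
  b₂ : ∀ k q → k + (1 * q + 0) + (0 * q + 0) + (1 * 1 + 0) ≡ suc (q + k)
  b₂ = solve-∀
  c₁ : ∀ k {q} → 1 ≤ q → 1 * pred q + (0 * 1 + (1 * k + (0 * k + 0))) + (0 * q + 0) + (1 * 1 + 0) ≡ q + k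
  c₁ k {suc q} _ = l k q
    where
    l : ∀ k q → 1 * q + (0 * 1 + (1 * k + (0 * k + 0))) + (0 * suc q + 0) + (1 * 1 + 0) ≡ suc q + k
    l = solve-∀
  c₂ : ∀ k q p → 0 * p + (1 * 1 + (0 * k + (1 * k + 0))) + (1 * q + 0) + (0 * 1 + 0) ≡ suc (q + k)
  c₂ = solve-∀
  d₁ : ∀ k {q} → 1 ≤ q → 1 * pred q + (0 * 1 + (0 * k + (1 * k + (0 * q + 0)))) + (1 * 1 + 0) ≡ q + k
  d₁ k {suc q} _ = l k q
    where
    l : ∀ k q → 1 * q + (0 * 1 + (0 * k + (1 * k + (0 * suc q + 0)))) + (1 * 1 + 0) ≡ suc q + k
    l = solve-∀
  d₂ : ∀ k q p → 0 * p + (1 * 1 + (1 * k + (0 * k + (1 * q + 0)))) + (0 * 1 + 0) ≡ suc (q + k)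
  d₂ = solve-∀
  e₁ : ∀ k q → k ≡ b2n τ + q → b2n τ * 1 + (0 * k + (0 * k + (1 * q + (1 * q + 0)))) ≡ q + k
  e₁ k q refl = l (b2n τ) q
    where
    l : ∀ t q → t * 1 + (0 * (t + q) + (0 * (t + q) + (1 * q + (1 * q + 0)))) ≡ q + (t + q)
    l = solve-∀
  e₂ : ∀ k q → k ≡ b2n τ + q → b2n (not τ) * 1 + (1 * k + (1 * k + (0 * q + (0 * q + 0)))) ≡ suc (q + k)
  e₂ k q refl = trans (l (b2n (not τ)) (b2n τ) q) (cong (_+ (q + (b2n τ + q))) (b2n-not τ))
    where
    l : ∀ u t q → u * 1 + (1 * (t + q) + (1 * (t + q) + (0 * q + (0 * q + 0)))) ≡ u + t + (q + (t + q))
    l = solve-∀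
  collect : ∀ {k q} {x : Item} → replicate k x ++ replicate k x ++ replicate q x ++ replicate q x ++ x ∷ [] ≡ replicate (q + k + suc (q + k)) x ++ []
  collect {k} {q} {x} = trans (cong (λ r → replicate k x ++ replicate k x ++ replicate q x ++ r) (replicate-++ q 1))
    (trans (cong (λ r → replicate k x ++ replicate k x ++ r) (replicate-++ q (q + 1)))
    (trans (cong (replicate k x ++_) (replicate-++ k (q + (q + 1))))
    (trans (replicate-++ k (k + (q + (q + 1)))) (trans (rep′ refl refl (l k q)) (sym (++-identityʳ _))))))
    where
    l : ∀ k q → k + (k + (q + (q + 1))) ≡ q + k + suc (q + k)
    l = solve-∀

-- The conditions are necessary: parity is the handshake lemma, a hub has no neighbours among
-- isolated vertices and, in the complement, no non-neighbours among dominating ones. `hubCon` shows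
-- that they suffice.
HubCon : ℕ → Set
HubCon n = ∀ d c s s′ → d + c ≡ n → s + s′ ≡ n → (d ≡ 0 → s ≡ 0) → (c ≡ 0 → s′ ≡ 0) → Even (n * d + s) → GCon (hub n d c s s′)

-- With `d = suc e`, removing a clique of size `d` from the neighbourhood of the hub lowers both `n`
-- and `s` by `d`, hence `n * d + s` by the even number `suc d * d`.
hub-clique-step : ∀ e c₀ s₁ s′ → HubCon (suc e + suc c₀) → suc e + s₁ + s′ ≡ suc e + suc (suc e + c₀) →
                  Even ((suc e + suc (suc e + c₀)) * suc e + (suc e + s₁)) →
                  GCon (hub (suc e + suc (suc e + c₀)) (suc e) (suc (suc e + c₀)) (suc e + s₁) s′)
hub-clique-step e c₀ s₁ s′ IH es ev = subst (λ x → GCon (hub (suc e + x) (suc e) x (suc e + s₁) s′)) (+-suc (suc e) c₀)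
  (hub-clique e (suc c₀) s₁ s′ (IH (suc e) (suc c₀) s₁ s′ refl es′ (λ ()) (λ ()) ev′))
  where
  es′ : s₁ + s′ ≡ suc e + suc c₀
  es′ = +-cancelˡ-≡ (suc e) _ _ (trans (sym (+-assoc (suc e) s₁ s′)) (trans es (cong (suc e +_) (sym (+-suc (suc e) c₀)))))
  lem : ∀ d c s → (d + suc (d + c)) * d + (d + s) ≡ ((d + suc c) * d + s) + suc d * d
  lem = solve-∀
  ev′ : Even ((suc e + suc c₀) * suc e + s₁)
  ev′ = Even-cancel _ (suc (suc e) * suc e) (subst Even (lem (suc e) c₀ s₁) ev) (Even-*-suc (suc e))

-- Here `n` drops by `suc d` and `s` stays, so `n * d + s` again drops by `suc d * d`.
hub-coclique-step : ∀ d c₀ s s₁ → HubCon (d + suc c₀) → s + (suc d + s₁) ≡ d + suc (suc d + c₀) → (d ≡ 0 → s ≡ 0) →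
                    Even ((d + suc (suc d + c₀)) * d + s) →
                    GCon (hub (d + suc (suc d + c₀)) d (suc (suc d + c₀)) s (suc d + s₁))
hub-coclique-step d c₀ s s₁ IH es z ev = subst (λ x → GCon (hub (d + x) d x s (suc d + s₁))) (+-suc (suc d) c₀)
  (hub-coclique d (suc c₀) s s₁ (IH d (suc c₀) s s₁ refl es′ z (λ ()) ev′))
  where
  l₁ : ∀ d s t → s + t + suc d ≡ s + (suc d + t)
  l₁ = solve-∀
  l₂ : ∀ d c → d + suc (suc d + c) ≡ d + suc c + suc d
  l₂ = solve-∀
  es′ : s + s₁ ≡ d + suc c₀
  es′ = +-cancelʳ-≡ (suc d) _ _ (trans (l₁ d s s₁) (trans es (l₂ d c₀)))
  lem : ∀ d c s → (d + suc (suc d + c)) * d + s ≡ ((d + suc c) * d + s) + suc d * d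
  lem = solve-∀
  ev′ : Even ((d + suc c₀) * d + s)
  ev′ = Even-cancel _ (suc d * d) (subst Even (lem d c₀ s) ev) (Even-*-suc d)

hub-resp : ∀ {n d c s s′ n₁ d₁ c₁ s₁ s₁′} → n ≡ n₁ → d ≡ d₁ → c ≡ c₁ → s ≡ s₁ → s′ ≡ s₁′ →
           GCon (hub n d c s s′) → GCon (hub n₁ d₁ c₁ s₁ s₁′)
hub-resp refl refl refl refl refl g = g

-- As `n` is `2 d + 1`, the parity condition says that `s` and `d` have the same parity, which
-- decides whether the vertex `v` of the blown-up 5-cycle sees the hub (`τ`).
hub-odd : ∀ d s s′ → s ≤ d → s + s′ ≡ d + suc d → Even ((d + suc d) * d + s) → GCon (hub (d + suc d) d (suc d) s s′)
hub-odd d s s′ le es ev with parity d | parity s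
... | inj₁ (q , refl) | inj₁ (i , refl) with m≤n⇒∃[o]m+o≡n (half-≤ {i} {q} (≤-trans le (n≤1+n _)))
... | j , refl = hub-resp refl refl refl (+-identityʳ _) (s′-eq j i s′ es) (odd-hub i j (i + j) (i + j) false refl refl)
  where
  s′-eq : ∀ j i s′ → i + i + s′ ≡ i + j + (i + j) + suc (i + j + (i + j)) → j + j + (i + j + (i + j)) + 1 ≡ s′
  s′-eq j i s′ e = +-cancelˡ-≡ (i + i) _ _ (trans (l i j) (sym e))
    where
    l : ∀ i j → i + i + (j + j + (i + j + (i + j)) + 1) ≡ i + j + (i + j) + suc (i + j + (i + j))
    l = solve-∀
hub-odd d s s′ le es ev | inj₁ (q , refl) | inj₂ (i , refl) = ⊥-elim (odd-≢-even i (proj₁ ev′) (proj₂ ev′))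
  where
  lem : ∀ d s → (d + suc d) * d + s ≡ s + ((d * d + d * d) + d)
  lem = solve-∀
  l : ∀ x q → x + x + (q + q) ≡ (x + q) + (x + q)
  l = solve-∀
  ev′ : Even (suc (i + i))
  ev′ = Even-cancel (suc (i + i)) _ (subst Even (lem (q + q) (suc (i + i))) ev) ((q + q) * (q + q) + q , l ((q + q) * (q + q)) q)
hub-odd d s s′ le es ev | inj₂ (q , refl) | inj₁ (i , refl) = ⊥-elim (odd-≢-even q (proj₁ ev′) (proj₂ ev′))
  where
  lem : ∀ d s → (d + suc d) * d + s ≡ d + ((d * d + d * d) + s)
  lem = solve-∀
  l : ∀ x q → x + x + (q + q) ≡ (x + q) + (x + q)
  l = solve-∀
  ev′ : Even (suc (q + q))
  ev′ = Even-cancel (suc (q + q)) _ (subst Even (lem (suc (q + q)) (i + i)) ev) (suc (q + q) * suc (q + q) + i , l (suc (q + q) * suc (q + q)) i)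
hub-odd d s s′ le es ev | inj₂ (q , refl) | inj₂ (i , refl) with m≤n⇒∃[o]m+o≡n (half-≤ {i} {q} (≤-trans (≤-pred le) (n≤1+n _)))
... | j , refl = hub-resp (l₂ i j) (l₁ i j) (cong suc (l₁ i j)) (+-comm _ 1) (s′-eq j i s′ es)
                   (odd-hub i (suc j) (suc (i + j)) (i + j) true (+-suc i j) refl)
  where
  l₁ : ∀ i j → i + j + suc (i + j) ≡ suc (i + j + (i + j))
  l₁ = solve-∀
  l₂ : ∀ i j → i + j + suc (i + j) + suc (i + j + suc (i + j)) ≡ suc (i + j + (i + j)) + suc (suc (i + j + (i + j)))
  l₂ = solve-∀
  s′-eq : ∀ j i s′ → suc (i + i) + s′ ≡ suc (i + j + (i + j)) + suc (suc (i + j + (i + j))) →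
          suc j + suc j + (i + j + (i + j)) + 0 ≡ s′
  s′-eq j i s′ e = +-cancelˡ-≡ (suc (i + i)) _ _ (trans (l i j) (sym e))
    where
    l : ∀ i j → suc (i + i) + (suc j + suc j + (i + j + (i + j)) + 0) ≡ suc (i + j + (i + j)) + suc (suc (i + j + (i + j)))
    l = solve-∀

-- With equal degree and codegree the pairs of `pairs-hub` alone suffice: half of `s` counts those
-- attached to the hub.
hub-even : ∀ d s s′ → s + s′ ≡ d + d → Even s → GCon (hub (d + d) d d s s′)
hub-even d _ s′ es (i , refl) with m≤n⇒∃[o]m+o≡n (half-≤ {i} {d} (≤-trans (m≤m+n (i + i) s′) (≤-trans (≤-reflexive es) (n≤1+n _))))
... | j , refl = hub-resp refl refl refl refl (+-cancelˡ-≡ (i + i) _ _ (trans (l i j) (sym es)))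
        (GCon-≡ {h = hub _ _ _ _ _} (cong₂ _∷_ refl (trans (sym (++-assoc (replicate (i + j) _) (replicate (i + j) _) []))
                                 (cong (_++ []) (replicate-++ (i + j) (i + j)))))
          (gren 2F 1F (pairs-hub i j)))
  where
  l : ∀ i j → i + i + (j + j) ≡ i + j + (i + j)
  l = solve-∀

-- For d < c there is room to peel off a K_d inside the neighbourhood of the hub or a K_{d+1} outside it, except
-- when c = d + 1 and the hub has few neighbours.
hub-sparse : ∀ n → (∀ {m} → m < n → HubCon m) → ∀ d c s s′ → d < c → d + c ≡ n → s + s′ ≡ n → (d ≡ 0 → s ≡ 0) → Even (n * d + s) →
             GCon (hub n d c s s′)
hub-sparse n IH d c s s′ lt refl es z ev with m≤n⇒∃[o]m+o≡n lt
... | c₀ , refl = cases d z lt (d ≤? s) IH es ev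
  where
  low : ∀ d c₀ → s ≤ d → (d ≡ 0 → s ≡ 0) → (∀ {m} → m < d + suc (d + c₀) → HubCon m) →
        s + s′ ≡ d + suc (d + c₀) → Even ((d + suc (d + c₀)) * d + s) → GCon (hub (d + suc (d + c₀)) d (suc (d + c₀)) s s′)
  low d zero s≤d z IH es ev = hub-resp (cong (λ x → d + suc x) (sym d0)) refl (cong suc (sym d0)) refl refl
      (hub-odd d s s′ s≤d (trans es (cong (λ x → d + suc x) d0)) (subst (λ x → Even ((d + suc x) * d + s)) d0 ev))
    where d0 = +-identityʳ d
  low d (suc c₁) s≤d z IH es ev with m≤n⇒∃[o]m+o≡n {suc d} {s′} d<s′
    where
    d<s′ : d < s′
    d<s′ = +-cancelˡ-< s d s′ (≤-<-trans (+-monoˡ-≤ d s≤d) (subst (d + d <_) (sym es) (+-monoʳ-< d (s≤s (m≤m+n d (suc c₁))))))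
  ... | s₁ , refl = hub-resp (cong (λ x → d + suc x) (sym (+-suc d c₁))) refl (cong suc (sym (+-suc d c₁))) refl refl
      (hub-coclique-step d c₁ s s₁ (IH (+-monoʳ-< d (s≤s (m≤n+m (suc c₁) d))))
        (trans es (cong (λ x → d + suc x) (+-suc d c₁))) z (subst (λ x → Even ((d + suc x) * d + s)) (+-suc d c₁) ev))
  cases : ∀ d → (d ≡ 0 → s ≡ 0) → d < suc (d + c₀) → Dec (d ≤ s) → (∀ {m} → m < d + suc (d + c₀) → HubCon m) →
          s + s′ ≡ d + suc (d + c₀) → Even ((d + suc (d + c₀)) * d + s) → GCon (hub (d + suc (d + c₀)) d (suc (d + c₀)) s s′)
  cases d       z lt (no ¬le) IH es ev = low d c₀ (<⇒≤ (≰⇒> ¬le)) z IH es ev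
  cases zero    z lt (yes le) IH es ev = low 0 c₀ (≤-reflexive (z refl)) z IH es ev
  cases (suc e) z lt (yes le) IH es ev with m≤n⇒∃[o]m+o≡n le
  ... | s₁ , refl = hub-clique-step e c₀ s₁ s′ (IH (+-monoʳ-< (suc e) (s≤s (s≤s (m≤n+m c₀ e))))) es ev

-- When `d ≠ c`, the sequence or its complement is sparse. Parity passes to the complement because
-- the two degree sums add up to `n * (n + 1)`.
hubCon : ∀ n → HubCon n
hubCon = <-rec HubCon step
  where
  lem′ : ∀ d s → (d + d) * d + s ≡ s + (d * d + d * d)
  lem′ = solve-∀
  step : ∀ n → (∀ {m} → m < n → HubCon m) → HubCon n
  step n IH d c s s′ e es z z′ ev with <-cmp d c
  ... | tri< lt _ _ = hub-sparse n IH d c s s′ lt e es z ev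
  ... | tri≈ _ refl _ = subst (λ x → GCon (hub x d d s s′)) e (hub-even d s s′ (trans es (sym e))
      (Even-cancel s (d * d + d * d) (subst Even (trans (cong (λ x → x * d + s) (sym e)) (lem′ d s)) ev) (d * d , refl)))
  ... | tri> _ _ gt = gcomp (hub-sparse n IH c d s′ s gt (trans (+-comm c d) e) (trans (+-comm s′ s) es) z′
                        (Even-cancel _ (n * d + s) (subst Even (sym (trans (lem n c d s s′) (trans (cong₂ (λ x y → n * x + y) e es) (+-comm (n * n) n)))) (Even-*-suc n)) ev))
    where
    lem : ∀ n c d s s′ → n * c + s′ + (n * d + s) ≡ n * (d + c) + (s + s′)
    lem = solve-∀

-- A hub and m rows, together a clique (k = 1, k′ = 0) or independent (k = 0, k′ = 1), against N columns that
-- are uniform the other way round. Towards the other side, the hub has degree s and codegree s′,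
-- a row α and α′, a column β and β′.
bip : (k k′ m N α α′ β β′ s s′ : ℕ) → List Group
bip k k′ m N α α′ β β′ s s′ =
  (0F , s + k * m , s′ + k′ * m , 1) ∷
  (1F , α + k * m , α′ + k′ * m , m) ∷
  (2F , β + k′ * pred N , β′ + k * pred N , N) ∷ []

bipᵇ : Bool → (m N α α′ β β′ s s′ : ℕ) → List Group
bipᵇ κ = bip (b2n κ) (b2n (not κ))

b2n-not-not : ∀ κ → b2n (not (not κ)) ≡ b2n κ
b2n-not-not κ = cong b2n (not-involutive κ)

block : ∀ κ r t → GCon ((3F , b2n κ * pred r + t , b2n (not κ) * pred r , r) ∷ (4F , b2n (not κ) * pred t + r , b2n κ * pred t , t) ∷ [])
block κ r t = GCon-≡
  (cong₂ _++_ (rep r (λ _ → l₁ (b2n κ * pred r) t) (λ _ → l₂ (b2n (not κ) * pred r) t))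
    (cong₂ _++_ (rep t (λ _ → l₁ (b2n (not κ) * pred t) r) (λ _ → trans (l₂ (b2n (not (not κ)) * pred t) r) (cong (_* pred t) (b2n-not-not κ)))) refl))
  (gjoin right₄ (λ _ _ → true) (refl ∷ []) (refl ∷ []) (uniform κ r) (gren 3F 4F (uniform (not κ) t)))
  where
  l₁ : ∀ x t → x + (1 * t + 0) ≡ x + t
  l₁ = solve-∀
  l₂ : ∀ x t → x + (0 * t + 0) ≡ x
  l₂ = solve-∀

-- The block of `r` rows and `α` columns is complete inside and has no other row-column edges,
-- except that `σ` joins the hub to its columns. So a block row gets `α` neighbours, a block column
-- `r` plus possibly the hub, which is `β`, and the old rows and columns keep theirs.
bip-step : ∀ κ σ m N α α′ β β′ s s′ r → α + α′ ≡ N → r + b2n σ ≡ β → β′ + r ≡ m + b2n (not σ) →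
           GCon (bipᵇ κ m N α α′ β β′ s s′) →
           GCon (bipᵇ κ (m + r) (N + α) α (α′ + α) β (β′ + r) (s + b2n σ * α) (s′ + b2n (not σ) * α))
bip-step κ σ m N α α′ β β′ s s′ r eα eβ eβ′ g = GCon-≡
  (cong₂ _∷_ (cong₂ (λ x y → 0F , x , y) (f₁ s k m r (b2n σ) α) (f₁ s′ k′ m r (b2n (not σ)) α))
    (trans (sym (++-assoc (replicate m _) (replicate r _) _)) (cong₂ _++_
      (trans (cong₂ _++_ (rep m (λ _ → r₁ α k m r) (λ _ → r₂ α′ k′ m r α)) (rep r (r₃ k) (λ h → trans (r₄ k′ h) (cong (λ z → z + k′ * (m + r)) (trans (sym eα) (+-comm α α′))))))
             (replicate-++ m r))
      (trans (sym (++-assoc (replicate N _) (replicate α _) [])) (cong (_++ []) (trans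
        (cong₂ _++_ (rep N (c₁ β k′ N r α) (λ h → trans (cong (λ z → β′ + k * pred N + (1 * r + (z * α + 0))) (b2n-not-not κ)) (c₂ k h)))
                    (rep α (c₃ k′) (λ h → trans (cong (λ z → k * pred α + (b2n (not σ) * 1 + (1 * m + (z * N + 0)))) (b2n-not-not κ)) (c₄ k h))))
        (replicate-++ N α)))))))
  (gswap (gren 4F 2F (gren 3F 1F
    (gjoin right₃₄ M (refl ∷ refl ∷ refl ∷ []) (refl ∷ refl ∷ []) g (block κ r α)))))
  where
  k  = b2n κ
  k′ = b2n (not κ)
  M : Fin 5 → Fin 5 → Bool
  M 0F 3F = κ
  M 1F 3F = κ
  M 0F 4F = σ
  M 2F 4F = not κ
  M _  _  = false
  f₁ : ∀ s k m r σ t → s + k * m + (k * r + (σ * t + 0)) ≡ s + σ * t + k * (m + r)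
  f₁ = solve-∀
  r₁ : ∀ α k m r → α + k * m + (k * r + (0 * α + 0)) ≡ α + k * (m + r)
  r₁ = solve-∀
  r₂ : ∀ α k m r t → α + k * m + (k * r + (1 * t + 0)) ≡ α + t + k * (m + r)
  r₂ = solve-∀
  r₃ : ∀ k {r} → 1 ≤ r → k * pred r + α + (k * 1 + (k * m + (0 * N + 0))) ≡ α + k * (m + r)
  r₃ k {suc r} _ = l k r α m N
    where
    l : ∀ k r α m N → k * r + α + (k * 1 + (k * m + (0 * N + 0))) ≡ α + k * (m + suc r)
    l = solve-∀
  r₄ : ∀ k {r} → 1 ≤ r → k * pred r + (k * 1 + (k * m + (1 * N + 0))) ≡ N + k * (m + r)
  r₄ k {suc r} _ = l k r m N
    where
    l : ∀ k r m N → k * r + (k * 1 + (k * m + (1 * N + 0))) ≡ N + k * (m + suc r)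
    l = solve-∀
  c₁ : ∀ β k N r t → 1 ≤ N → β + k * pred N + (0 * r + (k * t + 0)) ≡ β + k * pred (N + t)
  c₁ β k (suc N) r t _ = l β k N r t
    where
    l : ∀ β k N r t → β + k * N + (0 * r + (k * t + 0)) ≡ β + k * (N + t)
    l = solve-∀
  c₂ : ∀ k {N} → 1 ≤ N → β′ + k * pred N + (1 * r + (k * α + 0)) ≡ β′ + r + k * pred (N + α)
  c₂ k {suc N} _ = l β′ k N r α
    where
    l : ∀ β k N r t → β + k * N + (1 * r + (k * t + 0)) ≡ β + r + k * (N + t)
    l = solve-∀
  pred-+ : ∀ {t} → 1 ≤ t → pred (N + t) ≡ N + pred t
  pred-+ {suc t} _ = cong pred (+-suc N t)
  c₃ : ∀ k → 1 ≤ α → k * pred α + r + (b2n σ * 1 + (0 * m + (k * N + 0))) ≡ β + k * pred (N + α)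
  c₃ k h = trans (l k (pred α) r (b2n σ) m N) (cong₂ (λ x y → x + k * y) eβ (sym (pred-+ h)))
    where
    l : ∀ k a r σ m N → k * a + r + (σ * 1 + (0 * m + (k * N + 0))) ≡ r + σ + k * (N + a)
    l = solve-∀
  c₄ : ∀ k → 1 ≤ α → k * pred α + (b2n (not σ) * 1 + (1 * m + (k * N + 0))) ≡ β′ + r + k * pred (N + α)
  c₄ k h = trans (l k (pred α) (b2n (not σ)) m N) (cong₂ (λ x y → x + k * y) (sym eβ′) (sym (pred-+ h)))
    where
    l : ∀ k a σ m N → k * a + (σ * 1 + (1 * m + (k * N + 0))) ≡ m + σ + k * (N + a)
    l = solve-∀

bip-base : ∀ κ m N σ → GCon (bipᵇ κ m N 0 N (b2n σ) (b2n (not σ) + m) (b2n σ * N) (b2n (not σ) * N))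
bip-base κ m N σ = GCon-≡
  (cong₂ _∷_ (cong₂ (λ x y → 0F , x , y) (f k m (b2n σ) N) (f k′ m (b2n (not σ)) N))
    (cong₂ _++_ (rep m (r₁ k) (r₂ k′))
      (cong₂ _++_ (rep N (λ _ → c₁ k′ (pred N) (b2n σ) m) (λ _ → trans (cong (λ z → z * pred N + (b2n (not σ) * 1 + (1 * m + 0))) (b2n-not-not κ)) (c₂ k (pred N) (b2n (not σ)) m))) refl)))
  (gren 3F 2F (gjoin right₃ M (refl ∷ refl ∷ []) (refl ∷ [])
    (gren 3F 1F (gjoin right₃ (λ _ _ → κ) (refl ∷ []) (refl ∷ []) (gpt 0F) (uniform κ m)))
    (uniform (not κ) N)))
  where
  k  = b2n κ
  k′ = b2n (not κ)
  M : Fin 5 → Fin 5 → Bool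
  M 0F 3F = σ
  M _  _  = false
  f : ∀ k m σ N → k * m + 0 + (σ * N + 0) ≡ σ * N + k * m
  f = solve-∀
  r₁ : ∀ k {m} → 1 ≤ m → k * pred m + (k * 1 + 0) + (0 * N + 0) ≡ k * m
  r₁ k {suc m} _ = l k m N
    where
    l : ∀ k m N → k * m + (k * 1 + 0) + (0 * N + 0) ≡ k * suc m
    l = solve-∀
  r₂ : ∀ k {m} → 1 ≤ m → k * pred m + (k * 1 + 0) + (1 * N + 0) ≡ N + k * m
  r₂ k {suc m} _ = l k m N
    where
    l : ∀ k m N → k * m + (k * 1 + 0) + (1 * N + 0) ≡ N + k * suc m
    l = solve-∀
  c₁ : ∀ k n σ m → k * n + (σ * 1 + (0 * m + 0)) ≡ σ + k * n
  c₁ = solve-∀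
  c₂ : ∀ k n σ m → k * n + (σ * 1 + (1 * m + 0)) ≡ σ + m + k * n
  c₂ = solve-∀

-- The last equation counts the edges between the two sides in two ways. `bipCon` shows that any
-- numbers satisfying it are realised.
BipCon : ℕ → Set
BipCon n = ∀ κ m N α α′ β β′ s s′ → m + N ≡ n → α + α′ ≡ N → β + β′ ≡ suc m → s + s′ ≡ N → m * α + s ≡ N * β →
           GCon (bipᵇ κ m N α α′ β β′ s s′)

bip-resp : ∀ {κ} {m N α α′ β β′ s s′ m₁ N₁ α₁ α₁′ β₁ β₁′ s₁ s₁′} →
           m ≡ m₁ → N ≡ N₁ → α ≡ α₁ → α′ ≡ α₁′ → β ≡ β₁ → β′ ≡ β₁′ → s ≡ s₁ → s′ ≡ s₁′ →
           GCon (bipᵇ κ m N α α′ β β′ s s′) → GCon (bipᵇ κ m₁ N₁ α₁ α₁′ β₁ β₁′ s₁ s₁′)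
bip-resp refl refl refl refl refl refl refl refl g = g

-- Columns can see only the hub, so if there are columns, `β` is 0 or 1, and the hub is accordingly
-- empty or full.
bip-empty-rows : ∀ κ m N β β′ s s′ → β + β′ ≡ suc m → s + s′ ≡ N → s ≡ N * β → GCon (bipᵇ κ m N 0 N β β′ s s′)
bip-empty-rows κ m zero    β β′ zero zero _ _ _ = GCon-≡ refl (bip-base κ m 0 false)
bip-empty-rows κ m (suc N) zero β′ s s′ refl es e = bip-resp {κ} {m} {suc N} {0} {suc N} {0} {suc m} refl refl refl refl refl refl (sym s0)
      (trans (+-identityʳ _) (trans (sym es) (cong (_+ s′) s0)))
      (bip-base κ m (suc N) false)
  where
  s0 : s ≡ 0
  s0 = trans e (*-zeroʳ N)
bip-empty-rows κ m (suc N) (suc zero) β′ s s′ refl es e = bip-resp {κ} {m} {suc N} {0} {suc N} {1} {m} refl refl refl refl refl refl (trans (+-identityʳ _) (sym sN))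
      (sym s′0)
      (bip-base κ m (suc N) true)
  where
  sN : s ≡ suc N
  sN = trans e (*-identityʳ (suc N))
  s′0 : s′ ≡ 0
  s′0 = +-cancelˡ-≡ s s′ 0 (trans es (trans (sym sN) (sym (+-identityʳ s))))
bip-empty-rows κ m (suc N) (suc (suc β)) β′ s s′ eβ es e =
  ⊥-elim (<⇒≱ (m<m*n (suc N) (suc (suc β)) (s≤s (s≤s z≤n))) (≤-trans (≤-reflexive (sym e)) (≤-trans (m≤m+n s s′) (≤-reflexive es))))

β-bound : ∀ m N α β s → 1 ≤ N → α ≤ N → s ≤ N → m * α + s ≡ N * β → β ≤ suc m
β-bound m N@(suc _) α β s _ αN sN e = *-cancelˡ-≤ N (begin
  N * β          ≡⟨ e ⟨
  m * α + s      ≤⟨ +-mono-≤ (*-monoʳ-≤ m αN) sN ⟩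
  m * N + N      ≡⟨ +-comm (m * N) N ⟩
  suc m * N      ≡⟨ *-comm (suc m) N ⟩
  N * suc m      ∎)
  where open ≤-Reasoning

-- The block consists of `β` rows and `α` columns that the hub does not see.
bip-far : ∀ κ m a α₁ β s s₁ → let α = suc a; N = α + α₁ in
          BipCon (m + N) → s + s₁ ≡ N → m * α + s ≡ N * β →
          GCon (bipᵇ κ (β + m) (α + N) α N β (suc m) s (α + s₁))
bip-far κ m a α₁ β s s₁ IH es e with m≤n⇒∃[o]m+o≡n (β-bound m (suc a + α₁) (suc a) β s (s≤s z≤n) (m≤m+n (suc a) α₁) (≤-trans (m≤m+n s s₁) (≤-reflexive es)) e)
... | β₁ , eβ = bip-resp {κ} (+-comm m β) (+-comm (suc a + α₁) (suc a)) refl (+-comm α₁ (suc a)) refl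
      β₁β (+-identityʳ s) (trans (cong (s₁ +_) (*-identityˡ (suc a))) (+-comm s₁ (suc a)))
      (bip-step κ false m (suc a + α₁) (suc a) α₁ β β₁ s s₁ β refl (+-identityʳ β) (trans β₁β (+-comm 1 m))
        (IH κ m (suc a + α₁) (suc a) α₁ β β₁ s s₁ refl refl eβ es e))
  where
  β₁β : β₁ + β ≡ suc m
  β₁β = trans (+-comm β₁ β) eβ

-- The hub sees the `α` block columns and is one of their `suc b` neighbours, so the block needs
-- only `b` rows.
bip-near : ∀ κ m a α₁ b s₁ s′ → let α = suc a; N = α + α₁ in
           BipCon (m + N) → s₁ + s′ ≡ N → m * α + s₁ ≡ N * suc b →
           GCon (bipᵇ κ (b + m) (α + N) α N (suc b) m (α + s₁) s′)
bip-near κ m a α₁ b s₁ s′ IH es e with m≤n⇒∃[o]m+o≡n (β-bound m (suc a + α₁) (suc a) (suc b) s₁ (s≤s z≤n) (m≤m+n (suc a) α₁) (≤-trans (m≤m+n s₁ s′) (≤-reflexive es)) e)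
... | β₁ , eβ = bip-resp {κ} (+-comm m b) (+-comm (suc a + α₁) (suc a)) refl (+-comm α₁ (suc a)) refl
      β₁b (trans (cong (s₁ +_) (*-identityˡ (suc a))) (+-comm s₁ (suc a))) (+-identityʳ s′)
      (bip-step κ true m (suc a + α₁) (suc a) α₁ (suc b) β₁ s₁ s′ b refl (+-comm b 1) (trans β₁b (sym (+-identityʳ m)))
        (IH κ m (suc a + α₁) (suc a) α₁ (suc b) β₁ s₁ s′ refl refl eβ es e))
  where
  β₁b : β₁ + b ≡ m
  β₁b = trans (+-comm β₁ b) (suc-injective eβ)

-- Here 2α ≤ N, so the hub has α neighbours or α non-neighbours, with which a complete bipartite block is peeled off.
bip-sparse : ∀ n → (∀ {n′} → n′ < n → BipCon n′) → ∀ κ m N α α₁ β β′ s s′ → m + N ≡ n → α + (α + α₁) ≡ N → β + β′ ≡ suc m →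
             s + s′ ≡ N → m * α + s ≡ N * β → GCon (bipᵇ κ m N α (α + α₁) β β′ s s′)
bip-sparse n IH κ m N zero α₁ β β′ s s′ en refl eβ es e = bip-empty-rows κ m α₁ β β′ s s′ eβ es (trans (cong (_+ s) (sym (*-zeroʳ m))) e)
bip-sparse n IH κ m N (suc a) α₁ β β′ s s′ refl refl eβ es e = go (suc a ≤? s′)
  where
  α = suc a
  N₁ = α + α₁
  IH′ : ∀ b m₁ → b + m₁ ≡ m → BipCon (m₁ + N₁)
  IH′ b m₁ refl = IH (+-mono-≤-< (m≤n+m m₁ b) (s≤s (m≤n+m N₁ a)))
  -- There must be `β` rows to remove. From `s + α ≤ α + N₁` follows `(s + α) * β ≤ m * α + s`,
  -- hence `β * α ≤ m * α` for positive `β`.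
  far-m : ∀ β → m * α + s ≡ (α + N₁) * β → α ≤ s′ → β ≤ m
  far-m zero    _ _  = z≤n
  far-m (suc b) e le = *-cancelʳ-≤ (suc b) m α (+-cancelʳ-≤ s _ _ (begin
    suc b * α + s                  ≤⟨ +-monoʳ-≤ (suc b * α) (m≤m+n s (b * s)) ⟩
    suc b * α + (s + b * s)        ≡⟨ l b α s ⟩
    (s + α) * suc b                ≤⟨ *-monoˡ-≤ (suc b) (≤-trans (+-monoʳ-≤ s le) (≤-reflexive es)) ⟩
    (α + N₁) * suc b               ≡⟨ e ⟨
    m * α + s ∎))
    where
    open ≤-Reasoning
    l : ∀ b α s → suc b * α + (s + b * s) ≡ (s + α) * suc b
    l = solve-∀
  near-m : ∀ b → m * α + s ≡ (α + N₁) * suc b → b ≤ m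
  near-m b e = *-cancelʳ-≤ b m α (+-cancelʳ-≤ s _ _ (begin
    b * α + s                      ≤⟨ +-mono-≤ (*-monoʳ-≤ b (m≤m+n α N₁)) (≤-trans (m≤m+n s s′) (≤-reflexive es)) ⟩
    b * (α + N₁) + (α + N₁)        ≡⟨ l b (α + N₁) ⟩
    (α + N₁) * suc b               ≡⟨ e ⟨
    m * α + s ∎))
    where
    open ≤-Reasoning
    l : ∀ b x → b * x + x ≡ x * suc b
    l = solve-∀
  far : ∀ m₁ s₁ → α + s₁ ≡ s′ → β + m₁ ≡ m → GCon (bipᵇ κ m N α N₁ β β′ s s′)
  far m₁ s₁ refl refl = bip-resp {κ} refl refl refl refl refl (+-cancelˡ-≡ β _ _ (trans (+-suc β m₁) (sym eβ))) refl refl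
      (bip-far κ m₁ a α₁ β s s₁ (IH′ β m₁ refl) es₁ (+-cancelʳ-≡ (β * α) _ _ (trans (l₁ β m₁ α s) (trans e (l₂ β α N₁)))))
    where
    l₀ : ∀ α s t → s + t + α ≡ s + (α + t)
    l₀ = solve-∀
    es₁ : s + s₁ ≡ N₁
    es₁ = +-cancelʳ-≡ α _ _ (trans (l₀ α s s₁) (trans es (+-comm α N₁)))
    l₁ : ∀ b m α s → m * α + s + b * α ≡ (b + m) * α + s
    l₁ = solve-∀
    l₂ : ∀ b α y → (α + y) * b ≡ y * b + b * α
    l₂ = solve-∀
  near : ∀ b m₁ s₁ → α + s₁ ≡ s → b + m₁ ≡ m → suc b ≡ β → GCon (bipᵇ κ m N α N₁ β β′ s s′)
  near b m₁ s₁ refl refl refl = bip-resp {κ} refl refl refl refl refl (+-cancelˡ-≡ (suc b) _ _ (sym eβ)) refl refl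
      (bip-near κ m₁ a α₁ b s₁ s′ (IH′ b m₁ refl) es₁ (+-cancelʳ-≡ (suc b * α) _ _ (trans (l₁ b m₁ α s₁) (trans e (l₂ b α N₁)))))
    where
    es₁ : s₁ + s′ ≡ N₁
    es₁ = +-cancelˡ-≡ α _ _ (trans (sym (+-assoc α s₁ s′)) es)
    l₁ : ∀ b m α s → m * α + s + suc b * α ≡ (b + m) * α + (α + s)
    l₁ = solve-∀
    l₂ : ∀ b α y → (α + y) * suc b ≡ y * suc b + suc b * α
    l₂ = solve-∀
  go : Dec (α ≤ s′) → GCon (bipᵇ κ m N α N₁ β β′ s s′)
  go (yes le) = let m₁ , em = m≤n⇒∃[o]m+o≡n (far-m β e le); s₁ , e₁ = m≤n⇒∃[o]m+o≡n le in far m₁ s₁ e₁ em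
  go (no ¬le) = go′ β refl
    where
    N₁<s : N₁ < s
    N₁<s = +-cancelʳ-< s′ N₁ s (subst (N₁ + s′ <_) (trans (+-comm N₁ α) (sym es)) (+-monoʳ-< N₁ (≰⇒> ¬le)))
    go′ : ∀ b → b ≡ β → GCon (bipᵇ κ m N α N₁ β β′ s s′)
    go′ zero    refl = ⊥-elim (<⇒≱ (≤-<-trans z≤n N₁<s) (≤-trans (m≤n+m s (m * α)) (≤-reflexive (trans e (*-zeroʳ (α + N₁))))))
    go′ (suc b) refl = let m₁ , em = m≤n⇒∃[o]m+o≡n (near-m b e)
                           s₁ , e₁ = m≤n⇒∃[o]m+o≡n (≤-trans (m≤m+n α α₁) (<⇒≤ N₁<s)) in near b m₁ s₁ e₁ em refl

bipCon : ∀ n → BipCon n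
bipCon = <-rec BipCon step
  where
  step : ∀ n → (∀ {n′} → n′ < n → BipCon n′) → BipCon n
  step n IH κ m N α α′ β β′ s s′ en eα eβ es e with ≤-total α α′
  ... | inj₁ le = let α₁ , p = m≤n⇒∃[o]m+o≡n le in
        subst (λ x → GCon (bipᵇ κ m N α x β β′ s s′)) p
          (bip-sparse n IH κ m N α α₁ β β′ s s′ en (trans (cong (α +_) p) eα) eβ es e)
  ... | inj₂ le = let α₁ , p = m≤n⇒∃[o]m+o≡n le in dense κ
          (subst (λ x → GCon (bipᵇ (not κ) m N α′ x β′ β s′ s)) p
            (bip-sparse n IH (not κ) m N α′ α₁ β′ β s′ s en (trans (cong (α′ +_) p) (trans (+-comm α′ α) eα)) (trans (+-comm β′ β) eβ) (trans (+-comm s′ s) es) e′))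
    where
    l₁ : ∀ m α α′ s s′ → m * α′ + s′ + (m * α + s) ≡ m * (α + α′) + (s + s′)
    l₁ = solve-∀
    l₂ : ∀ m N → m * N + N ≡ N * suc m
    l₂ = solve-∀
    e′ : m * α′ + s′ ≡ N * β′
    e′ = +-cancelʳ-≡ (m * α + s) _ _ (trans (l₁ m α α′ s s′) (trans (cong₂ (λ x y → m * x + y) eα es) (trans (l₂ m N)
           (trans (cong (N *_) (sym eβ)) (trans (*-distribˡ-+ N β β′) (trans (+-comm (N * β) _) (cong (N * β′ +_) (sym e))))))))
    -- Matching on `κ` makes `not (not κ)` compute.
    dense : ∀ κ → GCon (bipᵇ (not κ) m N α′ α β′ β s′ s) → GCon (bipᵇ κ m N α α′ β β′ s s′)
    dense true  = gcomp
    dense false = gcomp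

-- Recognising the realised degree sequences inside a graph

wsum : ∀ {n} → (Fin n → Bool) → (Fin n → ℕ) → ℕ
wsum S w = sum (λ v → b2n (S v) * w v)

wsum-split : ∀ {n} (S T : Fin n → Bool) w → wsum S w ≡ wsum (S ∩ T) w + wsum (S ∩ ∁ T) w
wsum-split S T w = trans (sum-cong-≗ (λ v → lem (S v) (T v) (w v))) (∑-distrib-+ (λ v → b2n ((S ∩ T) v) * w v) (λ v → b2n ((S ∩ ∁ T) v) * w v))
  where
  lem : ∀ a b x → b2n a * x ≡ b2n (a ∧ b) * x + b2n (a ∧ not b) * x
  lem true  true  x = sym (+-identityʳ _)
  lem true  false x = refl
  lem false _     x = refl

wsum-const : ∀ {n} (S : Fin n → Bool) w d → (∀ v → S v ≡ true → w v ≡ d) → wsum S w ≡ # S * d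
wsum-const {zero}  S w d h = refl
wsum-const {suc n} S w d h with S zero | h zero
... | true  | e = cong₂ _+_ (trans (+-identityʳ _) (e refl)) (wsum-const (S ∘ suc) (w ∘ suc) d (h ∘ suc))
... | false | _ = wsum-const (S ∘ suc) (w ∘ suc) d (h ∘ suc)

wsum-point : ∀ {n} (S : Fin n → Bool) w x → S x ≡ true → wsum S w ≡ w x + wsum (S ∖ x) w
wsum-point S w x Sx = trans (wsum-split S ⟦ x ⟧ w) (cong (_+ wsum (S ∖ x) w)
  (trans (wsum-const (S ∩ ⟦ x ⟧) w (w x) (λ v h → cong w (==-true {x = v} (∧-elimʳ {S v} h))))
    (trans (cong (_* w x) (trans (#-⟦⟧ S x) (cong b2n Sx))) (+-identityʳ _))))

double-count : ∀ {n} (G : Graph n) (A B : Fin n → Bool) → wsum A (λ a → # (B ∩ adj G a)) ≡ wsum B (λ b → # (A ∩ adj G b))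
double-count {n} G A B = trans (sum-cong-≗ (λ a → row A B a))
  (trans (∑-comm (λ a b → b2n (A a ∧ (B b ∧ adj G a b))))
  (sym (trans (sum-cong-≗ (λ b → row B A b)) (sum-cong-≗ (λ b → sum-cong-≗ (λ a → cong b2n (lem (A a) (B b) (adj-sym G b a))))))))
  where
  lem : ∀ a b {x y} → x ≡ y → b ∧ (a ∧ x) ≡ a ∧ (b ∧ y)
  lem true  true  refl = refl
  lem true  false refl = refl
  lem false true  refl = refl
  lem false false refl = refl
  row : ∀ (A B : Fin n → Bool) a → b2n (A a) * # (B ∩ adj G a) ≡ sum (λ b → b2n (A a ∧ (B b ∧ adj G a b)))
  row A B a with A a
  ... | true  = trans (+-identityʳ _) (#-sum (B ∩ adj G a))
  ... | false = sym (trans (sym (#-sum {n} (λ _ → false))) (#-none {n} (λ _ → refl)))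

-- Row and column of the first vertex contribute the same number, so together an even one; the rest
-- is the same statement with one vertex less.
handshake : ∀ {n} (f : Fin n → Fin n → Bool) → (∀ u v → f u v ≡ f v u) → (∀ v → f v v ≡ false) → Even (sum (λ v → # (f v)))
handshake {zero}  f s i = 0 , refl
handshake {suc n} f s i with handshake (λ u v → f (suc u) (suc v)) (λ u v → s (suc u) (suc v)) (i ∘ suc)
... | h , e = # (f zero ∘ suc) + h , (begin
    b2n (f zero zero) + # (f zero ∘ suc) + sum (λ v → b2n (f (suc v) zero) + # (f (suc v) ∘ suc))
      ≡⟨ cong₂ (λ x y → b2n x + # (f zero ∘ suc) + y) (i zero) (∑-distrib-+ (λ v → b2n (f (suc v) zero)) (λ v → # (f (suc v) ∘ suc))) ⟩
    # (f zero ∘ suc) + (sum (λ v → b2n (f (suc v) zero)) + sum (λ v → # (f (suc v) ∘ suc)))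
      ≡⟨ cong₂ (λ x y → # (f zero ∘ suc) + (x + y)) (trans (sum-cong-≗ (λ v → cong b2n (s (suc v) zero))) (sym (#-sum (f zero ∘ suc)))) e ⟩
    # (f zero ∘ suc) + (# (f zero ∘ suc) + (h + h))
      ≡⟨ l (# (f zero ∘ suc)) h ⟩
    (# (f zero ∘ suc) + h) + (# (f zero ∘ suc) + h) ∎)
  where
  open ≡-Reasoning
  l : ∀ x h → x + (x + (h + h)) ≡ (x + h) + (x + h)
  l = solve-∀

Uniform : ∀ {n} → Graph n → (Fin n → Bool) → Bool → Set
Uniform G S κ = ∀ u v → S u ≡ true → S v ≡ true → u ≢ v → adj G u v ≡ κ

Uniform-co : ∀ {n} (G : Graph n) {S κ} → Uniform G S κ → Uniform (co G) S (not κ)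
Uniform-co G h u v Su Sv ne = trans (co-≢ G ne) (cong not (h u v Su Sv ne))

Uniform-# : ∀ {n} (G : Graph n) {S κ} → Uniform G S κ → ∀ {v} → S v ≡ true → # (S ∩ adj G v) ≡ b2n κ * pred (# S)
Uniform-# G {S} {κ} h {v} Sv = trans (lem κ h) (cong (λ z → b2n κ * pred z) (sym size))
  where
  size : # S ≡ suc (# (S ∖ v))
  size = trans (#-point S v) (cong (λ z → b2n z + # (S ∖ v)) Sv)
  lem : ∀ κ → Uniform G S κ → # (S ∩ adj G v) ≡ b2n κ * # (S ∖ v)
  lem false h = #-none λ u → not-true λ k → true≢false (∧-elimʳ {S u} k) (h v u Sv (∧-elimˡ k) (adj⇒≢ G (∧-elimʳ {S u} k)))
  lem true  h = trans (#-cong e) (sym (+-identityʳ _))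
    where
    e : ∀ u → S u ∧ adj G v u ≡ S u ∧ not (u == v)
    e u with u ≟ v
    ... | yes refl = cong (S u ∧_) (adj-irrefl G u)
    ... | no ne with bool-cases (S u)
    ... | inj₁ Su rewrite Su = h v u Sv Su (ne ∘ sym)
    ... | inj₂ Su rewrite Su = refl

expand-prof : ∀ {n} (G : Graph n) S T lab i d c → (∀ v → S v ≡ true → lab v ≡ i) → (∀ v → S v ≡ true → # (T ∩ adj G v) ≡ d) →
              (∀ v → S v ≡ true → # (T ∩ adj (co G) v) ≡ c) → items S (prof G T lab) ≡ replicate (# S) (i , d , c)
expand-prof G S T lab i d c hl hd hc = trans (items-cong S (λ v Sv → cong₂ _,_ (hl v Sv) (cong₂ _,_ (hd v Sv) (hc v Sv)))) (items-const S _)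

Good-uniform : ∀ {n} {G : Graph n} {S κ} i → Uniform G S κ → Good G S (λ _ → i)
Good-uniform {G = G} {S} {κ} i h = good (Con-resp (sym (trans
  (expand-prof G S S (λ _ → i) i _ _ (λ _ _ → refl) (λ v Sv → Uniform-# G h Sv) (λ v Sv → Uniform-# (co G) (Uniform-co G h) Sv))
  (sym (++-identityʳ _)))) (GCon.con (gren 3F i (uniform κ (# S)))))

-- For an empty set the value 0 is chosen, since the uses need a value within the trivial upper
-- bound.
common : ∀ {n} (S : Fin n → Bool) (w : Fin n → ℕ) → (∀ u v → S u ≡ true → S v ≡ true → w u ≡ w v) →
         ∃ λ d → (∀ v → S v ≡ true → w v ≡ d) × ((∃ λ v → S v ≡ true × w v ≡ d) ⊎ ((∀ v → S v ≡ false) × d ≡ 0))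
common S w h with find? S
... | inj₁ (v , Sv) = w v , (λ u Su → h u v Su Sv) , inj₁ (v , Sv , refl)
... | inj₂ e = 0 , (λ v Sv → ⊥-elim (true≢false Sv (e v))) , inj₂ (e , refl)

hubLab : ∀ {n} → Fin n → Fin n → Fin 5
hubLab x v = if v == x then 0F else 1F

-- The hypotheses of `hubCon` hold because the degrees come from an actual graph on `S`. Its inner
-- structure is forgotten and replaced by the constructed realisation.
Good-hub : ∀ {n} {G : Graph n} S x → S x ≡ true →
           (∀ u v → (S ∖ x) u ≡ true → (S ∖ x) v ≡ true → # (S ∩ adj G u) ≡ # (S ∩ adj G v)) →
           Good G S (hubLab x)
Good-hub {n} {G} S x Sx h with common (S ∖ x) (λ v → # (S ∩ adj G v)) h
... | d , hd , why = good (perm (↭-sym (↭-trans (items-split S ⟦ x ⟧ (prof G S (hubLab x))) (↭-reflexive (cong₂ _++_ one rest))))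
        (GCon.con (hubCon N d c s s′ dc ss z z′ even)))
  where
  N = # (S ∖ x)
  s = # (S ∩ adj G x)
  s′ = # (S ∩ adj (co G) x)
  #S : # S ≡ suc N
  #S = trans (#-point S x) (cong (λ b → b2n b + N) Sx)
  ss : s + s′ ≡ N
  ss = +-cancelʳ-≡ 1 _ _ (trans (cong (λ b → s + s′ + b2n b) (sym Sx)) (trans (co-split G S x) (trans #S (+-comm 1 N))))
  d≤N : d ≤ N
  d≤N = case why of λ where
    (inj₁ (v , Sv , refl)) → ≤-pred (≤-trans (≤-reflexive (+-comm 1 _)) (≤-trans (+-monoˡ-≤ 1 (m≤m+n _ (# (S ∩ adj (co G) v))))
      (≤-reflexive (trans (cong (λ b → # (S ∩ adj G v) + # (S ∩ adj (co G) v) + b2n b) (sym (∧-elimˡ Sv))) (trans (co-split G S v) #S)))))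
    (inj₂ (_ , refl)) → z≤n
  c = N ∸ d
  dc : d + c ≡ N
  dc = m+[n∸m]≡n d≤N
  hc : ∀ v → (S ∖ x) v ≡ true → # (S ∩ adj (co G) v) ≡ c
  hc v Sv = +-cancelˡ-≡ d _ _ (+-cancelʳ-≡ 1 _ _ (trans (cong₂ (λ y b → y + # (S ∩ adj (co G) v) + b2n b) (sym (hd v Sv)) (sym (∧-elimˡ Sv)))
              (trans (co-split G S v) (trans #S (trans (+-comm 1 N) (cong (_+ 1) (sym dc)))))))
  zero-hub : ∀ (H : Graph n) {d} → (∀ v → (S ∖ x) v ≡ true → # (S ∩ adj H v) ≡ d) → d ≡ 0 → # (S ∩ adj H x) ≡ 0
  zero-hub H hd refl = #-none λ v → not-true λ k → let e = ∧-elimʳ {S v} k in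
    true≢false (∧-intro Sx (adj-swap H e)) (#≡0 (hd v (∧-intro (∧-elimˡ k) (not-intro (==-≢ (adj⇒≢ H e ∘ sym))))) x)
  z : d ≡ 0 → s ≡ 0
  z = zero-hub G hd
  z′ : c ≡ 0 → s′ ≡ 0
  z′ = zero-hub (co G) hc
  even : Even (N * d + s)
  even = subst Even (trans (sum-cong-≗ row) (trans (wsum-point S _ x Sx)
           (trans (+-comm s _) (cong (_+ s) (wsum-const (S ∖ x) _ d hd)))))
         (handshake (λ v u → S v ∧ (S u ∧ adj G v u)) sym′ (λ v → trans (cong (λ b → S v ∧ (S v ∧ b)) (adj-irrefl G v)) (trans (cong (S v ∧_) (∧-zeroʳ _)) (∧-zeroʳ _))))
    where
    sym′ : ∀ u v → S u ∧ (S v ∧ adj G u v) ≡ S v ∧ (S u ∧ adj G v u)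
    sym′ u v rewrite adj-sym G u v with S u | S v
    ... | true  | true  = refl
    ... | true  | false = refl
    ... | false | true  = refl
    ... | false | false = refl
    row : ∀ v → # (λ u → S v ∧ (S u ∧ adj G v u)) ≡ b2n (S v) * # (S ∩ adj G v)
    row v with S v
    ... | true  = sym (+-identityʳ _)
    ... | false = #-none {n} (λ _ → refl)
  one : items (S ∩ ⟦ x ⟧) (prof G S (hubLab x)) ≡ (0F , s , s′) ∷ []
  one = trans (expand-prof G (S ∩ ⟦ x ⟧) S (hubLab x) 0F s s′
          (λ v k → cong (if_then 0F else 1F) (∧-elimʳ {S v} k))
          (λ v k → cong (λ y → # (S ∩ adj G y)) (==-true {x = v} (∧-elimʳ {S v} k)))
          (λ v k → cong (λ y → # (S ∩ adj (co G) y)) (==-true {x = v} (∧-elimʳ {S v} k))))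
          (rep′ refl refl (trans (#-⟦⟧ S x) (cong b2n Sx)))
  rest : items (S ∖ x) (prof G S (hubLab x)) ≡ replicate N (1F , d , c) ++ []
  rest = trans (expand-prof G (S ∖ x) S (hubLab x) 1F d c
          (λ v k → cong (if_then 0F else 1F) (not-elim (∧-elimʳ {S v} k))) hd hc) (sym (++-identityʳ _))

bipLab : ∀ {n} → Fin n → (Fin n → Bool) → Fin n → Fin 5
bipLab f A v = if v == f then 0F else if A v then 1F else 2F

-- As in `Good-hub`, only the degrees are kept; double counting of the edges between `A` and `B`
-- supplies the equation required by `bipCon`.
Good-bip : ∀ {n} {G : Graph n} A B f κ → Disjoint A B → A f ≡ true → Uniform G A κ → Uniform G B (not κ) →
           (∀ u v → (A ∖ f) u ≡ true → (A ∖ f) v ≡ true → # (B ∩ adj G u) ≡ # (B ∩ adj G v)) →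
           (∀ u v → B u ≡ true → B v ≡ true → # (A ∩ adj G u) ≡ # (A ∩ adj G v)) →
           Good G (A ∪ B) (bipLab f A)
Good-bip {n} {G} A B f κ dis Af uA uB hA hB with common (A ∖ f) (λ v → # (B ∩ adj G v)) hA | common B (λ v → # (A ∩ adj G v)) hB
... | α , rα , whyα | β , cβ , whyβ = good (perm (↭-sym (↭-trans (items-split (A ∪ B) A g)
        (↭-trans (++⁺ʳ _ (items-split ((A ∪ B) ∩ A) ⟦ f ⟧ g)) (↭-reflexive (trans (++-assoc (items _ g) (items _ g) (items _ g)) (cong₂ _++_ one (cong₂ _++_ rows cols)))))))
        (GCon.con (bipCon _ κ m N α α′ β β′ s s′ refl αα ββ ss count)))
  where
  g = prof G (A ∪ B) (bipLab f A)
  m = # (A ∖ f)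
  N = # B
  s = # (B ∩ adj G f)
  s′ = # (B ∩ adj (co G) f)
  #A : # A ≡ suc m
  #A = trans (#-point A f) (cong (λ b → b2n b + m) Af)
  co-A : ∀ {v} → A v ≡ true → # (B ∩ adj G v) + # (B ∩ adj (co G) v) ≡ N
  co-A {v} Av = trans (sym (+-identityʳ _)) (trans (cong (λ b → # (B ∩ adj G v) + # (B ∩ adj (co G) v) + b2n b) (sym (dis v Av))) (co-split G B v))
  co-B : ∀ {v} → B v ≡ true → # (A ∩ adj G v) + # (A ∩ adj (co G) v) ≡ suc m
  co-B {v} Bv = trans (sym (+-identityʳ _)) (trans (cong (λ b → # (A ∩ adj G v) + # (A ∩ adj (co G) v) + b2n b) (sym (Disjoint-sym dis v Bv))) (trans (co-split G A v) #A))
  ss : s + s′ ≡ N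
  ss = co-A Af
  α≤N : α ≤ N
  α≤N = case whyα of λ where
    (inj₁ (v , Av , refl)) → ≤-trans (m≤m+n _ _) (≤-reflexive (co-A (∧-elimˡ Av)))
    (inj₂ (_ , refl)) → z≤n
  β≤m : β ≤ suc m
  β≤m = case whyβ of λ where
    (inj₁ (v , Bv , refl)) → ≤-trans (m≤m+n _ _) (≤-reflexive (co-B Bv))
    (inj₂ (_ , refl)) → z≤n
  α′ = N ∸ α
  β′ = suc m ∸ β
  αα : α + α′ ≡ N
  αα = m+[n∸m]≡n α≤N
  ββ : β + β′ ≡ suc m
  ββ = m+[n∸m]≡n β≤m
  rα′ : ∀ v → (A ∖ f) v ≡ true → # (B ∩ adj (co G) v) ≡ α′
  rα′ v Av = +-cancelˡ-≡ α _ _ (trans (cong (_+ # (B ∩ adj (co G) v)) (sym (rα v Av))) (trans (co-A (∧-elimˡ Av)) (sym αα)))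
  cβ′ : ∀ v → B v ≡ true → # (A ∩ adj (co G) v) ≡ β′
  cβ′ v Bv = +-cancelˡ-≡ β _ _ (trans (cong (_+ # (A ∩ adj (co G) v)) (sym (cβ v Bv))) (trans (co-B Bv) (sym ββ)))
  count : m * α + s ≡ N * β
  count = trans (+-comm (m * α) s) (trans (cong (s +_) (sym (wsum-const (A ∖ f) _ α rα)))
    (trans (sym (wsum-point A _ f Af)) (trans (double-count G A B) (wsum-const B _ β cβ))))
  row-# : ∀ (H : Graph n) {κ} → Uniform H A κ → ∀ {v x} → A v ≡ true → # (B ∩ adj H v) ≡ x → # ((A ∪ B) ∩ adj H v) ≡ x + b2n κ * m
  row-# H {κ} u {v} Av e = trans (#-∪ (adj H v) dis) (trans (+-comm (# (A ∩ adj H v)) _) (cong₂ _+_ e (trans (Uniform-# H u Av) (cong (λ z → b2n κ * pred z) #A))))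
  col-# : ∀ (H : Graph n) {κ} → Uniform H B κ → ∀ {v x} → B v ≡ true → # (A ∩ adj H v) ≡ x → # ((A ∪ B) ∩ adj H v) ≡ x + b2n κ * pred N
  col-# H u {v} Bv e = trans (#-∪ (adj H v) dis) (cong₂ _+_ e (Uniform-# H u Bv))
  one : items (((A ∪ B) ∩ A) ∩ ⟦ f ⟧) g ≡ (0F , s + b2n κ * m , s′ + b2n (not κ) * m) ∷ []
  one = trans (expand-prof G (((A ∪ B) ∩ A) ∩ ⟦ f ⟧) (A ∪ B) (bipLab f A) 0F _ _
          (λ v k → cong (if_then 0F else if A v then 1F else 2F) (∧-elimʳ {((A ∪ B) ∩ A) v} k))
          (λ v k → trans (cong (λ y → # ((A ∪ B) ∩ adj G y)) (==-true {x = v} (∧-elimʳ {((A ∪ B) ∩ A) v} k))) (row-# G uA Af refl))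
          (λ v k → trans (cong (λ y → # ((A ∪ B) ∩ adj (co G) y)) (==-true {x = v} (∧-elimʳ {((A ∪ B) ∩ A) v} k))) (row-# (co G) (Uniform-co G uA) Af refl)))
          (rep′ refl refl (trans (#-⟦⟧ ((A ∪ B) ∩ A) f) (cong b2n (∧-intro {A f ∨ B f} (trans (cong (_∨ B f) Af) refl) Af))))
  inA : ∀ {v} → ((A ∪ B) ∩ A ∖ f) v ≡ true → (A ∖ f) v ≡ true
  inA {v} k = ∧-intro (∧-elimʳ {A v ∨ B v} (∧-elimˡ k)) (∧-elimʳ {((A ∪ B) ∩ A) v} k)
  rows : items ((A ∪ B) ∩ A ∖ f) g ≡ replicate m (1F , α + b2n κ * m , α′ + b2n (not κ) * m)
  rows = trans (expand-prof G ((A ∪ B) ∩ A ∖ f) (A ∪ B) (bipLab f A) 1F _ _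
          (λ v k → trans (cong (if_then 0F else if A v then 1F else 2F) (not-elim (∧-elimʳ {A v} (inA {v} k)))) (cong (if_then 1F else 2F) (∧-elimˡ (inA {v} k))))
          (λ v k → row-# G uA (∧-elimˡ (inA {v} k)) (rα v (inA {v} k)))
          (λ v k → row-# (co G) (Uniform-co G uA) (∧-elimˡ (inA {v} k)) (rα′ v (inA {v} k))))
          (rep′ refl refl (#-cong (λ v → cong (_∧ not (v == f)) (lem (A v) (B v)))))
    where
    lem : ∀ a b → (a ∨ b) ∧ a ≡ a
    lem true  _ = refl
    lem false _ = ∧-zeroʳ _
  inB : ∀ {v} → ((A ∪ B) ∩ ∁ A) v ≡ true → B v ≡ true
  inB {v} k with A v
  ... | false = trans (sym (∧-identityʳ (B v))) k
  inB {v} () | true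
  cols : items ((A ∪ B) ∩ ∁ A) g ≡ replicate N (2F , β + b2n (not κ) * pred N , β′ + b2n κ * pred N) ++ []
  cols = trans (expand-prof G ((A ∪ B) ∩ ∁ A) (A ∪ B) (bipLab f A) 2F _ _
          (λ v k → trans (cong (if_then 0F else if A v then 1F else 2F) (==-≢ {x = v} {f} λ { refl → true≢false Af (not-elim (∧-elimʳ {A v ∨ B v} k)) }))
                         (cong (if_then 1F else 2F) (not-elim (∧-elimʳ {A v ∨ B v} k))))
          (λ v k → col-# G uB (inB {v} k) (cβ v (inB {v} k)))
          (λ v k → trans (col-# (co G) (Uniform-co G uB) (inB {v} k) (cβ′ v (inB {v} k))) (cong (λ b → β′ + b2n b * pred N) (not-involutive κ))))
          (trans (rep′ refl refl (#-cong lem)) (sym (++-identityʳ _)))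
    where
    lem : ∀ v → (A v ∨ B v) ∧ not (A v) ≡ B v
    lem v with A v | dis v
    ... | true  | h = sym (h refl)
    ... | false | _ = ∧-identityʳ _

splitLab : ∀ {n} → (Fin n → Bool) → Fin n → Fin 5
splitLab A v = if A v then 1F else 2F

leaf-free : ∀ {n} {S f : Fin n → Bool} → # (S ∩ f) ≡ 1 → ∀ {p q} → S p ≡ true → f p ≡ true → S q ≡ true → q ≢ p → f q ≡ false
leaf-free {S = S} {f} e {p} {q} Sp fp Sq ne = not-true λ fq → true≢false
  (∧-intro (∧-intro Sq fq) (not-intro (==-≢ ne)))
  (#≡0 (+-cancelˡ-≡ 1 _ 0 (trans (cong (λ b → b2n b + # (S ∩ f ∖ p)) (sym (∧-intro Sp fp))) (trans (sym (#-point (S ∩ f) p)) e))) q)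

-- Here the structure of G is used directly: the vertices of `B` attached to one `a` form a star
-- with it, and the stars are added one by one. Between a new star and the rest only two vertices of
-- `A` or two of `B` can be adjacent, as prescribed by `κ`.
Good-stars : ∀ {n} {G : Graph n} k A B κ → # A ≡ k → Disjoint A B → Uniform G A κ → Uniform G B (not κ) →
             (∀ b → B b ≡ true → # (A ∩ adj G b) ≡ 1) → Good G (A ∪ B) (splitLab A)
Good-stars {G = G} zero A B κ e dis uA uB h = Good-empty λ v → cong₂ _∨_ (#≡0 {f = A} e v)
  (not-true λ Bv → case trans (sym (h v Bv)) (#-none {f = A ∩ adj G v} (λ u → cong (_∧ adj G v u) (#≡0 {f = A} e u))) of λ ())
Good-stars {n} {G} (suc k) A B κ e dis uA uB h with #-find A (≤-trans (s≤s z≤n) (≤-reflexive (sym e)))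
... | a , Aa = Good-lab final (Good-set set (Good-ren 4F 2F (Good-ren 3F 1F
      (Good-∪ right₃₄ M apart left right cross (Good-lab labL rest) (Good-lab labR star)))))
  where
  A′ = A ∖ a
  L  = B ∩ adj G a
  B′ = B ∩ ∁ (adj G a)
  T  = ⟦ a ⟧ ∪ L
  lab : Fin n → Fin 5
  lab v = if v == a then 3F else if A v then 1F else if adj G a v then 4F else 2F
  M : Fin 5 → Fin 5 → Bool
  M 1F 3F = κ
  M 2F 4F = not κ
  M _  _  = false
  Ba : ∀ {v} → B v ≡ true → v ≢ a
  Ba Bv refl = true≢false Bv (dis a Aa)
  #A′ : # A′ ≡ k
  #A′ = suc-injective (trans (cong (λ b → b2n b + # A′) (sym Aa)) (trans (sym (#-point A a)) e))
  one : ∀ b → B′ b ≡ true → # (A′ ∩ adj G b) ≡ 1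
  one b Bb = trans (#-cong lem) (h b (∧-elimˡ Bb))
    where
    lem : ∀ u → A′ u ∧ adj G b u ≡ A u ∧ adj G b u
    lem u with u ≟ a
    ... | yes refl rewrite adj-swap G (not-elim (∧-elimʳ {B b} Bb)) = trans (∧-zeroʳ _) (sym (∧-zeroʳ _))
    ... | no _ = cong (_∧ adj G b u) (∧-identityʳ _)
  rest : Good G (A′ ∪ B′) (splitLab A′)
  rest = Good-stars k A′ B′ κ #A′ (λ v k → trans (cong (_∧ _) (dis v (∧-elimˡ k))) refl)
           (λ u v p q → uA u v (∧-elimˡ p) (∧-elimˡ q)) (λ u v p q → uB u v (∧-elimˡ p) (∧-elimˡ q)) one
  star : Good G T (λ v → if v == a then 3F else 4F)
  star = Good-∪ right₄ (λ _ _ → true)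
      (λ v k → trans (cong (_∧ adj G a v) (not-true λ Bv → Ba Bv (==-true {x = v} k))) refl)
      (λ v k → cong (λ b → right₄ (if b then 3F else 4F)) k)
      (λ v k → cong (λ b → right₄ (if b then 3F else 4F)) (==-≢ (Ba (∧-elimˡ k))))
      (λ u v p q → trans (cong (λ z → adj G z v) (==-true {x = u} p)) (∧-elimʳ {B v} q))
      (Good-single a)
      (Good-lab (λ v k → sym (cong (if_then 3F else 4F) (==-≢ (Ba (∧-elimˡ k))))) (Good-uniform 4F (λ u v p q → uB u v (∧-elimˡ p) (∧-elimˡ q))))
  in-T : ∀ v → T v ≡ true → v ≡ a ⊎ L v ≡ true
  in-T v k with v ≟ a
  ... | yes p = inj₁ p
  ... | no _  = inj₂ k
  in-rest : ∀ v → (A′ ∪ B′) v ≡ true → A′ v ≡ true ⊎ B′ v ≡ true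
  in-rest v k with A′ v
  ... | true  = inj₁ refl
  ... | false = inj₂ k
  lab-a : lab a ≡ 3F
  lab-a rewrite ==-refl a = refl
  lab-L : ∀ v → L v ≡ true → lab v ≡ 4F
  lab-L v k rewrite ==-≢ (Ba (∧-elimˡ k)) | Disjoint-sym dis v (∧-elimˡ k) | ∧-elimʳ {B v} k = refl
  lab-A′ : ∀ v → A′ v ≡ true → lab v ≡ 1F
  lab-A′ v k rewrite not-elim (∧-elimʳ {A v} k) | ∧-elimˡ {A v} k = refl
  lab-B′ : ∀ v → B′ v ≡ true → lab v ≡ 2F
  lab-B′ v k rewrite ==-≢ (Ba (∧-elimˡ k)) | Disjoint-sym dis v (∧-elimˡ k) | not-elim (∧-elimʳ {B v} k) = refl
  labL : ∀ v → (A′ ∪ B′) v ≡ true → splitLab A′ v ≡ lab v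
  labL v k with in-rest v k
  ... | inj₁ p = trans (cong (if_then 1F else 2F) p) (sym (lab-A′ v p))
  ... | inj₂ p = trans (cong (if_then 1F else 2F) (cong (_∧ not (v == a)) (Disjoint-sym dis v (∧-elimˡ p)))) (sym (lab-B′ v p))
  labR : ∀ v → T v ≡ true → (if v == a then 3F else 4F) ≡ lab v
  labR v k with in-T v k
  ... | inj₁ refl = trans (cong (if_then 3F else 4F) (==-refl a)) (sym lab-a)
  ... | inj₂ p = trans (cong (if_then 3F else 4F) (==-≢ (Ba (∧-elimˡ p)))) (sym (lab-L v p))
  apart : Disjoint (A′ ∪ B′) T
  apart v k = not-true λ Tv → lem (in-rest v k) (in-T v Tv)
    where
    lem : A′ v ≡ true ⊎ B′ v ≡ true → v ≡ a ⊎ L v ≡ true → ⊥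
    lem (inj₁ p) (inj₁ refl) = true≢false (==-refl a) (not-elim (∧-elimʳ {A v} p))
    lem (inj₁ p) (inj₂ q) = true≢false (∧-elimˡ q) (dis v (∧-elimˡ p))
    lem (inj₂ p) (inj₁ q) = Ba (∧-elimˡ p) q
    lem (inj₂ p) (inj₂ q) = true≢false (∧-elimʳ {B v} q) (not-elim (∧-elimʳ {B v} p))
  left : ∀ v → (A′ ∪ B′) v ≡ true → right₃₄ (lab v) ≡ true
  left v k with in-rest v k
  ... | inj₁ p = cong right₃₄ (lab-A′ v p)
  ... | inj₂ p = cong right₃₄ (lab-B′ v p)
  right : ∀ v → T v ≡ true → right₃₄ (lab v) ≡ false
  right v k with in-T v k
  ... | inj₁ refl = cong right₃₄ lab-a
  ... | inj₂ p = cong right₃₄ (lab-L v p)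
  cross : ∀ u v → (A′ ∪ B′) u ≡ true → T v ≡ true → adj G u v ≡ M (lab u) (lab v)
  cross u v p q with in-rest u p | in-T v q
  ... | inj₁ p | inj₁ refl = trans (uA u v (∧-elimˡ p) Aa (==-false (not-elim (∧-elimʳ {A u} p)))) (sym (cong₂ M (lab-A′ u p) lab-a))
  ... | inj₁ p | inj₂ q = trans (adj-swap G (leaf-free {S = A} (h v (∧-elimˡ q)) Aa (adj-swap G (∧-elimʳ {B v} q)) (∧-elimˡ p) (==-false (not-elim (∧-elimʳ {A u} p)))))
                            (sym (cong₂ M (lab-A′ u p) (lab-L v q)))
  ... | inj₂ p | inj₁ refl = trans (adj-swap G (not-elim (∧-elimʳ {B u} p))) (sym (cong₂ M (lab-B′ u p) lab-a))
  ... | inj₂ p | inj₂ q = trans (uB u v (∧-elimˡ p) (∧-elimˡ q) (λ { refl → true≢false (∧-elimʳ {B u} q) (not-elim (∧-elimʳ {B u} p)) })) (sym (cong₂ M (lab-B′ u p) (lab-L v q)))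
  set : (A′ ∪ B′) ∪ T ≗ A ∪ B
  set v with v ≟ a
  ... | yes refl rewrite Aa = lem (B v) (adj G v v)
    where
    lem : ∀ b x → (false ∨ b ∧ not x) ∨ true ≡ true
    lem true  true  = refl
    lem true  false = refl
    lem false _     = refl
  ... | no _ = lem (A v) (B v) (adj G a v)
    where
    lem : ∀ a b x → (a ∧ true ∨ b ∧ not x) ∨ b ∧ x ≡ a ∨ b
    lem true  _     _     = refl
    lem false true  true  = refl
    lem false true  false = refl
    lem false false _     = refl
  final : ∀ v → (A ∪ B) v ≡ true → relabel 4F 2F (relabel 3F 1F (lab v)) ≡ splitLab A v
  final v k with v ≟ a
  ... | yes refl rewrite Aa = refl
  ... | no _ with A v
  ... | true = refl
  ... | false with adj G a v
  ... | true  = refl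
  ... | false = refl

-- Degree classes that are neither cliques nor independent sets

record Mixed {n} (G : Graph n) : Set where
  field
    {p q r s} : Fin n
    pq  : adj G p q ≡ true
    rs  : adj G r s ≡ false
    r≢s : r ≢ s
    p≈q : dg G p ≡ dg G q
    q≈r : dg G q ≡ dg G r
    r≈s : dg G r ≡ dg G s

mixed? : ∀ {n} (G : Graph n) → Dec (Mixed G)
mixed? G with any? (λ p → any? λ q → any? λ r → any? λ s →
    (adj G p q ≟ᵇ true) ×-dec (adj G r s ≟ᵇ false) ×-dec ¬? (r ≟ s) ×-dec
    (dg G p ≟ⁿ dg G q) ×-dec (dg G q ≟ⁿ dg G r) ×-dec (dg G r ≟ⁿ dg G s))
... | yes (p , q , r , s , a , b , c , d , e , f) =
  yes (record { pq = a ; rs = b ; r≢s = c ; p≈q = d ; q≈r = e ; r≈s = f })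
... | no h = no λ m → let open Mixed m in h (p , q , r , s , pq , rs , r≢s , p≈q , q≈r , r≈s)

module NotMixed {n} {G : Graph n} (R : Rigid G) (nm : ¬ Mixed G) where

  no-mixed : ∀ {p q r s} → adj G p q ≡ true → adj G r s ≡ false → r ≢ s →
             dg G p ≡ dg G q → dg G q ≡ dg G r → dg G r ≡ dg G s → ⊥
  no-mixed a b c d e f = nm (record { pq = a ; rs = b ; r≢s = c ; p≈q = d ; q≈r = e ; r≈s = f })

  separated : ∀ {a b c} → adj G a b ≡ true → adj G c b ≡ false → a ≢ c
  separated h k refl = true≢false h k

  -- The two ways of matching up the edges each force an equality of degrees. In every combination
  -- three of the four vertices have equal degree, and both an edge and a non-edge occur among them.
  no-2K₂ : ∀ {a b c d} → adj G a b ≡ true → adj G c d ≡ true →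
           adj G c a ≡ false → adj G d a ≡ false → adj G c b ≡ false → adj G d b ≡ false → ⊥
  no-2K₂ {a} {b} {c} {d} ab cd ca da cb db
    with Alt⇒deg R {a} {b} {c} {d} (record { ab = ab ; cd = cd ; cb = cb ; ad = adj-swap G da ; b≢c = b≢c ; a≢d = a≢d })
       | Alt⇒deg R {a} {b} {d} {c} (record { ab = ab ; cd = adj-swap G cd ; cb = db ; ad = adj-swap G ca ; b≢c = b≢d ; a≢d = a≢c })
    where
    b≢c : b ≢ c
    b≢c = separated (adj-swap G ab) ca
    a≢d : a ≢ d
    a≢d = separated ab db
    b≢d : b ≢ d
    b≢d = separated (adj-swap G ab) da
    a≢c : a ≢ c
    a≢c = separated ab cb
  ... | inj₁ a≈c | inj₁ a≈d = no-mixed cd (adj-swap G da) (separated ab db) (trans (sym a≈c) a≈d) (sym a≈d) a≈d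
  ... | inj₁ a≈c | inj₂ b≈c = no-mixed ab (adj-swap G ca) (separated ab cb) (trans a≈c (sym b≈c)) (trans b≈c (sym a≈c)) a≈c
  ... | inj₂ b≈d | inj₁ a≈d = no-mixed ab (adj-swap G db) (separated (adj-swap G ab) da) (trans a≈d (sym b≈d)) refl b≈d
  ... | inj₂ b≈d | inj₂ b≈c = no-mixed cd (adj-swap G db) (separated (adj-swap G ab) da) (trans (sym b≈c) b≈d) (sym b≈d) b≈d

  no-C₄ : ∀ {a b c d} → adj G a b ≡ true → adj G b c ≡ true → adj G c d ≡ true → adj G d a ≡ true →
          adj G a c ≡ false → adj G b d ≡ false → a ≢ c → b ≢ d → ⊥
  no-C₄ {a} {b} {c} {d} ab bc cd da ac bd a≢c b≢d
    with Alt⇒deg R {a} {b} {d} {c} (record { ab = ab ; cd = adj-swap G cd ; cb = adj-swap G bd ; ad = ac ; b≢c = b≢d ; a≢d = a≢c })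
       | Alt⇒deg R {b} {c} {a} {d} (record { ab = bc ; cd = adj-swap G da ; cb = ac ; ad = bd ; b≢c = a≢c ∘ sym ; a≢d = b≢d })
  ... | inj₁ a≈d | inj₁ b≈a = no-mixed da bd b≢d (sym a≈d) (sym b≈a) (trans b≈a a≈d)
  ... | inj₁ a≈d | inj₂ c≈d = no-mixed da ac a≢c (sym a≈d) refl (trans a≈d (sym c≈d))
  ... | inj₂ b≈c | inj₁ b≈a = no-mixed bc ac a≢c b≈c (trans (sym b≈c) b≈a) (trans (sym b≈a) b≈c)
  ... | inj₂ b≈c | inj₂ c≈d = no-mixed bc bd b≢d b≈c (sym b≈c) (trans b≈c c≈d)

  -- Three of the induced paths on four vertices already produce three vertices of equal degree that
  -- span an edge and a non-edge.
  no-C₅ : ∀ {a b c d e} → adj G a b ≡ true → adj G b c ≡ true → adj G c d ≡ true → adj G d e ≡ true → adj G e a ≡ true →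
          adj G a c ≡ false → adj G b d ≡ false → adj G c e ≡ false → adj G d a ≡ false → adj G e b ≡ false → ⊥
  no-C₅ {a} {b} {c} {d} {e} ab bc cd de ea ac bd ce da eb = cases (P₄ ab cd ac bd a≢c b≢d) (P₄ bc de bd ce b≢d c≢e) (P₄ cd ea ce da c≢e d≢a)
    where
    P₄ : ∀ {x y z w} → adj G x y ≡ true → adj G z w ≡ true → adj G x z ≡ false → adj G y w ≡ false → x ≢ z → y ≢ w →
         dg G x ≡ dg G w ⊎ dg G y ≡ dg G z
    P₄ xy zw xz yw x≢z y≢w = Alt⇒deg R (record { ab = xy ; cd = adj-swap G zw ; cb = adj-swap G yw ; ad = xz ; b≢c = y≢w ; a≢d = x≢z })
    a≢c = separated (adj-swap G ea) ce
    b≢d = separated (adj-swap G ab) da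
    c≢e = separated (adj-swap G bc) eb
    d≢a = separated (adj-swap G cd) ac
    e≢b = separated (adj-swap G de) bd
    cases : dg G a ≡ dg G d ⊎ dg G b ≡ dg G c → dg G b ≡ dg G e ⊎ dg G c ≡ dg G d → dg G c ≡ dg G a ⊎ dg G d ≡ dg G e → ⊥
    cases (inj₂ b≈c) (inj₂ c≈d) _ = no-mixed bc bd b≢d b≈c (sym b≈c) (trans b≈c c≈d)
    cases (inj₂ b≈c) (inj₁ b≈e) _ = no-mixed bc eb e≢b b≈c (trans (sym b≈c) b≈e) (sym b≈e)
    cases (inj₁ a≈d) _ (inj₂ d≈e) = no-mixed de da d≢a d≈e (sym d≈e) (sym a≈d)
    cases (inj₁ a≈d) _ (inj₁ c≈a) = no-mixed cd da d≢a (trans c≈a a≈d) refl (sym a≈d)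

  NonSimplicial NonCosimplicial : Fin n → Set
  NonSimplicial v = ∃ λ p → ∃ λ q → adj G v p ≡ true × adj G v q ≡ true × p ≢ q × adj G p q ≡ false
  NonCosimplicial v = ∃ λ r → ∃ λ s → adj G v r ≡ false × adj G v s ≡ false × r ≢ v × s ≢ v × adj G r s ≡ true

  nonSimplicial? : ∀ v → Dec (NonSimplicial v)
  nonSimplicial? v = any? λ p → any? λ q → (adj G v p ≟ᵇ true) ×-dec (adj G v q ≟ᵇ true) ×-dec ¬? (p ≟ q) ×-dec (adj G p q ≟ᵇ false)

  nonCosimplicial? : ∀ v → Dec (NonCosimplicial v)
  nonCosimplicial? v = any? λ r → any? λ s →
    (adj G v r ≟ᵇ false) ×-dec (adj G v s ≟ᵇ false) ×-dec ¬? (r ≟ v) ×-dec ¬? (s ≟ v) ×-dec (adj G r s ≟ᵇ true)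

  -- According to how `r` and `s` attach to `p` and `q`, the five vertices contain an induced `C₄`
  -- or `2K₂`, or form a `C₅`.
  not-both : ∀ v → NonSimplicial v → NonCosimplicial v → ⊥
  not-both v (p , q , vp , vq , p≢q , pq) (r , s , vr , vs , r≢v , s≢v , rs)
    with bool-cases (adj G r p) | bool-cases (adj G s p) | bool-cases (adj G r q) | bool-cases (adj G s q)
  ... | inj₁ rp | _       | inj₁ rq | _       = no-C₄ vp (adj-swap G rp) rq (adj-swap G vq) vr pq (r≢v ∘ sym) p≢q
  ... | _       | inj₁ sp | _       | inj₁ sq = no-C₄ vp (adj-swap G sp) sq (adj-swap G vq) vs pq (s≢v ∘ sym) p≢q
  ... | inj₂ rp | inj₂ sp | _       | _       = no-2K₂ vp rs (adj-swap G vr) (adj-swap G vs) rp sp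
  ... | _       | _       | inj₂ rq | inj₂ sq = no-2K₂ vq rs (adj-swap G vr) (adj-swap G vs) rq sq
  ... | inj₁ rp | inj₂ sp | inj₂ rq | inj₁ sq = no-C₅ vp (adj-swap G rp) rs sq (adj-swap G vq) vr (adj-swap G sp) rq (adj-swap G vs) (adj-swap G pq)
  ... | inj₂ rp | inj₁ sp | inj₁ rq | inj₂ sq = no-C₅ vp (adj-swap G sp) (adj-swap G rs) rq (adj-swap G vq) vs (adj-swap G rp) sq (adj-swap G vr) (adj-swap G pq)

  -- This is the characterisation of split graphs by forbidden `2K₂`, `C₄` and `C₅`. If some vertex
  -- is both simplicial and cosimplicial, its neighbourhood is the clique; otherwise each vertex is
  -- exactly one of the two, and the non-simplicial ones form the clique.
  split : ∃ λ A → Uniform G A true × Uniform G (∁ A) false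
  split with any? (λ v → ¬? (nonSimplicial? v) ×-dec ¬? (nonCosimplicial? v))
  ... | yes (v , ns , nc) = adj G v ,
        (λ p q vp vq p≢q → not-false λ pq → ns (p , q , vp , vq , p≢q , pq)) ,
        (λ r s vr vs r≢s → not-true λ rs → nc (r , s , not-elim vr , not-elim vs ,
           (λ { refl → true≢false rs (not-elim vs) }) , (λ { refl → true≢false (adj-swap G rs) (not-elim vr) }) , rs))
  ... | no h = A , clique , independent
    where
    A : Fin n → Bool
    A v = ⌊ nonSimplicial? v ⌋
    A-true : ∀ {v} → A v ≡ true → NonSimplicial v
    A-true {v} e with nonSimplicial? v
    ... | yes p = p
    A-false : ∀ {v} → A v ≡ false → NonCosimplicial v
    A-false {v} e with nonSimplicial? v | nonCosimplicial? v
    ... | no _  | yes p = p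
    ... | no p  | no q  = ⊥-elim (h (v , p , q))
    A-simplicial : ∀ {v} → A v ≡ false → ¬ NonSimplicial v
    A-simplicial {v} e with nonSimplicial? v
    ... | no p = p
    clique : Uniform G A true
    clique u v Au Av u≢v = not-false λ uv → let r , s , vr , vs , r≢s , rs = A-true Av in
      no-C₄ (nbr uv r vr) (adj-swap G vr) vs (adj-swap G (nbr uv s vs)) uv rs u≢v r≢s
      where
      -- If `u r` were missing, the edge `r v` would make `u` non-cosimplicial as well.
      nbr : adj G u v ≡ false → ∀ r → adj G v r ≡ true → adj G u r ≡ true
      nbr uv r vr = not-false λ ur → not-both u (A-true Au)
        (r , v , ur , uv , (λ { refl → true≢false (adj-swap G vr) uv }) , (u≢v ∘ sym) , adj-swap G vr)
    independent : Uniform G (∁ A) false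
    independent u v Au Av u≢v = not-true λ uv → let r , s , vr , vs , r≢v , s≢v , rs = A-false (not-elim Av) in
      no-2K₂ {u} {v} {r} {s} uv rs (adj-swap G (non uv r vr r≢v)) (adj-swap G (non uv s vs s≢v)) (adj-swap G vr) (adj-swap G vs)
      where
      non : adj G u v ≡ true → ∀ r → adj G v r ≡ false → r ≢ v → adj G u r ≡ false
      non uv r vr r≢v = not-true λ ur → A-simplicial (not-elim Au) (v , r , uv , ur , r≢v ∘ sym , vr)

module _ {n} {G : Graph n} (R : Rigid G) {δ} {x z : Fin n} (x≢z : x ≢ z) (dx : dg G x ≢ δ) (dz : dg G z ≢ δ) (xz : adj G x z ≡ false) where

  -- The non-edge `r s` of the class plays the part of `t w` in `crossing`. It is reversed when
  -- `r = v` or `s = u`, which `crossing` excludes.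
  outside-crossing : ∀ {v u r s} → dg G v ≡ δ → dg G u ≡ δ → dg G r ≡ δ → dg G s ≡ δ → adj G r s ≡ false → r ≢ s →
                     u ≢ v → adj G x v ≡ true → adj G z u ≡ true → ⊥
  outside-crossing {v} {u} {r} {s} dv du dr ds rs r≢s u≢v xv zu with r ≟ v | s ≟ u
  ... | no r≢v | no s≢u = crossing R xv (adj-swap G zu) xz x≢z u≢v (dx ∘ λ e → trans e du) (λ e → dz (trans (sym e) dv)) rs r≢s
        (trans dr (sym du)) (trans ds (sym dv)) (λ { refl → dx ds }) s≢u r≢v (λ { refl → dz dr })
  ... | yes refl | _ = crossing R xv (adj-swap G zu) xz x≢z u≢v (dx ∘ λ e → trans e du) (λ e → dz (trans (sym e) dv)) (adj-swap G rs) (r≢s ∘ sym)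
        (trans ds (sym du)) refl (λ { refl → dx dr }) (u≢v ∘ sym) (r≢s ∘ sym) (λ { refl → dz ds })
  ... | no _ | yes refl = crossing R xv (adj-swap G zu) xz x≢z u≢v (dx ∘ λ e → trans e du) (λ e → dz (trans (sym e) dv)) (adj-swap G rs) (r≢s ∘ sym)
        refl (trans dr (sym dv)) (λ { refl → dx dr }) r≢s u≢v (λ { refl → dz du })

-- If the two given neighbours coincide in `v`, another vertex `w′` of the class serves as neighbour
-- of `x`, after a switch if necessary; then `outside-crossing` applies.
outside-adjacent : ∀ {n} {G : Graph n} → Rigid G → (m : Mixed G) → let δ = dg G (Mixed.r m) in ∀ {x z v u} → x ≢ z → dg G x ≢ δ → dg G z ≢ δ →
                   dg G v ≡ δ → dg G u ≡ δ → adj G x v ≡ true → adj G z u ≡ true → adj G x z ≡ true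
outside-adjacent {n} {G} R m {x} {z} {v} {u} x≢z dx dz dv du xv zu = not-false λ xz → go xz (u ≟ v)
  where
  open Mixed m
  δ = dg G r
  module _ (xz : adj G x z ≡ false) where
    move : ∀ w′ → dg G w′ ≡ δ → w′ ≢ v → adj G z v ≡ true → adj G x w′ ≡ false → ⊥
    move w′ dw′ w′≢v zv xw′ with deg-exchange G {v} {w′} {x} (≤-reflexive (trans dv (sym dw′))) (adj-swap G xv) (adj-swap G xw′) (λ { refl → dx dw′ })
    ... | q , w′q , vq , q≢v = nonedge (dg G q ≟ⁿ δ)
      where
      x≢w′ : x ≢ w′
      x≢w′ refl = dx dw′
      alt : Alt G v x w′ q
      alt = record { ab = adj-swap G xv ; cd = w′q ; cb = adj-swap G xw′ ; ad = vq ; b≢c = x≢w′ ; a≢d = q≢v ∘ sym }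
      open Switch G alt
      out : ∀ {y} → dg G y ≢ δ → dg switch y ≢ δ
      out {y} h e = h (trans (sym (same-deg y)) e)
      inn : ∀ {y} → dg G y ≡ δ → dg switch y ≡ δ
      inn {y} e = trans (same-deg y) e
      x≢v : x ≢ v
      x≢v = adj⇒≢ G xv
      z≢v : z ≢ v
      z≢v = adj⇒≢ G zv
      z≢w′ : z ≢ w′
      z≢w′ refl = dz dw′
      z≢q : z ≢ q
      z≢q refl = true≢false (adj-swap G zv) vq
      finish : ∀ {r s} → dg G r ≡ δ → dg G s ≡ δ → adj switch r s ≡ false → r ≢ s → ⊥
      finish {r} {s} dr ds rs r≢s = outside-crossing (switch-rigid R) x≢z (out dx) (out dz) (trans (switch-α x≢v x≢w′ z≢v z≢w′) xz)
        (inn dw′) (inn dv) (inn dr) (inn ds) rs r≢s (w′≢v ∘ sym) (adj-swap switch switch-cb)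
        (trans (switch-β (x≢z ∘ sym) z≢q (x≢v ∘ sym) (q≢v ∘ sym)) zv)
      -- The switched graph must have a non-edge within the class: the switch has just created
      -- `w′ q` if `q` lies in the class, and otherwise it left the class untouched.
      nonedge : Dec (dg G q ≡ δ) → ⊥
      nonedge (yes dq) = finish dw′ dq switch-cd (adj⇒≢ G w′q)
      nonedge (no dq)  = finish {r} {s} refl (sym r≈s) (trans (switch-β (λ { refl → dx refl }) (λ { refl → dq refl })
                           (λ { refl → dx (sym r≈s) }) (λ { refl → dq (sym r≈s) })) rs) r≢s
    other : ∀ w′ → dg G w′ ≡ δ → w′ ≢ v → adj G z v ≡ true → ⊥
    other w′ dw′ w′≢v zv with bool-cases (adj G x w′)
    ... | inj₁ xw′ = outside-crossing R x≢z dx dz xz dw′ dv refl (sym r≈s) rs r≢s (w′≢v ∘ sym) xw′ zv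
    ... | inj₂ xw′ = move w′ dw′ w′≢v zv xw′
    go : Dec (u ≡ v) → ⊥
    go (no u≢v) = outside-crossing R x≢z dx dz xz dv du refl (sym r≈s) rs r≢s u≢v xv zu
    go (yes refl) with r ≟ v
    ... | yes refl = other s (sym r≈s) (r≢s ∘ sym) zu
    ... | no r≢v   = other r refl r≢v zu

-- Split graphs with one side of constant degree

-- By `twins`, the columns `B` can differ only in their neighbours among the rows `A`. The form is
-- neutral between cliques and independent sets, so it serves both sides of a split graph and its
-- complement. `D` is a set of degrees that marks some of the rows.
record Columns {n} (G : Graph n) (A B : Fin n → Bool) (D : ℕ → Bool) : Set where
  field
    isRigid  : Rigid G
    disjoint : Disjoint A B
    twins    : ∀ {b b′ v} → B b ≡ true → B b′ ≡ true → A v ≡ false → v ≢ b → v ≢ b′ → adj G b v ≡ adj G b′ v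
    same-dg  : ∀ {b b′} → B b ≡ true → B b′ ≡ true → dg G b ≡ dg G b′

Partial : ∀ {n} → Graph n → (A B : Fin n → Bool) → Set
Partial G A B = ∀ a → A a ≡ true → (∃ λ b → B b ≡ true × adj G a b ≡ true) × (∃ λ b → B b ≡ true × adj G a b ≡ false)

module Col {n} {G : Graph n} {A B : Fin n → Bool} {D : ℕ → Bool} (C : Columns G A B D) where
  open Columns C

  AD AE : Fin n → Bool
  AD = A ∩ ofDeg G D
  AE = A ∩ ∁ (ofDeg G D)

  X Y : Fin n → Fin n → Bool
  X b = AD ∩ adj G b
  Y b = AE ∩ adj G b

  X-false : ∀ {b a} → AD a ≡ true → X b a ≡ false → adj G b a ≡ false
  X-false Da h = not-true λ k → true≢false (∧-intro Da k) h
  Y-false : ∀ {b a} → AE a ≡ true → Y b a ≡ false → adj G b a ≡ false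
  Y-false Ea h = not-true λ k → true≢false (∧-intro Ea k) h

  B⇒¬A : ∀ {b} → B b ≡ true → A b ≡ false
  B⇒¬A = Disjoint-sym disjoint _

  -- The columns `b` and `b′` themselves are compared crosswise: each sees the other, or neither
  -- does.
  outside-# : ∀ (f : Fin n → Bool) {b b′} → B b ≡ true → B b′ ≡ true → f b ≡ f b′ →
              # (∁ A ∩ (adj G b ∩ f)) ≡ # (∁ A ∩ (adj G b′ ∩ f))
  outside-# f {b} {b′} Bb Bb′ e = trans (#-point (∁ A ∩ (adj G b ∩ f)) b′) (trans (cong₂ _+_ (cong b2n here′) (#-cong rest)) (sym (#-point (∁ A ∩ (adj G b′ ∩ f)) b)))
    where
    here′ : not (A b′) ∧ (adj G b b′ ∧ f b′) ≡ not (A b) ∧ (adj G b′ b ∧ f b)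
    here′ rewrite B⇒¬A Bb | B⇒¬A Bb′ | adj-sym G b b′ | e = refl
    rest : ∀ v → (∁ A ∩ (adj G b ∩ f) ∖ b′) v ≡ (∁ A ∩ (adj G b′ ∩ f) ∖ b) v
    rest v with v ≟ b | v ≟ b′
    ... | yes refl | yes refl = refl
    ... | yes refl | no _ rewrite adj-irrefl G v = trans (∧-identityʳ _) (trans (∧-zeroʳ _) (sym (∧-zeroʳ _)))
    ... | no _ | yes refl rewrite adj-irrefl G v = trans (∧-zeroʳ _) (sym (trans (∧-identityʳ _) (∧-zeroʳ _)))
    ... | no vb | no vb′ with bool-cases (A v)
    ... | inj₁ Av rewrite Av = refl
    ... | inj₂ Av rewrite twins Bb Bb′ Av vb vb′ = refl

  split-# : ∀ (f : Fin n → Bool) b → # (adj G b ∩ f) ≡ # (A ∩ f ∩ adj G b) + # (∁ A ∩ (adj G b ∩ f))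
  split-# f b = trans (#-split (adj G b ∩ f) A) (cong₂ _+_ (#-cong (λ v → lem (adj G b v) (f v) (A v))) (#-cong (λ v → ∧-comm (adj G b v ∧ f v) _)))
    where
    lem : ∀ x y z → (x ∧ y) ∧ z ≡ (z ∧ y) ∧ x
    lem true  true  z = sym (trans (∧-identityʳ _) (∧-identityʳ z))
    lem true  false z = sym (trans (∧-identityʳ _) (∧-zeroʳ z))
    lem false _     z = sym (∧-zeroʳ _)

  degree-D : ∀ {b b′} → B b ≡ true → B b′ ≡ true → nD G D b ≡ suc (nD G D b′) → # (X b) ≡ suc (# (X b′))
  degree-D {b} {b′} Bb Bb′ e = +-cancelʳ-≡ _ _ _ (trans (sym (split-# (ofDeg G D) b)) (trans e (trans (cong suc (split-# (ofDeg G D) b′))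
    (cong (λ z → suc (# (X b′)) + z) (outside-# (ofDeg G D) Bb′ Bb (cong D (same-dg Bb′ Bb)))))))

  nbrs-# : ∀ b → # (A ∩ adj G b) ≡ # (X b) + # (Y b)
  nbrs-# b = trans (#-split (A ∩ adj G b) (ofDeg G D)) (cong₂ _+_ (#-cong (λ v → lem (A v) _ _)) (#-cong (λ v → lem (A v) _ _)))
    where
    lem : ∀ x y z → (x ∧ y) ∧ z ≡ (x ∧ z) ∧ y
    lem true  y z = ∧-comm y z
    lem false _ _ = refl

  total : ∀ {b b′} → B b ≡ true → B b′ ≡ true → # (X b) + # (Y b) ≡ # (X b′) + # (Y b′)
  total {b} {b′} Bb Bb′ = trans (sym (nbrs-# b)) (trans (+-cancelʳ-≡ (# (∁ A ∩ (adj G b ∩ full))) _ _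
      (trans (sym (whole b)) (trans (same-dg Bb Bb′) (trans (whole b′) (cong (# (A ∩ adj G b′) +_) (outside-# full Bb′ Bb refl)))))) (nbrs-# b′))
    where
    whole : ∀ b → dg G b ≡ # (A ∩ adj G b) + # (∁ A ∩ (adj G b ∩ full))
    whole b = trans (#-split (adj G b) A) (cong₂ _+_ (#-cong (λ v → ∧-comm (adj G b v) (A v)))
                (#-cong (λ v → trans (∧-comm (adj G b v) _) (cong (not (A v) ∧_) (sym (∧-identityʳ _))))))

  -- The two rows close an alternating cycle with the two columns, so `private-nbrs` applies; the
  -- neighbours outside `A` cancel.
  one-up : ∀ {b b′ a a′} → B b ≡ true → B b′ ≡ true → X b a ≡ true → X b′ a ≡ false → Y b′ a′ ≡ true → Y b a′ ≡ false →
           # (X b) ≡ suc (# (X b′))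
  one-up {b} {b′} {a} {a′} Bb Bb′ Xba Xb′a Yb′a′ Yba′ = degree-D Bb Bb′ (private-nbrs isRigid D
    (record { ab = ∧-elimʳ {AD a} Xba ; cd = ∧-elimʳ {AE a′} Yb′a′ ; cb = X-false (∧-elimˡ Xba) Xb′a ; ad = Y-false (∧-elimˡ Yb′a′) Yba′
            ; b≢c = λ { refl → true≢false (∧-elimˡ (∧-elimˡ Xba)) (B⇒¬A Bb′) }
            ; a≢d = λ { refl → true≢false (∧-elimˡ (∧-elimˡ Yb′a′)) (B⇒¬A Bb) } })
    (same-dg Bb Bb′) (∧-elimʳ {A a} (∧-elimˡ Xba)) (not-elim (∧-elimʳ {A a′} (∧-elimˡ Yb′a′))))

  -- If both sets differed, equality of sizes would provide the two rows needed by `one-up`, whose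
  -- conclusion contradicts that equality.
  same-level : ∀ {b b′} → B b ≡ true → B b′ ≡ true → # (X b) ≡ # (X b′) → X b ≗ X b′ ⊎ Y b ≗ Y b′
  same-level {b} {b′} Bb Bb′ e with ∩-find? (X b) (X b′)
  ... | inj₂ s = inj₁ λ a → bool-ext (s a) (⊆-antisym-# s (≤-reflexive (sym e)) a)
  ... | inj₁ (a , p , q) with ∩-find? (Y b′) (Y b)
  ... | inj₁ (a′ , p′ , q′) = ⊥-elim (1+n≢n (trans (sym (one-up Bb Bb′ p q p′ q′)) e))
  ... | inj₂ s = inj₂ λ a → sym (bool-ext (s a) (⊆-antisym-# s (≤-reflexive e′) a))
    where
    e′ : # (Y b) ≡ # (Y b′)
    e′ = +-cancelˡ-≡ (# (X b)) _ _ (trans (total Bb Bb′) (cong (_+ # (Y b′)) (sym e)))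

  Level : ℕ → Fin n → Set
  Level t b = B b ≡ true × # (X b) ≡ t

  ConstX ConstY : ℕ → Set
  ConstX t = ∀ {b b′} → Level t b → Level t b′ → X b ≗ X b′
  ConstY t = ∀ {b b′} → Level t b → Level t b′ → Y b ≗ Y b′

  -- Every column of the level agrees with `b`, and with `b′`, in its X-set or in its Y-set. As the
  -- X-sets of these two differ, they share their Y-set, and so does every other column.
  vary⇒ConstY : ∀ {t b b′ a} → Level t b → Level t b′ → X b a ≡ true → X b′ a ≡ false → ConstY t
  vary⇒ConstY {t} {b} {b′} {a} (Bb , e) (Bb′ , e′) p q {c} {c′} lc lc′ v = trans (to-b lc v) (sym (to-b lc′ v))
    where
    bb′ : Y b ≗ Y b′
    bb′ with same-level Bb Bb′ (trans e (sym e′))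
    ... | inj₁ s = ⊥-elim (true≢false (trans (sym (s a)) p) q)
    ... | inj₂ s = s
    to-b : ∀ {c} → Level t c → Y c ≗ Y b
    to-b (Bc , f) with same-level Bc Bb (trans f (sym e))
    ... | inj₂ s = s
    ... | inj₁ s with same-level Bc Bb′ (trans f (sym e′))
    ... | inj₂ s′ = λ v → trans (s′ v) (sym (bb′ v))
    ... | inj₁ s′ = ⊥-elim (true≢false (trans (s a) p) (trans (s′ a) q))

  constant : ∀ t → ConstX t ⊎ ConstY t
  constant t with any? (λ b → any? λ b′ → any? λ a → ((B b ≟ᵇ true) ×-dec (# (X b) ≟ⁿ t)) ×-dec ((B b′ ≟ᵇ true) ×-dec (# (X b′) ≟ⁿ t))
                   ×-dec (X b a ≟ᵇ true) ×-dec (X b′ a ≟ᵇ false))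
  ... | yes (b , b′ , a , l , l′ , p , q) = inj₂ (vary⇒ConstY l l′ p q)
  ... | no h = inj₁ λ l l′ a → bool-ext (λ p → not-false λ q → h (_ , _ , a , l , l′ , p , q)) (λ p → not-false λ q → h (_ , _ , a , l′ , l , p , q))

  step-up : ∀ {b b′} → B b ≡ true → B b′ ≡ true → # (X b′) < # (X b) → # (X b) ≡ suc (# (X b′))
  step-up {b} {b′} Bb Bb′ lt with ∩-find? (X b) (X b′) | ∩-find? (Y b′) (Y b)
  ... | inj₁ (a , p , q) | inj₁ (a′ , p′ , q′) = one-up Bb Bb′ p q p′ q′
  ... | inj₂ s | _ = ⊥-elim (<⇒≱ lt (#-mono s))
  ... | _ | inj₂ s = ⊥-elim (<⇒≢ (+-mono-<-≤ lt (#-mono s)) (total Bb′ Bb))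

  -- Otherwise `one-up`, applied in the opposite direction, would make the smaller X-set the larger
  -- one.
  cross-level : ∀ {b b′} → B b ≡ true → B b′ ≡ true → # (X b′) < # (X b) → X b′ ⊆ X b ⊎ Y b ⊆ Y b′
  cross-level {b} {b′} Bb Bb′ lt with ∩-find? (X b′) (X b) | ∩-find? (Y b) (Y b′)
  ... | inj₂ s | _ = inj₁ s
  ... | _ | inj₂ s = inj₂ s
  ... | inj₁ (a , p , q) | inj₁ (a′ , p′ , q′) = ⊥-elim (<⇒≱ lt (≤-trans (n≤1+n _) (≤-reflexive (sym (one-up Bb′ Bb p q p′ q′)))))

  ChainX ChainY : ℕ → Set
  ChainX t = ∀ {b b′} → Level (suc t) b → Level t b′ → X b′ ⊆ X b
  ChainY t = ∀ {b b′} → Level (suc t) b → Level t b′ → Y b ⊆ Y b′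

  -- On each of the two levels X or Y is constant, so a single failure of containment between X-sets
  -- spreads and forces containment of the Y-sets for all pairs.
  chain : ∀ t → ChainX t ⊎ ChainY t
  chain t with any? (λ b → any? λ b′ → any? λ a → ((B b ≟ᵇ true) ×-dec (# (X b) ≟ⁿ suc t)) ×-dec ((B b′ ≟ᵇ true) ×-dec (# (X b′) ≟ⁿ t))
                   ×-dec (X b′ a ≟ᵇ true) ×-dec (X b a ≟ᵇ false))
  ... | no h = inj₁ λ l l′ a p → not-false λ q → h (_ , _ , a , l , l′ , p , q)
  ... | yes (b , b′ , a , lb , lb′ , p , q) = inj₂ (go (constant (suc t)) (constant t))
    where
    X⊈⇒Y : ∀ {c c′} → Level (suc t) c → Level t c′ → X c′ a ≡ true → X c a ≡ false → Y c ⊆ Y c′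
    X⊈⇒Y (Bc , e) (Bc′ , e′) p q with cross-level Bc Bc′ (≤-reflexive (trans (cong suc e′) (sym e)))
    ... | inj₁ s = ⊥-elim (true≢false (s a p) q)
    ... | inj₂ s = s
    go : ConstX (suc t) ⊎ ConstY (suc t) → ConstX t ⊎ ConstY t → ChainY t
    go (inj₁ x) (inj₁ x′) lc lc′ = X⊈⇒Y lc lc′ (trans (x′ lc′ lb′ a) p) (trans (x lc lb a) q)
    go (inj₁ x) (inj₂ y′) lc lc′ v h = trans (y′ lc′ lb′ v) (X⊈⇒Y lc lb′ p (trans (x lc lb a) q) v h)
    go (inj₂ y) (inj₁ x′) lc lc′ v h = X⊈⇒Y lb lc′ (trans (x′ lc′ lb′ a) p) q v (trans (y lb lc v) h)
    go (inj₂ y) (inj₂ y′) lc lc′ v h = trans (y′ lc′ lb′ v) (X⊈⇒Y lb lb′ p q v (trans (y lb lc v) h))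

  -- By `step-up`, distinct levels differ by one, so there are at most two. On a single level, X
  -- would vary because of `a`, hence Y would be constant, which the partial row `e` forbids.
  two-levels : Partial G A B → (∃ λ a → AD a ≡ true) → (∃ λ a → AE a ≡ true) →
               ∃ λ t → (∃ λ b → Level (suc t) b) × (∃ λ b → Level t b) × (∀ {b} → B b ≡ true → Level (suc t) b ⊎ Level t b)
  two-levels P (a , Da) (e , Ee) with any? (λ b → any? λ b′ → (B b ≟ᵇ true) ×-dec (B b′ ≟ᵇ true) ×-dec (# (X b′) <? # (X b)))
  ... | yes (b , b′ , Bb , Bb′ , lt) = # (X b′) , (b , Bb , step-up Bb Bb′ lt) , (b′ , Bb′ , refl) , levels
    where
    levels : ∀ {c} → B c ≡ true → Level (suc (# (X b′))) c ⊎ Level (# (X b′)) c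
    levels {c} Bc with <-cmp (# (X c)) (# (X b′))
    ... | tri≈ _ e _ = inj₂ (Bc , e)
    ... | tri> _ _ gt = inj₁ (Bc , step-up Bc Bb′ gt)
    ... | tri< l _ _ = ⊥-elim (<⇒≢ l (suc-injective (trans (sym (step-up Bb Bc (<-trans l lt))) (step-up Bb Bb′ lt))))
  ... | no h with proj₁ (P a (∧-elimˡ Da)) | proj₂ (P a (∧-elimˡ Da)) | proj₁ (P e (∧-elimˡ Ee)) | proj₂ (P e (∧-elimˡ Ee))
  ... | b , Bb , ab | b′ , Bb′ , ab′ | c , Bc , ec | c′ , Bc′ , ec′ =
    ⊥-elim (true≢false (∧-elimʳ {AE e} (trans (sym (vary⇒ConstY {t = # (X b)} (Bb , refl) (Bb′ , eq Bb′ Bb) (∧-intro Da (adj-swap G ab))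
             (trans (cong (AD a ∧_) (adj-swap G ab′)) (∧-zeroʳ _)) (Bc , eq Bc Bb) (Bc′ , eq Bc′ Bb) e)) (∧-intro Ee (adj-swap G ec)))) (adj-swap G ec′))
    where
    eq : ∀ {b b′} → B b ≡ true → B b′ ≡ true → # (X b) ≡ # (X b′)
    eq Bb Bb′ = ≤-antisym (≮⇒≥ λ lt → h (_ , _ , Bb , Bb′ , lt)) (≮⇒≥ λ lt → h (_ , _ , Bb′ , Bb , lt))

Columns-switch : ∀ {n} {G : Graph n} {A B D} → Columns G A B D → ∀ {b a b′ a′} (alt : Alt G b a b′ a′) → A a ≡ true → A a′ ≡ true →
                 Columns (Switch.switch G alt) A B D
Columns-switch {G = G} {A} {B} C {b} {a} {b′} {a′} alt Aa Aa′ = record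
  { isRigid = switch-rigid isRigid
  ; disjoint = disjoint
  ; twins = λ Bb Bb′ Av vb vb′ → trans (keep Bb Av) (trans (twins Bb Bb′ Av vb vb′) (sym (keep Bb′ Av)))
  ; same-dg = λ {c} {c′} Bb Bb′ → trans (same-deg c) (trans (same-dg Bb Bb′) (sym (same-deg c′)))
  }
  where
  open Columns C
  open Switch G alt
  ≢A : ∀ {x v} → A x ≡ true → A v ≡ false → v ≢ x
  ≢A Ax Av refl = true≢false Ax Av
  keep : ∀ {c v} → B c ≡ true → A v ≡ false → adj switch c v ≡ adj G c v
  keep {c} Bc Av = switch-β (≢A Aa Ac) (≢A Aa′ Ac) (≢A Aa Av) (≢A Aa′ Av)
    where Ac = Disjoint-sym disjoint c Bc

-- A vertex of degree `δ` in `co G` has degree `n ∸ (δ + 1)` in G, so the transformed `D` marks the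
-- same rows.
Columns-co : ∀ {n} {G : Graph n} {A B D} → Columns G A B D → Columns (co G) A B (λ δ → D (n ∸ (δ + 1)))
Columns-co {G = G} C = record
  { isRigid = Rigid-co isRigid
  ; disjoint = disjoint
  ; twins = λ Bb Bb′ Av vb vb′ → trans (co-≢ G (vb ∘ sym)) (trans (cong not (twins Bb Bb′ Av vb vb′)) (sym (co-≢ G (vb′ ∘ sym))))
  ; same-dg = λ Bb Bb′ → dg-co-cong G G _ _ refl (same-dg Bb Bb′)
  }
  where open Columns C

Columns-not : ∀ {n} {G : Graph n} {A B D} → Columns G A B D → Columns G A B (not ∘ D)
Columns-not C = record { Columns C }

ofDeg-co : ∀ {n} (G : Graph n) D v → ofDeg (co G) (λ δ → D (n ∸ (δ + 1))) v ≡ ofDeg G D v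
ofDeg-co {n} G D v = cong D (trans (cong (_∸ (dg (co G) v + 1)) (sym (trans (sym (+-assoc (dg G v) _ 1)) (dg-co G v)))) (m+n∸n≡m (dg G v) (dg (co G) v + 1)))

Partial-co : ∀ {n} {G : Graph n} {A B} → Disjoint A B → Partial G A B → Partial (co G) A B
Partial-co {G = G} dis P a Aa with P a Aa
... | (b , Bb , ab) , (b′ , Bb′ , ab′) =
  (b′ , Bb′ , co-true G (λ { refl → true≢false Bb′ (dis a Aa) }) ab′) , (b , Bb , co-false G ab)

two-elements : ∀ {n} (S : Fin n → Bool) → 2 ≤ # S → ∃ λ a → ∃ λ a′ → S a ≡ true × S a′ ≡ true × a′ ≢ a
two-elements S h with #-find S (<⇒≤ h)
... | a , Sa with #-find (S ∖ a) (≤-pred (≤-trans h (≤-reflexive (trans (#-point S a) (cong (λ b → b2n b + # (S ∖ a)) Sa)))))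
... | a′ , k = a , a′ , Sa , ∧-elimˡ k , ==-false (not-elim (∧-elimʳ {S a′} k))

-- Rows of D with pairwise disjoint neighbourhoods: a common neighbour outside D of the columns they cover would have
-- a non-neighbour elsewhere, and a switch would break the agreement given by same-level.
module Thin {n} {G : Graph n} {A B : Fin n → Bool} {D : ℕ → Bool} (C : Columns G A B D) (P : Partial G A B)
            (≤1 : ∀ {b} → B b ≡ true → # (Col.X C b) ≤ 1) (two : 2 ≤ # (Col.AD C)) where
  open Columns C
  open Col C

  private
    els = two-elements AD two
    a₁ = proj₁ els
    a₂ = proj₁ (proj₂ els)
    AD₁ = proj₁ (proj₂ (proj₂ els))
    AD₂ = proj₁ (proj₂ (proj₂ (proj₂ els)))
    a₂≢a₁ = proj₂ (proj₂ (proj₂ (proj₂ els)))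
    b₁ = proj₁ (proj₁ (P a₁ (∧-elimˡ AD₁)))
    Bb₁ = proj₁ (proj₂ (proj₁ (P a₁ (∧-elimˡ AD₁))))
    a₁b₁ = proj₂ (proj₂ (proj₁ (P a₁ (∧-elimˡ AD₁))))
    b₂ = proj₁ (proj₁ (P a₂ (∧-elimˡ AD₂)))
    Bb₂ = proj₁ (proj₂ (proj₁ (P a₂ (∧-elimˡ AD₂))))
    a₂b₂ = proj₂ (proj₂ (proj₁ (P a₂ (∧-elimˡ AD₂))))

  level₁ : ∀ {b a} → B b ≡ true → X b a ≡ true → Level 1 b
  level₁ {b} Bb Xa = Bb , ≤-antisym (≤1 Bb) (#-pos (X b) Xa)

  X₁ : X b₁ a₁ ≡ true
  X₁ = ∧-intro AD₁ (adj-swap G a₁b₁)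
  X₂ : X b₂ a₂ ≡ true
  X₂ = ∧-intro AD₂ (adj-swap G a₂b₂)
  l₁ : Level 1 b₁
  l₁ = level₁ Bb₁ X₁
  l₂ : Level 1 b₂
  l₂ = level₁ Bb₂ X₂
  X₂₁ : X b₂ a₁ ≡ false
  X₂₁ = trans (cong (AD a₁ ∧_) (leaf-free {S = AD} {adj G b₂} (proj₂ l₂) AD₂ (adj-swap G a₂b₂) AD₁ (a₂≢a₁ ∘ sym))) (∧-zeroʳ _)
  constY : ConstY 1
  constY = vary⇒ConstY l₁ l₂ X₁ X₂₁

  Y₁-empty : ∀ a → Y b₁ a ≡ false
  Y₁-empty a = not-true λ Ya → contra a Ya (proj₂ (P a (∧-elimˡ (∧-elimˡ Ya))))
    where
    contra : ∀ a → Y b₁ a ≡ true → (∃ λ b → B b ≡ true × adj G a b ≡ false) → ⊥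
    contra a Ya (b′ , Bb′ , ab′) with <-cmp (# (X b′)) 1
    ... | tri> _ _ gt = <⇒≱ gt (≤1 Bb′)
    ... | tri≈ _ e _ = true≢false (∧-elimʳ {AE a} (trans (sym (constY l₁ (Bb′ , e) a)) Ya)) (adj-swap G ab′)
    -- As `X b′` is empty, `Y b′` is larger than `Y b₁` by one and contains a row `a′` for the
    -- switch.
    ... | tri< lt _ _ with #-exchange {f = Y b₁} {Y b′} le {a} Ya (trans (cong (AE a ∧_) (adj-swap G ab′)) (∧-zeroʳ _))
      where
      le : # (Y b₁) ≤ # (Y b′)
      le = ≤-trans (n≤1+n _) (≤-reflexive (trans (cong (_+ # (Y b₁)) (sym (proj₂ l₁))) (trans (total Bb₁ Bb′) (cong (_+ # (Y b′)) (n<1⇒n≡0 lt)))))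
    ... | a′ , Yb′a′ , Yb₁a′ = true≢false
            (trans (constY-H (Bb₁ , trans (X-H-# Bb₁) (proj₂ l₁)) (Bb₂ , trans (X-H-# Bb₂) (proj₂ l₂)) a) (∧-intro Ea-H Y₂a))
            (trans (cong (CH.AE a ∧_) switch-ab) (∧-zeroʳ _))
      where
      Ea = ∧-elimˡ {AE a} Ya
      Ea′ = ∧-elimˡ {AE a′} Yb′a′
      B≢A : ∀ {b x} → B b ≡ true → A x ≡ true → b ≢ x
      B≢A Bb Ax refl = true≢false Ax (B⇒¬A Bb)
      alt : Alt G b₁ a b′ a′
      alt = record { ab = ∧-elimʳ {AE a} Ya ; cd = ∧-elimʳ {AE a′} Yb′a′ ; cb = adj-swap G ab′ ; ad = Y-false Ea′ Yb₁a′
                   ; b≢c = B≢A Bb′ (∧-elimˡ Ea) ∘ sym ; a≢d = B≢A Bb₁ (∧-elimˡ Ea′) }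
      open Switch G alt
      CH-cols : Columns switch A B D
      CH-cols = Columns-switch C alt (∧-elimˡ Ea) (∧-elimˡ Ea′)
      module CH = Col CH-cols
      deg-D : ∀ v → ofDeg switch D v ≡ ofDeg G D v
      deg-D v = cong D (same-deg v)
      AD≢ : ∀ {x v} → AD v ≡ true → AE x ≡ true → v ≢ x
      AD≢ {x} Dv Ex refl = true≢false (∧-elimʳ {A x} Dv) (not-elim (∧-elimʳ {A x} Ex))
      X-H : ∀ {b} → B b ≡ true → CH.X b ≗ X b
      X-H {b} Bb v with bool-cases (AD v)
      ... | inj₁ Dv = cong₂ _∧_ (cong (A v ∧_) (deg-D v)) (switch-β (B≢A Bb (∧-elimˡ Ea)) (B≢A Bb (∧-elimˡ Ea′)) (AD≢ Dv Ea) (AD≢ Dv Ea′))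
      ... | inj₂ Dv = trans (cong (_∧ adj switch b v) (trans (cong (A v ∧_) (deg-D v)) Dv)) (sym (cong (_∧ adj G b v) Dv))
      X-H-# : ∀ {b} → B b ≡ true → # (CH.X b) ≡ # (X b)
      X-H-# Bb = #-cong (X-H Bb)
      constY-H : CH.ConstY 1
      constY-H = CH.vary⇒ConstY {a = a₁} (Bb₁ , trans (X-H-# Bb₁) (proj₂ l₁)) (Bb₂ , trans (X-H-# Bb₂) (proj₂ l₂))
                   (trans (X-H Bb₁ a₁) X₁) (trans (X-H Bb₂ a₁) X₂₁)
      Ea-H : CH.AE a ≡ true
      Ea-H = trans (cong (λ z → A a ∧ not z) (deg-D a)) Ea
      Y₂a : adj switch b₂ a ≡ true
      Y₂a = trans (switch-α b₂≢b₁ b₂≢b′ (B≢A Bb₁ (∧-elimˡ Ea) ∘ sym) (B≢A Bb′ (∧-elimˡ Ea) ∘ sym))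
              (∧-elimʳ {AE a} (trans (constY l₂ l₁ a) Ya))
        where
        b₂≢b₁ : b₂ ≢ b₁
        b₂≢b₁ e = true≢false X₁ (trans (cong (λ z → X z a₁) (sym e)) X₂₁)
        b₂≢b′ : b₂ ≢ b′
        b₂≢b′ e = <⇒≢ lt (trans (cong (λ z → # (X z)) (sym e)) (proj₂ l₂))

  one-nbr : ∀ {b} → B b ≡ true → # (A ∩ adj G b) ≡ 1
  one-nbr {b} Bb = trans (nbrs-# b) (trans (total Bb Bb₁) (cong₂ _+_ (proj₂ l₁) (#-none Y₁-empty)))

OneNbr : ∀ {n} → Graph n → (A B : Fin n → Bool) → Set
OneNbr G A B = ∀ {b} → B b ≡ true → # (A ∩ adj G b) ≡ 1

module _ {n} {G : Graph n} {A B : Fin n → Bool} {D : ℕ → Bool} (C : Columns G A B D) (P : Partial G A B) where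
  open Columns C
  open Col C

  -- If the larger X-sets are all of `AD`, every column misses at most one marked row, and the
  -- complement is thin. Otherwise the smaller X-sets are all equal and contained in every X-set; as
  -- no row is full, they are empty, and G itself is thin.
  chain⇒OneNbr : ∀ t → ∃ (Level (suc t)) → ∃ (Level t) → (∀ {b} → B b ≡ true → Level (suc t) b ⊎ Level t b) → ChainX t → 2 ≤ # AD →
                 OneNbr G A B ⊎ OneNbr (co G) A B
  chain⇒OneNbr t (b⁺ , l⁺) (b⁻ , l⁻) levels ch two
    with any? (λ b → any? λ a → ((B b ≟ᵇ true) ×-dec (# (X b) ≟ⁿ suc t)) ×-dec (AD a ≟ᵇ true) ×-dec (adj G b a ≟ᵇ false))
  ... | no h = inj₂ (Thin.one-nbr (Columns-co C) (Partial-co {G = G} disjoint P) ≤1 (≤-trans two (≤-reflexive (sym (#-cong AD-co)))))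
    where
    AD-co : Col.AD (Columns-co C) ≗ AD
    AD-co v = cong (A v ∧_) (ofDeg-co G D v)
    co-count : ∀ {b} → B b ≡ true → # (X b) + # (AD ∩ adj (co G) b) ≡ # AD
    co-count {b} Bb = trans (sym (+-identityʳ _)) (trans (cong (λ z → # (X b) + # (AD ∩ adj (co G) b) + b2n (z ∧ ofDeg G D b)) (sym (B⇒¬A Bb))) (co-split G AD b))
    #AD : # AD ≡ suc t
    #AD = trans (≤-antisym (#-mono {f = AD} {X b⁺} (λ a Da → ∧-intro Da (not-false λ k → h (b⁺ , a , l⁺ , Da , k)))) (#-mono {f = X b⁺} {AD} (λ a k → ∧-elimˡ k))) (proj₂ l⁺)
    lem : ∀ {b} → B b ≡ true → Level (suc t) b ⊎ Level t b → # (AD ∩ adj (co G) b) ≤ 1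
    lem {b} Bb (inj₁ (_ , e)) = ≤-trans (≤-reflexive (+-cancelˡ-≡ (# (X b)) _ 0 (trans (co-count Bb) (trans #AD (trans (sym e) (sym (+-identityʳ _))))))) z≤n
    lem {b} Bb (inj₂ (_ , e)) = ≤-reflexive (+-cancelˡ-≡ (# (X b)) _ 1 (trans (co-count Bb) (trans #AD (trans (cong suc (sym e)) (+-comm 1 _)))))
    ≤1 : ∀ {b} → B b ≡ true → # (Col.X (Columns-co C) b) ≤ 1
    ≤1 {b} Bb = ≤-trans (≤-reflexive (#-cong (λ v → cong (_∧ adj (co G) b v) (AD-co v)))) (lem Bb (levels Bb))
  ... | yes (b₀ , a₀ , l₀ , Da₀ , b₀a₀) = inj₁ (Thin.one-nbr C P ≤1 two)
    where
    X₀ : X b₀ a₀ ≡ false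
    X₀ = trans (cong (AD a₀ ∧_) b₀a₀) (∧-zeroʳ _)
    second : ∃ λ b → Level (suc t) b × X b a₀ ≡ true
    second with proj₁ (P a₀ (∧-elimˡ Da₀))
    ... | b , Bb , ab with levels Bb
    ... | inj₁ l = b , l , ∧-intro Da₀ (adj-swap G ab)
    ... | inj₂ l = ⊥-elim (true≢false (ch l₀ l a₀ (∧-intro Da₀ (adj-swap G ab))) X₀)
    b₂ = proj₁ second
    l₂ = proj₁ (proj₂ second)
    -- This set has at most `t` elements because `a₀` separates `b₀` from `b₂`; by the chain
    -- condition it is then the X-set of every column of level `t`.
    I : Fin n → Bool
    I = X b₀ ∩ X b₂
    #I : # I ≤ t
    #I = ≤-pred (≤-trans (#-mono-< {f = I} {X b₂} (λ a k → ∧-elimʳ {X b₀ a} k) a₀ (cong (_∧ X b₂ a₀) X₀) (proj₂ (proj₂ second))) (≤-reflexive (proj₂ l₂)))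
    I⊆ : ∀ {c} → Level t c → I ⊆ X c
    I⊆ {c} l = ⊆-antisym-# (λ a k → ∧-intro (ch l₀ l a k) (ch l₂ l a k)) (≤-trans #I (≤-reflexive (sym (proj₂ l))))
    everywhere : ∀ a → X b⁻ a ≡ true → ∀ {c} → B c ≡ true → Level (suc t) c ⊎ Level t c → X c a ≡ true
    everywhere a k _ (inj₁ l) = ch l l⁻ a k
    everywhere a k _ (inj₂ l) = I⊆ l a (∧-intro (ch l₀ l⁻ a k) (ch l₂ l⁻ a k))
    empty : ∀ a → X b⁻ a ≡ false
    empty a = not-true λ k → case proj₂ (P a (∧-elimˡ (∧-elimˡ k))) of λ where
      (c , Bc , ac) → true≢false (adj-swap G (∧-elimʳ {AD a} (everywhere a k Bc (levels Bc)))) ac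
    t≡0 : t ≡ 0
    t≡0 = trans (sym (proj₂ l⁻)) (#-none empty)
    ≤1 : ∀ {b} → B b ≡ true → # (X b) ≤ 1
    ≤1 Bb with levels Bb
    ... | inj₁ (_ , e) = ≤-reflexive (trans e (cong suc t≡0))
    ... | inj₂ (_ , e) = ≤-trans (≤-reflexive (trans e t≡0)) z≤n

-- If the Y-sets form the chain, `D` is replaced by its complement, which exchanges X with Y. As the
-- two sizes have a constant sum, this also exchanges the upper level with the lower one.
columns⇒OneNbr : ∀ {n} {G : Graph n} {A B D} (C : Columns G A B D) → Partial G A B → 2 ≤ # (Col.AD C) → 2 ≤ # (Col.AE C) →
                 OneNbr G A B ⊎ OneNbr (co G) A B
columns⇒OneNbr {n} {G} {A} {B} {D} C P two two′ with Col.two-levels C P (#-find (Col.AD C) (<⇒≤ two)) (#-find (Col.AE C) (<⇒≤ two′))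
... | t , (b⁺ , l⁺) , (b⁻ , l⁻) , levels with Col.chain C t
... | inj₁ ch = chain⇒OneNbr C P t (b⁺ , l⁺) (b⁻ , l⁻) levels ch two
... | inj₂ ch = chain⇒OneNbr (Columns-not C) P t′ (b⁻ , down l⁻) (b⁺ , up l⁺) levels′ ch′ two′
  where
  open Col C
  t′ = # (Y b⁺)
  up : ∀ {b} → Level (suc t) b → B b ≡ true × # (Y b) ≡ t′
  up {b} (Bb , e) = Bb , +-cancelˡ-≡ (suc t) _ _ (trans (cong (_+ # (Y b)) (sym e)) (trans (total Bb (proj₁ l⁺)) (cong (_+ t′) (proj₂ l⁺))))
  down : ∀ {b} → Level t b → B b ≡ true × # (Y b) ≡ suc t′
  down {b} (Bb , e) = Bb , +-cancelˡ-≡ t _ _ (trans (cong (_+ # (Y b)) (sym e)) (trans (total Bb (proj₁ l⁺)) (trans (cong (_+ t′) (proj₂ l⁺)) (sym (+-suc t t′)))))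
  levels′ : ∀ {b} → B b ≡ true → (B b ≡ true × # (Y b) ≡ suc t′) ⊎ (B b ≡ true × # (Y b) ≡ t′)
  levels′ Bb with levels Bb
  ... | inj₁ l = inj₂ (up l)
  ... | inj₂ l = inj₁ (down l)
  ch′ : Col.ChainX (Columns-not C) t′
  ch′ {b} {b′} (Bb , e) (Bb′ , e′) with levels Bb | levels Bb′
  ... | inj₂ l | inj₁ l′ = ch l′ l
  ... | inj₁ l | _ = ⊥-elim (1+n≢n (trans (sym e) (proj₂ (up l))))
  ... | _ | inj₂ l′ = ⊥-elim (1+n≢n (trans (sym (proj₂ (down l′))) e′))

-- The split components of a graph

-- A union of consecutive split components of the canonical decomposition of Tyshkevich.
record Piece {n} (G : Graph n) (A B : Fin n → Bool) : Set where
  field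
    disjoint    : Disjoint A B
    clique      : Uniform G A true
    independent : Uniform G B false
    homA : ∀ {v a a′} → A v ≡ false → B v ≡ false → A a ≡ true → A a′ ≡ true → adj G v a ≡ adj G v a′
    homB : ∀ {v b b′} → A v ≡ false → B v ≡ false → B b ≡ true → B b′ ≡ true → adj G v b ≡ adj G v b′

  A≢B : ∀ {a b} → A a ≡ true → B b ≡ true → a ≢ b
  A≢B Aa Bb refl = true≢false Bb (disjoint _ Aa)

≢-by : ∀ {n} (f : Fin n → Bool) {x y} → f x ≡ true → f y ≡ false → x ≢ y
≢-by f fx fy refl = true≢false fx fy

Piece-co : ∀ {n} {G : Graph n} {A B} → Piece G A B → Piece (co G) B A
Piece-co {G = G} {A} {B} P = record
  { disjoint    = Disjoint-sym disjoint
  ; clique      = Uniform-co G independent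
  ; independent = Uniform-co G clique
  ; homA = λ Bv Av Ba Ba′ → trans (co-≢ G (≢-by B Ba Bv ∘ sym)) (trans (cong not (homB Av Bv Ba Ba′)) (sym (co-≢ G (≢-by B Ba′ Bv ∘ sym))))
  ; homB = λ Bv Av Aa Aa′ → trans (co-≢ G (≢-by A Aa Av ∘ sym)) (trans (cong not (homA Av Bv Aa Aa′)) (sym (co-≢ G (≢-by A Aa′ Av ∘ sym))))
  }
  where open Piece P

Piece-columns : ∀ {n} {G : Graph n} {A B} D → Rigid G → Piece G A B → (∀ {b b′} → B b ≡ true → B b′ ≡ true → dg G b ≡ dg G b′) → Columns G A B D
Piece-columns {G = G} {A} {B} D R P h = record { isRigid = R ; disjoint = disjoint ; twins = tw ; same-dg = h }
  where
  open Piece P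
  tw : ∀ {b b′ v} → B b ≡ true → B b′ ≡ true → A v ≡ false → v ≢ b → v ≢ b′ → adj G b v ≡ adj G b′ v
  tw {b} {b′} {v} Bb Bb′ Av vb vb′ with bool-cases (B v)
  ... | inj₁ Bv = trans (independent b v Bb Bv (vb ∘ sym)) (sym (independent b′ v Bb′ Bv (vb′ ∘ sym)))
  ... | inj₂ Bv = trans (adj-sym G b v) (trans (homB Av Bv Bb Bb′) (adj-sym G v b′))

-- The clique side takes the role of the columns here. This shows that vertices of equal degree in
-- `A` have equally many neighbours in `B`.
Piece-rows : ∀ {n} {G : Graph n} {A B A′} → Rigid G → Piece G A B → A′ ⊆ A → (∀ {a a′} → A′ a ≡ true → A′ a′ ≡ true → dg G a ≡ dg G a′) →
             Columns G B A′ (λ _ → true)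
Piece-rows {G = G} {A} {B} {A′} R P sub h = record
  { isRigid = R ; disjoint = λ v Bv → not-true λ k → true≢false Bv (disjoint v (sub v k)) ; twins = tw ; same-dg = h }
  where
  open Piece P
  tw : ∀ {b b′ v} → A′ b ≡ true → A′ b′ ≡ true → B v ≡ false → v ≢ b → v ≢ b′ → adj G b v ≡ adj G b′ v
  tw {b} {b′} {v} Ab Ab′ Bv vb vb′ with bool-cases (A v)
  ... | inj₁ Av = trans (clique b v (sub b Ab) Av (vb ∘ sym)) (sym (clique b′ v (sub b′ Ab′) Av (vb′ ∘ sym)))
  ... | inj₂ Av = trans (adj-sym G b v) (trans (homA Av Bv (sub b Ab) (sub b′ Ab′)) (adj-sym G v b′))

nbrs-const : ∀ {n} {G : Graph n} {A B D} → Columns G A B D → ∀ {b b′} → B b ≡ true → B b′ ≡ true → # (A ∩ adj G b) ≡ # (A ∩ adj G b′)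
nbrs-const C {b} {b′} Bb Bb′ = trans (Col.nbrs-# C b) (trans (Col.total C Bb Bb′) (sym (Col.nbrs-# C b′)))

module Middle {n} {G : Graph n} {A B : Fin n → Bool} (R : Rigid G) (P : Piece G A B)
              (same : ∀ {b b′} → B b ≡ true → B b′ ≡ true → dg G b ≡ dg G b′) (part : Partial G A B) where
  open Piece P

  is : Fin n → ℕ → Bool
  is a δ = δ ≡ᵇ dg G a

  size others : Fin n → ℕ
  size a   = # (A ∩ ofDeg G (is a))
  others a = # (A ∩ ∁ (ofDeg G (is a)))

  stars : OneNbr G A B ⊎ OneNbr (co G) A B → Good G (A ∪ B) (splitLab A)
  stars (inj₁ h) = Good-stars (# A) A B true refl disjoint clique independent (λ b Bb → h Bb)
  stars (inj₂ h) = Good-co (Good-stars (# A) A B false refl disjoint (Uniform-co G clique) (Uniform-co G independent) (λ b Bb → h Bb))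

  columns : ∀ D → Columns G A B D
  columns D = Piece-columns D R P same

  near-regular : ∀ f → A f ≡ true → (∀ {a a′} → (A ∖ f) a ≡ true → (A ∖ f) a′ ≡ true → dg G a ≡ dg G a′) → Good G (A ∪ B) (splitLab A)
  near-regular f Af h = Good-lab final (Good-ren 0F 1F (Good-bip A B f true disjoint Af clique independent
      (λ u v Au Av → nbrs-const (Piece-rows R P (λ _ → ∧-elimˡ) h) Au Av) (λ u v Bu Bv → nbrs-const (columns (λ _ → true)) Bu Bv)))
    where
    final : ∀ v → (A ∪ B) v ≡ true → relabel 0F 1F (bipLab f A v) ≡ splitLab A v
    final v k with v ≟ f
    ... | yes refl rewrite Af = refl
    ... | no _ with A v
    ... | true  = refl
    ... | false = refl

  -- The exceptional row becomes the hub; if there is none, `a` itself can take its place.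
  few-others : ∀ a → A a ≡ true → others a ≤ 1 → Good G (A ∪ B) (splitLab A)
  few-others a Aa le with find? (A ∩ ∁ (ofDeg G (is a)))
  ... | inj₂ none = near-regular a Aa (λ p q → trans (lem (∧-elimˡ p)) (sym (lem (∧-elimˡ q))))
    where
    lem : ∀ {v} → A v ≡ true → dg G v ≡ dg G a
    lem {v} Av = ≡ᵇ-true (not-false λ k → true≢false (∧-intro Av (not-intro k)) (none v))
  ... | inj₁ (f , k) = near-regular f (∧-elimˡ k) (λ p q → trans (lem p) (sym (lem q)))
    where
    lem : ∀ {v} → (A ∖ f) v ≡ true → dg G v ≡ dg G a
    lem {v} p = ≡ᵇ-true (not-false λ e → true≢false (∧-intro (∧-intro (∧-elimˡ p) (not-intro e)) (∧-elimʳ {A v} p))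
      (#≡0 (n≤0⇒n≡0 (≤-pred (≤-trans (≤-reflexive (trans (cong (λ b → b2n b + # (A ∩ ∁ (ofDeg G (is a)) ∖ f)) (sym k))
        (sym (#-point (A ∩ ∁ (ofDeg G (is a))) f)))) le))) v))

  -- All columns have the same number of neighbours among the rows, and it is neither zero nor the
  -- number of all rows. With at most three rows this means one neighbour or one non-neighbour.
  small : # A ≤ 3 → ∀ {a} → A a ≡ true → Good G (A ∪ B) (splitLab A)
  small le {a} Aa = stars (cases (part a Aa))
    where
    cases : _ → OneNbr G A B ⊎ OneNbr (co G) A B
    cases ((b , Bb , ab) , (b′ , Bb′ , ab′)) = go (# (A ∩ adj G b)) refl
      where
      count : ∀ {c} → B c ≡ true → # (A ∩ adj G c) + # (A ∩ adj (co G) c) ≡ # A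
      count {c} Bc = trans (sym (+-identityʳ _)) (trans (cong (λ z → # (A ∩ adj G c) + # (A ∩ adj (co G) c) + b2n z) (sym (Disjoint-sym disjoint c Bc))) (co-split G A c))
      const : ∀ {c} → B c ≡ true → # (A ∩ adj G c) ≡ # (A ∩ adj G b)
      const Bc = nbrs-const (columns (λ _ → true)) Bc Bb
      co-const : ∀ {c c′} → B c ≡ true → B c′ ≡ true → # (A ∩ adj (co G) c) ≡ # (A ∩ adj (co G) c′)
      co-const {c} {c′} Bc Bc′ = +-cancelˡ-≡ (# (A ∩ adj G c)) _ _ (trans (count Bc) (trans (sym (count Bc′))
        (cong (_+ # (A ∩ adj (co G) c′)) (trans (const Bc′) (sym (const Bc))))))
      pos : 1 ≤ # (A ∩ adj G b)
      pos = #-pos (A ∩ adj G b) (∧-intro Aa (adj-swap G ab))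
      co-pos : 1 ≤ # (A ∩ adj (co G) b)
      co-pos = ≤-trans (#-pos (A ∩ adj (co G) b′) (∧-intro Aa (adj-swap (co G) (co-true G (A≢B Aa Bb′) ab′)))) (≤-reflexive (co-const Bb′ Bb))
      go : ∀ β → # (A ∩ adj G b) ≡ β → OneNbr G A B ⊎ OneNbr (co G) A B
      go zero e = ⊥-elim (<⇒≢ pos (sym e))
      go (suc zero) e = inj₁ (λ Bc → trans (const Bc) e)
      go (suc (suc β)) e = inj₂ (λ Bc → trans (co-const Bc Bb) (≤-antisym (+-cancelˡ-≤ 2 _ _
        (≤-trans (+-monoˡ-≤ (# (A ∩ adj (co G) b)) (s≤s (s≤s (z≤n {β})))) (≤-trans (≤-reflexive (trans (cong (_+ # (A ∩ adj (co G) b)) (sym e)) (count Bb))) le))) co-pos))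

  -- `columns⇒OneNbr` needs two marked and two unmarked rows. A class that leaves at most one row is
  -- the near-regular case; otherwise a class with two rows serves as `D`. If all classes are
  -- singletons, two of them together serve, unless there are at most three rows.
  middle : ∀ {a₀} → A a₀ ≡ true → Good G (A ∪ B) (splitLab A)
  middle {a₀} A₀ with any? (λ a → (A a ≟ᵇ true) ×-dec (others a ≤? 1))
  ... | yes (a , Aa , le) = few-others a Aa le
  ... | no many with any? (λ a → (A a ≟ᵇ true) ×-dec (2 ≤? size a))
  ... | yes (a , Aa , le) = stars (columns⇒OneNbr (columns (is a)) part le (≰⇒> λ k → many (a , Aa , k)))
  ... | no singles with #-find (A ∩ ∁ (ofDeg G (is a₀))) (<⇒≤ (≰⇒> λ k → many (a₀ , A₀ , k)))
  ... | a₁ , k₁ = go (2 ≤? # (A ∩ ∁ (ofDeg G D)))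
    where
    D : ℕ → Bool
    D δ = is a₀ δ ∨ is a₁ δ
    A₁ = ∧-elimˡ {A a₁} k₁
    AD = A ∩ ofDeg G D
    one : ∀ a → A a ≡ true → size a ≤ 1
    one a Aa = ≤-pred (≰⇒> λ k → singles (a , Aa , k))
    hit₀ : ofDeg G D a₀ ≡ true
    hit₀ rewrite ≡ᵇ-refl (dg G a₀) = refl
    hit₁ : ofDeg G D a₁ ≡ true
    hit₁ rewrite ≡ᵇ-refl (dg G a₁) = trans (∨-comm _ true) refl
    a₁≢a₀ : a₁ ≢ a₀
    a₁≢a₀ refl = true≢false (≡ᵇ-refl (dg G a₀)) (not-elim (∧-elimʳ {A a₀} k₁))
    two : 2 ≤ # AD
    two = ≤-trans (s≤s (#-pos (AD ∖ a₀) {a₁} (∧-intro (∧-intro A₁ hit₁) (not-intro (==-≢ a₁≢a₀)))))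
            (≤-reflexive (trans (cong (λ b → b2n b + # (AD ∖ a₀)) (sym (∧-intro A₀ hit₀))) (sym (#-point AD a₀))))
    at-most-two : # AD ≤ 2
    at-most-two = ≤-trans (≤-reflexive (#-split AD (ofDeg G (is a₀)))) (+-mono-≤
      (≤-trans (#-mono {f = AD ∩ ofDeg G (is a₀)} (λ v k → ∧-intro (∧-elimˡ (∧-elimˡ k)) (∧-elimʳ {AD v} k))) (one a₀ A₀))
      (≤-trans (#-mono {f = AD ∩ ∁ (ofDeg G (is a₀))} (λ v k → ∧-intro (∧-elimˡ (∧-elimˡ k)) (lem (∧-elimʳ {A v} (∧-elimˡ k)) (not-elim (∧-elimʳ {AD v} k))))) (one a₁ A₁)))
      where
      lem : ∀ {x y} → x ∨ y ≡ true → x ≡ false → y ≡ true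
      lem h refl = h
    go : Dec (2 ≤ # (A ∩ ∁ (ofDeg G D))) → Good G (A ∪ B) (splitLab A)
    go (yes le) = stars (columns⇒OneNbr (columns D) part two le)
    go (no ¬le) = small (≤-trans (≤-reflexive (#-split A (ofDeg G D))) (+-mono-≤ at-most-two (≤-pred (≰⇒> ¬le)))) A₀

sub-disjoint : ∀ {n} {S T S′ T′ : Fin n → Bool} → S′ ⊆ S → T′ ⊆ T → Disjoint S T → Disjoint S′ T′
sub-disjoint s t d v Sv = not-true λ Tv → true≢false (t v Tv) (d v (s v Sv))

-- (A , B) is the composition of its restriction to O, as the outer part, with the rest.
record Outer {n} (G : Graph n) (A B O : Fin n → Bool) : Set where
  field
    upper : ∀ {a v} → A a ≡ true → O a ≡ true → (A ∪ B) v ≡ true → O v ≡ false → adj G a v ≡ true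
    lower : ∀ {b v} → B b ≡ true → O b ≡ true → (A ∪ B) v ≡ true → O v ≡ false → adj G b v ≡ false

PieceGood : ℕ → Set
PieceGood k = ∀ {n} {G : Graph n} {A B} → Rigid G → Piece G A B → # (A ∪ B) ≡ k → Good G (A ∪ B) (splitLab A)

module SplitOff {n} {G : Graph n} {A B O : Fin n → Bool} (R : Rigid G) (P : Piece G A B) (out : Outer G A B O) where
  open Piece P
  open Outer out

  piece-O : Piece G (A ∩ O) (B ∩ O)
  piece-O = record
    { disjoint    = sub-disjoint {S = A} {B} (λ _ → ∧-elimˡ) (λ _ → ∧-elimˡ) disjoint
    ; clique      = λ u v p q → clique u v (∧-elimˡ p) (∧-elimˡ q)
    ; independent = λ u v p q → independent u v (∧-elimˡ p) (∧-elimˡ q)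
    ; homA = λ {v} {a} {a′} nA nB p q → hA v nA nB p q (bool-cases (A v ∨ B v))
    ; homB = λ {v} {b} {b′} nA nB p q → hB v nA nB p q (bool-cases (A v ∨ B v))
    }
    where
    notO : ∀ v → (A ∩ O) v ≡ false → (B ∩ O) v ≡ false → A v ∨ B v ≡ true → O v ≡ false
    notO v nA nB k = not-true λ Ov → case ∨-elim k of λ where
      (inj₁ Av) → true≢false (∧-intro Av Ov) nA
      (inj₂ Bv) → true≢false (∧-intro Bv Ov) nB
    hA : ∀ v {a a′} → (A ∩ O) v ≡ false → (B ∩ O) v ≡ false → (A ∩ O) a ≡ true → (A ∩ O) a′ ≡ true →
         A v ∨ B v ≡ true ⊎ A v ∨ B v ≡ false → adj G v a ≡ adj G v a′
    hA v nA nB p q (inj₂ k) = homA (∨-falseˡ k) (∨-falseʳ {A v} k) (∧-elimˡ p) (∧-elimˡ q)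
    hA v {a} {a′} nA nB p q (inj₁ k) = trans (adj-swap G (upper (∧-elimˡ p) (∧-elimʳ {A a} p) k (notO v nA nB k)))
                                   (sym (adj-swap G (upper (∧-elimˡ q) (∧-elimʳ {A a′} q) k (notO v nA nB k))))
    hB : ∀ v {a a′} → (A ∩ O) v ≡ false → (B ∩ O) v ≡ false → (B ∩ O) a ≡ true → (B ∩ O) a′ ≡ true →
         A v ∨ B v ≡ true ⊎ A v ∨ B v ≡ false → adj G v a ≡ adj G v a′
    hB v nA nB p q (inj₂ k) = homB (∨-falseˡ k) (∨-falseʳ {A v} k) (∧-elimˡ p) (∧-elimˡ q)
    hB v {a} {a′} nA nB p q (inj₁ k) = trans (adj-swap G (lower (∧-elimˡ p) (∧-elimʳ {B a} p) k (notO v nA nB k)))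
                                   (sym (adj-swap G (lower (∧-elimˡ q) (∧-elimʳ {B a′} q) k (notO v nA nB k))))

  piece-∁O : Piece G (A ∩ ∁ O) (B ∩ ∁ O)
  piece-∁O = record
    { disjoint    = sub-disjoint {S = A} {B} (λ _ → ∧-elimˡ) (λ _ → ∧-elimˡ) disjoint
    ; clique      = λ u v p q → clique u v (∧-elimˡ p) (∧-elimˡ q)
    ; independent = λ u v p q → independent u v (∧-elimˡ p) (∧-elimˡ q)
    ; homA = λ {v} {a} {a′} nA nB p q → h v nA nB (λ h₁ h₂ → homA h₁ h₂ (∧-elimˡ p) (∧-elimˡ q))
               (∨-introˡ {A a} (∧-elimˡ p)) (not-elim (∧-elimʳ {A a} p)) (∨-introˡ {A a′} (∧-elimˡ q)) (not-elim (∧-elimʳ {A a′} q))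
    ; homB = λ {v} {b} {b′} nA nB p q → h v nA nB (λ h₁ h₂ → homB h₁ h₂ (∧-elimˡ p) (∧-elimˡ q))
               (∨-introʳ {A b} (∧-elimˡ p)) (not-elim (∧-elimʳ {B b} p)) (∨-introʳ {A b′} (∧-elimˡ q)) (not-elim (∧-elimʳ {B b′} q))
    }
    where
    isO : ∀ v → (A ∩ ∁ O) v ≡ false → A v ≡ true → O v ≡ true
    isO v h Av = not-false λ k → true≢false (∧-intro Av (not-intro k)) h
    isO′ : ∀ v → (B ∩ ∁ O) v ≡ false → B v ≡ true → O v ≡ true
    isO′ v h Av = not-false λ k → true≢false (∧-intro Av (not-intro k)) h
    h : ∀ v {x y} → (A ∩ ∁ O) v ≡ false → (B ∩ ∁ O) v ≡ false → (A v ≡ false → B v ≡ false → adj G v x ≡ adj G v y) →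
        (A ∪ B) x ≡ true → O x ≡ false → (A ∪ B) y ≡ true → O y ≡ false → adj G v x ≡ adj G v y
    h v nA nB base Sx Ox Sy Oy with bool-cases (A v) | bool-cases (B v)
    ... | inj₁ Av | _ = trans (upper Av (isO v nA Av) Sx Ox) (sym (upper Av (isO v nA Av) Sy Oy))
    ... | inj₂ _ | inj₁ Bv = trans (lower Bv (isO′ v nB Bv) Sx Ox) (sym (lower Bv (isO′ v nB Bv) Sy Oy))
    ... | inj₂ Av | inj₂ Bv = base Av Bv

  restrict : ∀ {Q : Fin n → Bool} → Good G ((A ∩ Q) ∪ (B ∩ Q)) (splitLab (A ∩ Q)) → Good G ((A ∪ B) ∩ Q) (splitLab A)
  restrict {Q} g = Good-lab (λ v k → cong (if_then 1F else 2F) (trans (cong (A v ∧_) (∧-elimʳ {A v ∨ B v} k)) (∧-identityʳ (A v))))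
                     (Good-set (λ v → lem (A v) (B v) (Q v)) g)
    where
    lem : ∀ a b q → a ∧ q ∨ b ∧ q ≡ (a ∨ b) ∧ q
    lem true  b q = lem′ b q
      where
      lem′ : ∀ b q → q ∨ b ∧ q ≡ q
      lem′ b true  = refl
      lem′ b false = ∧-zeroʳ b
    lem false b q = refl

  -- The outer factor uses the labels `1F` and `2F`, the inner one `3F` and `4F`; the outer clique
  -- side is joined to everything inner.
  compose : Good G ((A ∪ B) ∩ O) (splitLab A) → Good G ((A ∪ B) ∩ ∁ O) (splitLab A) → Good G (A ∪ B) (splitLab A)
  compose g h = Good-lab final (Good-set set (Good-ren 4F 2F (Good-ren 3F 1F
      (Good-∪ right₃₄ M (λ v k → trans (cong (λ z → (A ∪ B) v ∧ not z) (∧-elimʳ {(A ∪ B) v} k)) (∧-zeroʳ _)) left right cross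
        (Good-lab (λ v k → sym (lab-O v (∧-elimʳ {(A ∪ B) v} k))) g)
        (Good-lab (λ v k → trans (rel (A v)) (sym (lab-∁O v (∧-elimʳ {(A ∪ B) v} k)))) (Good-ren 2F 4F (Good-ren 1F 3F h)))))))
    where
    lab : Fin n → Fin 5
    lab v = if O v then splitLab A v else if A v then 3F else 4F
    rel : ∀ a → relabel 2F 4F (relabel 1F 3F (if a then 1F else 2F)) ≡ (if a then 3F else 4F)
    rel true  = refl
    rel false = refl
    lab-O : ∀ v → O v ≡ true → lab v ≡ splitLab A v
    lab-O v k = cong (λ b → if b then splitLab A v else if A v then 3F else 4F) k
    lab-∁O : ∀ v → not (O v) ≡ true → lab v ≡ (if A v then 3F else 4F)
    lab-∁O v k = cong (λ b → if b then splitLab A v else if A v then 3F else 4F) (not-elim k)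
    M : Fin 5 → Fin 5 → Bool
    M 1F _ = true
    M _  _ = false
    side-l : ∀ a → right₃₄ (if a then 1F else 2F) ≡ true
    side-l true  = refl
    side-l false = refl
    side-r : ∀ a → right₃₄ (if a then 3F else 4F) ≡ false
    side-r true  = refl
    side-r false = refl
    left : ∀ v → ((A ∪ B) ∩ O) v ≡ true → right₃₄ (lab v) ≡ true
    left v k = trans (cong right₃₄ (lab-O v (∧-elimʳ {(A ∪ B) v} k))) (side-l (A v))
    right : ∀ v → ((A ∪ B) ∩ ∁ O) v ≡ true → right₃₄ (lab v) ≡ false
    right v k = trans (cong right₃₄ (lab-∁O v (∧-elimʳ {(A ∪ B) v} k))) (side-r (A v))
    cross : ∀ u v → ((A ∪ B) ∩ O) u ≡ true → ((A ∪ B) ∩ ∁ O) v ≡ true → adj G u v ≡ M (lab u) (lab v)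
    cross u v p q with bool-cases (A u)
    ... | inj₁ Au = trans (upper Au (∧-elimʳ {(A ∪ B) u} p) (∧-elimˡ q) (not-elim (∧-elimʳ {(A ∪ B) v} q)))
                      (sym (cong (λ l → M l (lab v)) (trans (lab-O u (∧-elimʳ {(A ∪ B) u} p)) (cong (if_then 1F else 2F) Au))))
    ... | inj₂ Au = trans (lower (trans (sym (cong (_∨ B u) Au)) (∧-elimˡ p)) (∧-elimʳ {(A ∪ B) u} p) (∧-elimˡ q) (not-elim (∧-elimʳ {(A ∪ B) v} q)))
                      (sym (cong (λ l → M l (lab v)) (trans (lab-O u (∧-elimʳ {(A ∪ B) u} p)) (cong (if_then 1F else 2F) Au))))
    set : ((A ∪ B) ∩ O) ∪ ((A ∪ B) ∩ ∁ O) ≗ A ∪ B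
    set v = lem (A v ∨ B v) (O v)
      where
      lem : ∀ x o → x ∧ o ∨ x ∧ not o ≡ x
      lem true  true  = refl
      lem true  false = refl
      lem false _     = refl
    final : ∀ v → (A ∪ B) v ≡ true → relabel 4F 2F (relabel 3F 1F (lab v)) ≡ splitLab A v
    final v _ with O v | A v
    ... | true  | true  = refl
    ... | true  | false = refl
    ... | false | true  = refl
    ... | false | false = refl

  split-off : (∀ {k} → k < # (A ∪ B) → PieceGood k) → ∀ {p q} → (A ∪ B) p ≡ true → O p ≡ true → (A ∪ B) q ≡ true → O q ≡ false →
              Good G (A ∪ B) (splitLab A)
  split-off IH {p} {q} Sp Op Sq Oq = compose
    (restrict (IH (#-mono-< {f = (A ∩ O) ∪ (B ∩ O)} {A ∪ B} (sub O) q (trans (cong₂ (λ x y → A q ∧ x ∨ B q ∧ y) Oq Oq) (cong₂ _∨_ (∧-zeroʳ (A q)) (∧-zeroʳ (B q)))) Sq) R piece-O refl))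
    (restrict (IH (#-mono-< {f = (A ∩ ∁ O) ∪ (B ∩ ∁ O)} {A ∪ B} (sub (∁ O)) p (trans (cong₂ (λ x y → A p ∧ not x ∨ B p ∧ not y) Op Op) (cong₂ _∨_ (∧-zeroʳ (A p)) (∧-zeroʳ (B p)))) Sp) R piece-∁O refl))
    where
    sub : ∀ Q → (A ∩ Q) ∪ (B ∩ Q) ⊆ A ∪ B
    sub Q v k with ∨-elim {A v ∧ Q v} k
    ... | inj₁ h = ∨-introˡ {A v} (∧-elimˡ h)
    ... | inj₂ h = ∨-introʳ {A v} (∧-elimˡ h)

-- A degree class within `A` and one within `B` that are joined neither completely nor not at all.
-- Such a pair marks the core around which the piece is layered.
record Mixing {n} (G : Graph n) (A B : Fin n → Bool) : Set where
  field
    {a₁ a₂ b₁ b₂} : Fin n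
    Aa₁ : A a₁ ≡ true
    Aa₂ : A a₂ ≡ true
    Bb₁ : B b₁ ≡ true
    Bb₂ : B b₂ ≡ true
    da  : dg G a₁ ≡ dg G a₂
    db  : dg G b₁ ≡ dg G b₂
    edge₁ : adj G a₁ b₁ ≡ true
    edge₂ : adj G a₂ b₂ ≡ false

mixing? : ∀ {n} (G : Graph n) A B → Dec (Mixing G A B)
mixing? G A B with any? (λ a₁ → any? λ a₂ → any? λ b₁ → any? λ b₂ →
    (A a₁ ≟ᵇ true) ×-dec (A a₂ ≟ᵇ true) ×-dec (B b₁ ≟ᵇ true) ×-dec (B b₂ ≟ᵇ true) ×-dec
    (dg G a₁ ≟ⁿ dg G a₂) ×-dec (dg G b₁ ≟ⁿ dg G b₂) ×-dec (adj G a₁ b₁ ≟ᵇ true) ×-dec (adj G a₂ b₂ ≟ᵇ false))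
... | yes (_ , _ , _ , _ , x , y , z , w , s , t , u , v) =
  yes (record { Aa₁ = x ; Aa₂ = y ; Bb₁ = z ; Bb₂ = w ; da = s ; db = t ; edge₁ = u ; edge₂ = v })
... | no h = no λ m → let open Mixing m in h (_ , _ , _ , _ , Aa₁ , Aa₂ , Bb₁ , Bb₂ , da , db , edge₁ , edge₂)

Mixing-co : ∀ {n} {G : Graph n} {A B} → Piece G A B → Mixing G A B → Mixing (co G) B A
Mixing-co {G = G} P m = record
  { Aa₁ = Bb₂ ; Aa₂ = Bb₁ ; Bb₁ = Aa₂ ; Bb₂ = Aa₁ ; da = dg-co-cong G G _ _ refl (sym db) ; db = dg-co-cong G G _ _ refl (sym da)
  ; edge₁ = adj-swap (co G) (co-true G (A≢B Aa₂ Bb₂) edge₂) ; edge₂ = adj-swap (co G) (co-false G edge₁) }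
  where
  open Mixing m
  open Piece P

-- The non-edge between the two classes that `crossing` needs is `a₂ b₂`.
joined-up : ∀ {n} {G : Graph n} {A B} → Rigid G → Piece G A B → (m : Mixing G A B) → let open Mixing m in
            ∀ {a b w u} → A a ≡ true → dg G a ≢ dg G a₁ → B b ≡ true → dg G b ≢ dg G b₁ →
            B w ≡ true → dg G w ≡ dg G b₁ → adj G a w ≡ true → A u ≡ true → dg G u ≡ dg G a₁ → adj G u b ≡ true → adj G a b ≡ true
joined-up {G = G} R P m {a} {b} {w} {u} Aa da′ Bb db′ Bw dw aw Au du ub = not-false λ ab →
  crossing R {a} {w} {u} {b} {a₂} {b₂} aw ub ab (A≢B Aa Bb) (A≢B Au Bw) (λ e → da′ (trans e du)) (λ e → db′ (trans (sym e) dw))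
    edge₂ (A≢B Aa₂ Bb₂) (trans (sym da) (sym du)) (trans (sym db) (sym dw)) (A≢B Aa Bb₂ ∘ sym) (A≢B Au Bb₂ ∘ sym) (A≢B Aa₂ Bw) (A≢B Aa₂ Bb)
  where
  open Mixing m
  open Piece P

joined-down : ∀ {n} {G : Graph n} {A B} → Rigid G → Piece G A B → (m : Mixing G A B) → let open Mixing m in
              ∀ {a b w u} → A a ≡ true → dg G a ≢ dg G a₁ → B b ≡ true → dg G b ≢ dg G b₁ →
              B w ≡ true → dg G w ≡ dg G b₁ → adj G a w ≡ false → A u ≡ true → dg G u ≡ dg G a₁ → adj G u b ≡ false → adj G a b ≡ false
joined-down {G = G} R P m {a} {b} {w} {u} Aa da′ Bb db′ Bw dw aw Au du ub = not-true λ ab → true≢false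
  (joined-up (Rigid-co R) (Piece-co P) (Mixing-co P m) Bb (λ e → db′ (trans (cancel e) (sym db))) Aa (λ e → da′ (trans (cancel e) (sym da)))
     Au (dg-co-cong G G _ _ refl (trans du da)) (adj-swap (co G) (co-true G (A≢B Au Bb) ub))
     Bw (dg-co-cong G G _ _ refl (trans dw db)) (adj-swap (co G) (co-true G (A≢B Aa Bw) aw)))
  (adj-swap (co G) (co-false G ab))
  where
  open Mixing m
  open Piece P
  cancel : ∀ {x y} → dg (co G) x ≡ dg (co G) y → dg G x ≡ dg G y
  cancel = dg-co-cancel G G _ _ refl

module Step {n} {G : Graph n} {A B : Fin n → Bool} (R : Rigid G) (P : Piece G A B) (IH : ∀ {k} → k < # (A ∪ B) → PieceGood k) where
  open Piece P

  only : ∀ {p} → (∀ q → (A ∪ B) q ≡ true → q ≡ p) → Good G (A ∪ B) (splitLab A)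
  only {p} h = Good-lab (λ v k → sym (cong (splitLab A) (h v k)))
    (Good-uniform {κ = true} (splitLab A p) (λ u v Su Sv u≢v → ⊥-elim (u≢v (trans (h u Su) (sym (h v Sv))))))

  peel : ∀ p → (A ∪ B) p ≡ true → Outer G A B ⟦ p ⟧ → Good G (A ∪ B) (splitLab A)
  peel p Sp out with find? ((A ∪ B) ∖ p)
  ... | inj₁ (q , k) = SplitOff.split-off R P out IH Sp (==-refl p) (∧-elimˡ k) (not-elim (∧-elimʳ {(A ∪ B) q} k))
  ... | inj₂ none = only λ q Sq → ==-true {x = q} (not-false λ k → true≢false (∧-intro Sq (not-intro k)) (none q))

  -- Let `a` have maximal degree in `A`. Either it sees all of `B` and is peeled off, or it misses
  -- some `b`. A row seeing `b` would then give an alternating cycle and so a mixing pair; hence `b`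
  -- sees no row and is peeled off.
  no-mixing : ¬ Mixing G A B → Good G (A ∪ B) (splitLab A)
  no-mixing nm with find? A
  ... | inj₂ none = Good-lab (λ v _ → sym (cong (if_then 1F else 2F) (none v)))
        (Good-set (λ v → sym (cong (_∨ B v) (none v))) (Good-uniform 2F independent))
  ... | inj₁ (a₀ , Aa₀) with argmax A (dg G) Aa₀
  ... | a , Aa , max with find? (B ∩ ∁ (adj G a))
  ... | inj₂ none = peel a (∨-introˡ {A a} Aa) (record { upper = up ; lower = λ {b} Bb e → ⊥-elim (A≢B Aa Bb (sym (==-true {x = b} e))) })
    where
    up : ∀ {a′ v} → A a′ ≡ true → ⟦ a ⟧ a′ ≡ true → (A ∪ B) v ≡ true → ⟦ a ⟧ v ≡ false → adj G a′ v ≡ true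
    up {a′} {v} _ e k ne with ==-true {x = a′} e | ∨-elim {A v} k
    ... | refl | inj₁ Av = clique a v Aa Av (==-false {x = v} ne ∘ sym)
    ... | refl | inj₂ Bv = not-false λ h → true≢false (∧-intro Bv (not-intro h)) (none v)
  ... | inj₁ (b , k) = peel b (∨-introʳ {A b} Bb) (record { upper = λ {a′} Aa′ e → ⊥-elim (A≢B Aa′ Bb (==-true {x = a′} e)) ; lower = low })
    where
    Bb = ∧-elimˡ {B b} k
    ab = not-elim (∧-elimʳ {B b} k)
    isolated : ∀ a′ → A a′ ≡ true → adj G a′ b ≡ true → ⊥
    isolated a′ Aa′ a′b with deg-exchange G (max a′ Aa′) a′b ab (A≢B Aa Bb ∘ sym)
    ... | q , aq , a′q , q≢a′ with bool-cases (A q) | bool-cases (B q)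
    -- The exchanged vertex lies in `B`, because `A` is a clique and vertices outside the piece do
    -- not distinguish `a` from `a′`.
    ... | inj₁ Aq | _ = true≢false (clique a′ q Aa′ Aq (q≢a′ ∘ sym)) a′q
    ... | inj₂ Aq | inj₂ Bq = true≢false (adj-swap G (trans (homA Aq Bq Aa′ Aa) (adj-swap G aq))) a′q
    ... | inj₂ _ | inj₁ Bq with Alt⇒deg R {a} {q} {a′} {b} (record { ab = aq ; cd = a′b ; cb = a′q ; ad = ab ; b≢c = q≢a′ ; a≢d = A≢B Aa Bb })
    ... | inj₁ e = nm (record { Aa₁ = Aa′ ; Aa₂ = Aa ; Bb₁ = Bb ; Bb₂ = Bb ; da = sym e ; db = refl ; edge₁ = a′b ; edge₂ = ab })
    ... | inj₂ e = nm (record { Aa₁ = Aa ; Aa₂ = Aa ; Bb₁ = Bq ; Bb₂ = Bb ; da = refl ; db = e ; edge₁ = aq ; edge₂ = ab })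
    low : ∀ {b′ v} → B b′ ≡ true → ⟦ b ⟧ b′ ≡ true → (A ∪ B) v ≡ true → ⟦ b ⟧ v ≡ false → adj G b′ v ≡ false
    low {b′} {v} _ e k ne with ==-true {x = b′} e | ∨-elim {A v} k
    ... | refl | inj₁ Av = not-true λ h → isolated v Av (adj-swap G h)
    ... | refl | inj₂ Bv = independent b v Bb Bv (==-false {x = v} ne ∘ sym)

  -- The three layers are: the rows full to B₀ with the columns empty to A₀ (this is O), the rows not constant on B₀
  -- with B₀ itself (what O′ adds), and the rest.
  module _ (m : Mixing G A B)
           (unmixed : ∀ {b u u′} → B b ≡ true → dg G b ≢ dg G (Mixing.b₁ m) → A u ≡ true → dg G u ≡ dg G (Mixing.a₁ m) →
                      A u′ ≡ true → dg G u′ ≡ dg G (Mixing.a₁ m) → adj G u b ≡ adj G u′ b) where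
    open Mixing m

    A₀ B₀ none-in full-in O O′ : Fin n → Bool
    A₀ v = A v ∧ dg G v ≡ᵇ dg G a₁
    B₀ v = B v ∧ dg G v ≡ᵇ dg G b₁
    none-in v = # (B₀ ∩ adj G v) ≡ᵇ 0
    full-in v = # (B₀ ∩ adj (co G) v) ≡ᵇ 0
    O v  = (A v ∧ not (dg G v ≡ᵇ dg G a₁) ∧ full-in v) ∨ (B v ∧ not (dg G v ≡ᵇ dg G b₁) ∧ not (adj G a₁ v))
    O′ v = (A v ∧ ((dg G v ≡ᵇ dg G a₁) ∨ not (none-in v))) ∨ (B v ∧ dg G v ≡ᵇ dg G b₁)

    B₀b₁ : B₀ b₁ ≡ true
    B₀b₁ = ∧-intro Bb₁ (≡ᵇ-refl _)

    in-A : ∀ {v x y} → A v ≡ true → (A v ∧ x) ∨ (B v ∧ y) ≡ x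
    in-A {v} {x} {y} Av rewrite Av | disjoint v Av = ∨-identityʳ x
    in-B : ∀ {v x y} → B v ≡ true → (A v ∧ x) ∨ (B v ∧ y) ≡ y
    in-B {v} Bv rewrite Disjoint-sym disjoint v Bv | Bv = refl

    none⇒ : ∀ {v w} → none-in v ≡ true → B₀ w ≡ true → adj G v w ≡ false
    none⇒ {v} {w} h Bw = not-true λ k → true≢false (∧-intro Bw k) (#≡0 {f = B₀ ∩ adj G v} (≡ᵇ-true h) w)
    full⇒ : ∀ {v w} → A v ≡ true → full-in v ≡ true → B₀ w ≡ true → adj G v w ≡ true
    full⇒ {v} {w} Av h Bw = not-false λ k → true≢false (∧-intro Bw (co-true G (A≢B Av (∧-elimˡ Bw)) k)) (#≡0 {f = B₀ ∩ adj (co G) v} (≡ᵇ-true h) w)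
    some : ∀ {v} → none-in v ≡ false → ∃ λ w → B₀ w ≡ true × adj G v w ≡ true
    some {v} h with #-find (B₀ ∩ adj G v) (n≢0⇒n>0 (≡ᵇ-false h))
    ... | w , k = w , ∧-elimˡ k , ∧-elimʳ {B₀ w} k
    missing : ∀ {v} → full-in v ≡ false → ∃ λ w → B₀ w ≡ true × adj G v w ≡ false
    missing {v} h with #-find (B₀ ∩ adj (co G) v) (n≢0⇒n>0 (≡ᵇ-false h))
    ... | w , k = w , ∧-elimˡ k , not-elim (∧-elimˡ (∧-elimʳ {B₀ w} k))

    up : ∀ {a b w} → A a ≡ true → dg G a ≢ dg G a₁ → B b ≡ true → dg G b ≢ dg G b₁ → B₀ w ≡ true → adj G a w ≡ true → adj G a₁ b ≡ true → adj G a b ≡ true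
    up {w = w} Aa da′ Bb db′ Bw aw ub = joined-up R P m Aa da′ Bb db′ (∧-elimˡ Bw) (≡ᵇ-true (∧-elimʳ {B w} Bw)) aw Aa₁ refl ub
    down : ∀ {a b w} → A a ≡ true → dg G a ≢ dg G a₁ → B b ≡ true → dg G b ≢ dg G b₁ → B₀ w ≡ true → adj G a w ≡ false → adj G a₁ b ≡ false → adj G a b ≡ false
    down {w = w} Aa da′ Bb db′ Bw aw ub = joined-down R P m Aa da′ Bb db′ (∧-elimˡ Bw) (≡ᵇ-true (∧-elimʳ {B w} Bw)) aw Aa₁ refl ub

    O-A : ∀ {v} → A v ≡ true → O v ≡ not (dg G v ≡ᵇ dg G a₁) ∧ full-in v
    O-A = in-A
    O-B : ∀ {v} → B v ≡ true → O v ≡ not (dg G v ≡ᵇ dg G b₁) ∧ not (adj G a₁ v)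
    O-B = in-B
    O′-A : ∀ {v} → A v ≡ true → O′ v ≡ (dg G v ≡ᵇ dg G a₁) ∨ not (none-in v)
    O′-A = in-A
    O′-B : ∀ {v} → B v ≡ true → O′ v ≡ dg G v ≡ᵇ dg G b₁
    O′-B = in-B

    -- By `unmixed`, `a₁` can represent all of `A₀` for the columns outside `B₀`. Pairs avoiding
    -- both classes are settled by `joined-up` and `joined-down`.
    outer : Outer G A B O
    outer = record { upper = upper ; lower = lower }
      where
      upper : ∀ {a v} → A a ≡ true → O a ≡ true → (A ∪ B) v ≡ true → O v ≡ false → adj G a v ≡ true
      upper {a} {v} Aa Oa Sv Ov with ∨-elim {A v} Sv | trans (sym (O-A Aa)) Oa
      ... | inj₁ Av | _ = clique a v Aa Av (≢-by O Oa Ov)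
      ... | inj₂ Bv | h with bool-cases (dg G v ≡ᵇ dg G b₁)
      ... | inj₁ e = full⇒ Aa (∧-elimʳ {not (dg G a ≡ᵇ dg G a₁)} h) (∧-intro Bv e)
      ... | inj₂ e = up Aa (≡ᵇ-false (not-elim (∧-elimˡ h))) Bv (≡ᵇ-false e) B₀b₁ (full⇒ Aa (∧-elimʳ {not (dg G a ≡ᵇ dg G a₁)} h) B₀b₁)
                       (not-false λ k → true≢false (∧-intro (not-intro e) (not-intro k)) (trans (sym (O-B Bv)) Ov))
      lower : ∀ {b v} → B b ≡ true → O b ≡ true → (A ∪ B) v ≡ true → O v ≡ false → adj G b v ≡ false
      lower {b} {v} Bb Ob Sv Ov with ∨-elim {A v} Sv | trans (sym (O-B Bb)) Ob
      ... | inj₂ Bv | _ = independent b v Bb Bv (≢-by O Ob Ov)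
      ... | inj₁ Av | h with bool-cases (dg G v ≡ᵇ dg G a₁)
      ... | inj₁ e = adj-swap G (trans (unmixed Bb (≡ᵇ-false (not-elim (∧-elimˡ h))) Av (≡ᵇ-true e) Aa₁ refl) (not-elim (∧-elimʳ {not (dg G b ≡ᵇ dg G b₁)} h)))
      ... | inj₂ e with missing {v} (not-true λ k → true≢false (∧-intro (not-intro e) k) (trans (sym (O-A Av)) Ov))
      ... | w , Bw , vw = adj-swap G (down Av (≡ᵇ-false e) Bb (≡ᵇ-false (not-elim (∧-elimˡ h))) Bw vw (not-elim (∧-elimʳ {not (dg G b ≡ᵇ dg G b₁)} h)))

    a₁∉O : O a₁ ≡ false
    a₁∉O = trans (O-A Aa₁) (cong (λ b → not b ∧ full-in a₁) (≡ᵇ-refl _))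
    a₁∈O′ : O′ a₁ ≡ true
    a₁∈O′ = trans (O′-A Aa₁) (cong (_∨ not (none-in a₁)) (≡ᵇ-refl _))

    module _ (noO : ∀ v → ((A ∪ B) ∩ O) v ≡ false) where

      ∉O : ∀ {v} → (A ∪ B) v ≡ true → O v ≡ false
      ∉O {v} Sv = not-true λ k → true≢false (∧-intro Sv k) (noO v)

      outer′ : Outer G A B O′
      outer′ = record { upper = upper ; lower = lower }
        where
        upper : ∀ {a v} → A a ≡ true → O′ a ≡ true → (A ∪ B) v ≡ true → O′ v ≡ false → adj G a v ≡ true
        upper {a} {v} Aa Oa Sv Ov with ∨-elim {A v} Sv
        ... | inj₁ Av = clique a v Aa Av (≢-by O′ Oa Ov)
        ... | inj₂ Bv = cases (bool-cases (dg G a ≡ᵇ dg G a₁))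
          where
          e = trans (sym (O′-B Bv)) Ov
          a₁v : adj G a₁ v ≡ true
          a₁v = not-false λ k → true≢false (∧-intro (not-intro e) (not-intro k)) (trans (sym (O-B Bv)) (∉O Sv))
          cases : _ → adj G a v ≡ true
          cases (inj₁ d) = trans (unmixed Bv (≡ᵇ-false e) Aa (≡ᵇ-true d) Aa₁ refl) a₁v
          cases (inj₂ d) with some {a} (not-true λ k → true≢false (trans (sym (O′-A Aa)) Oa) (cong₂ (λ x y → x ∨ not y) d k))
          ... | w , Bw , aw = up Aa (≡ᵇ-false d) Bv (≡ᵇ-false e) Bw aw a₁v
        lower : ∀ {b v} → B b ≡ true → O′ b ≡ true → (A ∪ B) v ≡ true → O′ v ≡ false → adj G b v ≡ false
        lower {b} {v} Bb Ob Sv Ov with ∨-elim {A v} Sv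
        ... | inj₂ Bv = independent b v Bb Bv (≢-by O′ Ob Ov)
        ... | inj₁ Av = adj-swap G (none⇒ (not-false λ k → true≢false (∨-introʳ {dg G v ≡ᵇ dg G a₁} (not-intro k)) (trans (sym (O′-A Av)) Ov))
                          (∧-intro Bb (trans (sym (O′-B Bb)) Ob)))

      module _ (allO′ : ∀ v → ((A ∪ B) ∩ ∁ O′) v ≡ false) where

        ∈O′ : ∀ {v} → (A ∪ B) v ≡ true → O′ v ≡ true
        ∈O′ {v} Sv = not-false λ k → true≢false (∧-intro Sv (not-intro k)) (allO′ v)

        dB : ∀ {b} → B b ≡ true → dg G b ≡ dg G b₁
        dB {b} Bb = ≡ᵇ-true (trans (sym (O′-B Bb)) (∈O′ (∨-introʳ {A b} Bb)))

        exchange : ∀ {a a′ b} → A a ≡ true → A a′ ≡ true → dg G a ≡ dg G a′ → B b ≡ true → adj G a b ≡ true → adj G a′ b ≡ false →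
                   ∃ λ q → B q ≡ true × adj G a′ q ≡ true × adj G a q ≡ false
        exchange {a} {a′} {b} Aa Aa′ e Bb ab a′b with deg-exchange G (≤-reflexive e) ab a′b (A≢B Aa′ Bb ∘ sym)
        ... | q , a′q , aq , q≢a with bool-cases (A q) | bool-cases (B q)
        ... | _ | inj₁ Bq = q , Bq , a′q , aq
        ... | inj₁ Aq | _ = ⊥-elim (true≢false (clique a q Aa Aq (q≢a ∘ sym)) aq)
        ... | inj₂ Aq | inj₂ Bq = ⊥-elim (true≢false (adj-swap G (trans (homA Aq Bq Aa Aa′) (adj-swap G a′q))) aq)

        -- A row of `A₀` gets a neighbour by comparison with `a₁` and a non-neighbour by comparison
        -- with `a₂`, which have the same degree. The other rows are neither empty nor full to `B₀`,
        -- since `O` is empty and `O′` is everything.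
        partial : Partial G A B
        partial a Aa with bool-cases (dg G a ≡ᵇ dg G a₁)
        ... | inj₂ d = let w , Bw , aw   = some {a} (not-true λ k → true≢false (trans (sym (O′-A Aa)) (∈O′ (∨-introˡ {A a} Aa))) (cong₂ (λ x y → x ∨ not y) d k))
                           w′ , Bw′ , aw′ = missing {a} (not-true λ k → true≢false (∧-intro (not-intro d) k) (trans (sym (O-A Aa)) (∉O (∨-introˡ {A a} Aa))))
                       in (w , ∧-elimˡ Bw , aw) , (w′ , ∧-elimˡ Bw′ , aw′)
        ... | inj₁ d = nbr , non
          where
          nbr : ∃ λ b → B b ≡ true × adj G a b ≡ true
          nbr with bool-cases (adj G a b₁)
          ... | inj₁ h = b₁ , Bb₁ , h
          ... | inj₂ h = let q , Bq , aq , _ = exchange Aa₁ Aa (sym (≡ᵇ-true d)) Bb₁ edge₁ h in q , Bq , aq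
          non : ∃ λ b → B b ≡ true × adj G a b ≡ false
          non with bool-cases (adj G a b₂)
          ... | inj₂ h = b₂ , Bb₂ , h
          ... | inj₁ h = let q , Bq , _ , aq = exchange Aa Aa₂ (trans (≡ᵇ-true d) da) Bb₂ h edge₂ in q , Bq , aq

        core : Good G (A ∪ B) (splitLab A)
        core = Middle.middle R P (λ p q → trans (dB p) (sym (dB q))) partial Aa₁

    row-layers : Good G (A ∪ B) (splitLab A)
    row-layers with find? ((A ∪ B) ∩ O)
    ... | inj₁ (p , k) = SplitOff.split-off R P outer IH (∧-elimˡ k) (∧-elimʳ {(A ∪ B) p} k) (∨-introˡ {A a₁} Aa₁) a₁∉O
    ... | inj₂ noO with find? ((A ∪ B) ∩ ∁ O′)
    ... | inj₁ (q , k) = SplitOff.split-off R P (outer′ noO) IH (∨-introˡ {A a₁} Aa₁) a₁∈O′ (∧-elimˡ k) (not-elim (∧-elimʳ {(A ∪ B) q} k))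
    ... | inj₂ allO′ = core noO allO′

-- The label `3F` is a temporary name in exchanging `1F` with `2F`.
swap-sides : ∀ {n} {G : Graph n} {A B} → Disjoint A B → Good (co G) (B ∪ A) (splitLab B) → Good G (A ∪ B) (splitLab A)
swap-sides {A = A} {B} dis g = Good-lab final (Good-set (λ v → ∨-comm (B v) (A v)) (Good-ren 3F 2F (Good-ren 2F 1F (Good-ren 1F 3F (Good-co g)))))
  where
  final : ∀ v → (A ∪ B) v ≡ true → relabel 3F 2F (relabel 2F 1F (relabel 1F 3F (splitLab B v))) ≡ splitLab A v
  final v k with A v | B v | dis v
  ... | true  | false | _ = refl
  ... | false | true  | _ = refl
  ... | true  | true  | h = case h refl of λ ()

-- If some row outside the class of `a₁` is not constant on the class of `b₁`, then `joined-up` and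
-- `joined-down` make every column outside the latter constant on the former. If there is no such
-- row, the same holds in the complement with the sides exchanged.
pieceGood : ∀ k → PieceGood k
pieceGood = <-rec PieceGood step
  where
  step : ∀ k → (∀ {j} → j < k → PieceGood j) → PieceGood k
  step _ IH {n} {G} {A} {B} R P refl with mixing? G A B
  ... | no nm = Step.no-mixing R P IH nm
  ... | yes m with any? (λ x → any? λ v → any? λ v′ → (A x ≟ᵇ true) ×-dec ¬? (dg G x ≟ⁿ dg G (Mixing.a₁ m)) ×-dec
                   (B v ≟ᵇ true) ×-dec (dg G v ≟ⁿ dg G (Mixing.b₁ m)) ×-dec (B v′ ≟ᵇ true) ×-dec (dg G v′ ≟ⁿ dg G (Mixing.b₁ m)) ×-dec
                   (adj G x v ≟ᵇ true) ×-dec (adj G x v′ ≟ᵇ false))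
  ... | yes (x , v , v′ , Ax , dx , Bv , dv , Bv′ , dv′ , xv , xv′) = Step.row-layers R P IH m
          (λ {b} {u} {u′} Bb db′ Au du Au′ du′ → bool-ext (λ ub → not-false λ u′b → contra Bb db′ Au du ub Au′ du′ u′b)
                                                          (λ u′b → not-false λ ub → contra Bb db′ Au′ du′ u′b Au du ub))
    where
    open Mixing m
    contra : ∀ {b u u′} → B b ≡ true → dg G b ≢ dg G b₁ → A u ≡ true → dg G u ≡ dg G a₁ → adj G u b ≡ true →
             A u′ ≡ true → dg G u′ ≡ dg G a₁ → adj G u′ b ≡ false → ⊥
    contra Bb db′ Au du ub Au′ du′ u′b = true≢false (joined-up R P m Ax dx Bb db′ Bv dv xv Au du ub) (joined-down R P m Ax dx Bb db′ Bv′ dv′ xv′ Au′ du′ u′b)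
  ... | no h = swap-sides disjoint (Step.row-layers (Rigid-co R) (Piece-co P) (λ lt → IH (≤-trans lt (≤-reflexive (#-cong (λ v → ∨-comm (B v) (A v))))))
          (Mixing-co P m) unmixed)
    where
    open Mixing m
    open Piece P
    unmixed : ∀ {a v v′} → A a ≡ true → dg (co G) a ≢ dg (co G) a₂ → B v ≡ true → dg (co G) v ≡ dg (co G) b₂ → B v′ ≡ true → dg (co G) v′ ≡ dg (co G) b₂ →
              adj (co G) v a ≡ adj (co G) v′ a
    unmixed {a} {v} {v′} Aa da′ Bv dv Bv′ dv′ = trans (co-≢ G (A≢B Aa Bv ∘ sym)) (trans (cong not (trans (adj-sym G v a) (trans same (adj-sym G a v′)))) (sym (co-≢ G (A≢B Aa Bv′ ∘ sym))))
      where
      da″ : dg G a ≢ dg G a₁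
      da″ e = da′ (dg-co-cong G G _ _ refl (trans e da))
      in-b : ∀ {w} → dg (co G) w ≡ dg (co G) b₂ → dg G w ≡ dg G b₁
      in-b e = trans (dg-co-cancel G G _ _ refl e) (sym db)
      same : adj G a v ≡ adj G a v′
      same = bool-ext (λ p → not-false λ q → h (a , v , v′ , Aa , da″ , Bv , in-b dv , Bv′ , in-b dv′ , p , q))
                      (λ p → not-false λ q → h (a , v′ , v , Aa , da″ , Bv′ , in-b dv′ , Bv , in-b dv , p , q))

-- The graph around a mixed degree class

module MixedClass {n} {G : Graph n} (R : Rigid G) (m : Mixed G) where
  open Mixed m

  δ : ℕ
  δ = dg G r

  m-co : Mixed (co G)
  m-co = record { pq = co-true G r≢s rs ; rs = co-false G pq ; r≢s = adj⇒≢ G pq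
                ; p≈q = c r≈s ; q≈r = c (trans (sym r≈s) (trans (sym q≈r) (sym p≈q))) ; r≈s = c p≈q }
    where
    c : ∀ {x y} → dg G x ≡ dg G y → dg (co G) x ≡ dg (co G) y
    c = dg-co-cong G G _ _ refl

  -- `V` is the mixed class, `F` and `E` are the outside vertices complete and anticomplete to it,
  -- and `S` is the rest, which turns out to be `V` with at most one further vertex.
  V none-in full-in F E S : Fin n → Bool
  V v = dg G v ≡ᵇ δ
  none-in v = # (V ∩ adj G v) ≡ᵇ 0
  full-in v = # (V ∩ adj (co G) v) ≡ᵇ 0
  F v = not (V v) ∧ full-in v
  E v = not (V v) ∧ none-in v
  S v = not (F v ∨ E v)

  Vr : V r ≡ true
  Vr = ≡ᵇ-refl δ

  out : ∀ {v} → V v ≡ false → dg G v ≢ δ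
  out = ≡ᵇ-false

  full⇒ : ∀ {v w} → F v ≡ true → V w ≡ true → adj G v w ≡ true
  full⇒ {v} {w} h Vw = not-false λ k → true≢false (∧-intro Vw (co-true G (λ { refl → true≢false Vw (not-elim (∧-elimˡ h)) }) k))
                         (#≡0 {f = V ∩ adj (co G) v} (≡ᵇ-true (∧-elimʳ {not (V v)} h)) w)
  none⇒ : ∀ {v w} → E v ≡ true → V w ≡ true → adj G v w ≡ false
  none⇒ {v} {w} h Vw = not-true λ k → true≢false (∧-intro Vw k) (#≡0 {f = V ∩ adj G v} (≡ᵇ-true (∧-elimʳ {not (V v)} h)) w)

  some : ∀ {v} → V v ≡ false → E v ≡ false → ∃ λ w → V w ≡ true × adj G v w ≡ true
  some {v} nV h with #-find (V ∩ adj G v) (n≢0⇒n>0 (≡ᵇ-false (not-true λ k → true≢false (∧-intro (not-intro nV) k) h)))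
  ... | w , k = w , ∧-elimˡ k , ∧-elimʳ {V w} k
  missing : ∀ {v} → V v ≡ false → F v ≡ false → ∃ λ w → V w ≡ true × adj G v w ≡ false
  missing {v} nV h with #-find (V ∩ adj (co G) v) (n≢0⇒n>0 (≡ᵇ-false (not-true λ k → true≢false (∧-intro (not-intro nV) k) h)))
  ... | w , k = w , ∧-elimˡ k , not-elim (∧-elimˡ (∧-elimʳ {V w} k))

  joined : ∀ {x z v u} → x ≢ z → V x ≡ false → V z ≡ false → V v ≡ true → V u ≡ true → adj G x v ≡ true → adj G z u ≡ true → adj G x z ≡ true
  joined x≢z nx nz Vv Vu = outside-adjacent R m x≢z (out nx) (out nz) (≡ᵇ-true Vv) (≡ᵇ-true Vu)

  apart : ∀ {x z v u} → x ≢ z → V x ≡ false → V z ≡ false → V v ≡ true → V u ≡ true → adj G x v ≡ false → adj G z u ≡ false → adj G x z ≡ false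
  apart x≢z nx nz Vv Vu xv zu = not-true λ k → true≢false
    (outside-adjacent (Rigid-co R) m-co x≢z (out nx ∘ cancel) (out nz ∘ cancel) (inn Vv) (inn Vu)
      (co-true G (≢-by V Vv nx ∘ sym) xv) (co-true G (≢-by V Vu nz ∘ sym) zu)) (co-false G k)
    where
    δ-co : dg (co G) p ≡ dg (co G) r
    δ-co = dg-co-cong G G _ _ refl (trans p≈q q≈r)
    cancel : ∀ {x} → dg (co G) x ≡ dg (co G) p → dg G x ≡ δ
    cancel e = dg-co-cancel G G _ _ refl (trans e δ-co)
    inn : ∀ {x} → V x ≡ true → dg (co G) x ≡ dg (co G) p
    inn Vx = trans (dg-co-cong G G _ _ refl (≡ᵇ-true Vx)) (sym δ-co)

  F⇒ : ∀ {v} → F v ≡ true → V v ≡ false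
  F⇒ h = not-elim (∧-elimˡ h)
  E⇒ : ∀ {v} → E v ≡ true → V v ≡ false
  E⇒ h = not-elim (∧-elimˡ h)

  -- A vertex outside `V` that is not in `E` has a neighbour in `V`, as has every vertex of `F`, so
  -- `joined` applies.
  F-S : ∀ {f v} → F f ≡ true → F v ≡ false → E v ≡ false → adj G f v ≡ true
  F-S {f} {v} Ff nF nE with bool-cases (V v)
  ... | inj₁ Vv = full⇒ Ff Vv
  ... | inj₂ nV = let w , Vw , vw = some nV nE in joined (≢-by F Ff nF) (F⇒ Ff) nV Vr Vw (full⇒ Ff Vr) vw

  E-S : ∀ {e v} → E e ≡ true → F v ≡ false → E v ≡ false → adj G e v ≡ false
  E-S {e} {v} Ee nF nE with bool-cases (V v)
  ... | inj₁ Vv = none⇒ Ee Vv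
  ... | inj₂ nV = let w , Vw , vw = missing nV nF in apart (≢-by E Ee nE) (E⇒ Ee) nV Vr Vw (none⇒ Ee Vr) vw

  outer-piece : Piece G F E
  outer-piece = record
    { disjoint    = λ v Fv → not-true λ Ev → true≢false (full⇒ Fv Vr) (none⇒ Ev Vr)
    ; clique      = λ u v Fu Fv u≢v → joined u≢v (F⇒ Fu) (F⇒ Fv) Vr Vr (full⇒ Fu Vr) (full⇒ Fv Vr)
    ; independent = λ u v Eu Ev u≢v → apart u≢v (E⇒ Eu) (E⇒ Ev) Vr Vr (none⇒ Eu Vr) (none⇒ Ev Vr)
    ; homA = λ nF nE Fa Fa′ → trans (adj-swap G (F-S Fa nF nE)) (sym (adj-swap G (F-S Fa′ nF nE)))
    ; homB = λ nF nE Ea Ea′ → trans (adj-swap G (E-S Ea nF nE)) (sym (adj-swap G (E-S Ea′ nF nE)))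
    }

  S⇒F : ∀ {v} → S v ≡ true → F v ≡ false
  S⇒F h = ∨-falseˡ (not-elim h)
  S⇒E : ∀ {v} → S v ≡ true → E v ≡ false
  S⇒E {v} h = ∨-falseʳ {F v} (not-elim h)

  V⇒S : ∀ {v} → V v ≡ true → S v ≡ true
  V⇒S h rewrite h = refl

  -- Vertices of `V` have the same neighbours outside `S`, so equal degrees in G leave equal degrees
  -- inside `S`.
  core-degree : ∀ {u v} → V u ≡ true → V v ≡ true → # (S ∩ adj G u) ≡ # (S ∩ adj G v)
  core-degree {u} {v} Vu Vv = +-cancelʳ-≡ (# (adj G u ∩ ∁ S)) _ _ (trans (sym (parts u)) (trans (trans (≡ᵇ-true Vu) (sym (≡ᵇ-true Vv)))
      (trans (parts v) (cong (# (S ∩ adj G v) +_) (#-cong agree)))))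
    where
    parts : ∀ u → dg G u ≡ # (S ∩ adj G u) + # (adj G u ∩ ∁ S)
    parts u = trans (#-split (adj G u) S) (cong (_+ # (adj G u ∩ ∁ S)) (#-cong (λ w → ∧-comm (adj G u w) (S w))))
    agree : ∀ w → adj G v w ∧ not (S w) ≡ adj G u w ∧ not (S w)
    agree w with bool-cases (F w) | bool-cases (E w)
    ... | inj₁ Fw | _ = cong (_∧ not (S w)) (trans (adj-swap G (full⇒ Fw Vv)) (sym (adj-swap G (full⇒ Fw Vu))))
    ... | inj₂ _ | inj₁ Ew = cong (_∧ not (S w)) (trans (adj-swap G (none⇒ Ew Vv)) (sym (adj-swap G (none⇒ Ew Vu))))
    ... | inj₂ Fw | inj₂ Ew rewrite Fw | Ew = trans (∧-zeroʳ _) (sym (∧-zeroʳ _))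

  merge : ∀ x → Good G S (hubLab x) → Good G S (λ _ → 3F)
  merge x g = Good-lab (λ v _ → lem (v == x)) (Good-ren 1F 3F (Good-ren 0F 3F g))
    where
    lem : ∀ b → relabel 1F 3F (relabel 0F 3F (if b then 0F else 1F)) ≡ 3F
    lem true  = refl
    lem false = refl

  core : Good G S (λ _ → 3F)
  core with find? (S ∩ ∁ V)
  -- Without an exceptional vertex `S` equals `V` and is regular, so any vertex can be named the
  -- hub.
  ... | inj₂ none = merge r (Good-hub S r (V⇒S Vr) (λ u v p q → core-degree (inV p) (inV q)))
    where
    inV : ∀ {u} → (S ∖ r) u ≡ true → V u ≡ true
    inV {u} k = not-false λ h → true≢false (∧-intro (∧-elimˡ k) (not-intro h)) (none u)
  ... | inj₁ (x , k) = merge x (Good-hub S x (∧-elimˡ k) (λ u v p q → core-degree (inV p) (inV q)))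
    where
    nVx : V x ≡ false
    nVx = not-elim (∧-elimʳ {S x} k)
    Sx = ∧-elimˡ {S x} k
    -- Two hubs would have to be both adjacent and non-adjacent.
    inV : ∀ {u} → (S ∖ x) u ≡ true → V u ≡ true
    inV {u} h = not-false λ nV →
      let w , Vw , uw = some nV (S⇒E Su); w′ , Vw′ , uw′ = missing nV (S⇒F Su)
          y , Vy , xy = some nVx (S⇒E Sx); y′ , Vy′ , xy′ = missing nVx (S⇒F Sx)
      in true≢false (joined u≢x nV nVx Vw Vy uw xy) (apart u≢x nV nVx Vw′ Vy′ uw′ xy′)
      where
      Su = ∧-elimˡ {S u} h
      u≢x : u ≢ x
      u≢x = ==-false (not-elim (∧-elimʳ {S u} h))

  everything : Good G full (λ _ → 3F)
  everything = Good-lab final (Good-set set (Good-ren 2F 3F (Good-ren 1F 3F (Good-∪ right₃ M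
      (λ v k → cong not k)
      (λ v k → trans (cong right₃ (lab-out v k)) (side (F v)))
      (λ v k → cong right₃ (lab-in v k))
      cross (Good-lab (λ v k → sym (lab-out v k)) (pieceGood _ R outer-piece refl)) (Good-lab (λ v k → sym (lab-in v k)) core)))))
    where
    lab : Fin n → Fin 5
    lab v = if S v then 3F else splitLab F v
    lab-in : ∀ v → S v ≡ true → lab v ≡ 3F
    lab-in v k = cong (λ b → if b then 3F else splitLab F v) k
    lab-out : ∀ v → (F ∪ E) v ≡ true → lab v ≡ splitLab F v
    lab-out v k = cong (λ b → if not b then 3F else splitLab F v) k
    M : Fin 5 → Fin 5 → Bool
    M 1F _ = true
    M _  _ = false
    side : ∀ b → right₃ (if b then 1F else 2F) ≡ true
    side true  = refl
    side false = refl
    cross : ∀ u v → (F ∪ E) u ≡ true → S v ≡ true → adj G u v ≡ M (lab u) (lab v)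
    cross u v p Sv with bool-cases (F u)
    ... | inj₁ Fu = trans (F-S Fu (S⇒F Sv) (S⇒E Sv)) (sym (cong (λ l → M l (lab v)) (trans (lab-out u p) (cong (if_then 1F else 2F) Fu))))
    ... | inj₂ Fu = trans (E-S (trans (sym (cong (_∨ E u) Fu)) p) (S⇒F Sv) (S⇒E Sv)) (sym (cong (λ l → M l (lab v)) (trans (lab-out u p) (cong (if_then 1F else 2F) Fu))))
    set : (F ∪ E) ∪ S ≗ full
    set v = lem (F v ∨ E v)
      where
      lem : ∀ b → b ∨ not b ≡ true
      lem true  = refl
      lem false = refl
    final : ∀ v → full v ≡ true → relabel 2F 3F (relabel 1F 3F (lab v)) ≡ 3F
    final v _ = lem (S v) (F v)
      where
      lem : ∀ b c → relabel 2F 3F (relabel 1F 3F (if b then 3F else if c then 1F else 2F)) ≡ 3F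
      lem true  _     = refl
      lem false true  = refl
      lem false false = refl

-- The split case and the theorem

split-good : ∀ {n} {G : Graph n} → Rigid G → ∀ A → Uniform G A true → Uniform G (∁ A) false → Good G full (splitLab A)
split-good {G = G} R A uA uB = Good-set set (pieceGood _ R piece refl)
  where
  nowhere : ∀ {v} → A v ≡ false → ∁ A v ≡ false → ⊥
  nowhere h k rewrite h = case k of λ ()
  piece : Piece G A (∁ A)
  -- No vertex lies outside the two sides, so homogeneity is vacuous.
  piece = record { disjoint = λ v Av → cong not Av ; clique = uA ; independent = uB
                 ; homA = λ {v} h k → ⊥-elim (nowhere {v} h k) ; homB = λ {v} h k → ⊥-elim (nowhere {v} h k) }
  set : A ∪ ∁ A ≗ full
  set v with A v
  ... | true  = refl
  ... | false = refl

Rigid⇒cw : ∀ {n} {G : Graph (suc n)} → Rigid G → CwAtMost 5 G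
Rigid⇒cw {G = G} R with mixed? G
... | yes m = Good⇒cw R (MixedClass.everything R m)
... | no nm = let A , uA , uB = NotMixed.split R nm in Good⇒cw R (split-good R A uA uB)

theorem3 : ∀ {n : ℕ} (G : Graph (suc n)) → Unigraph G → CwAtMost 5 G
theorem3 G U = Rigid⇒cw {G = G} (rigid U)
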